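{- Let $\mathcal{F} \subseteq 2^{[n]}$ be an intersecting $B$-free family with $2 \le |F| \le n-2$ for all $F \in \mathcal{F}$. Then \[ \sum_{F\in\mathcal{F},\ |F|\le n/2}\frac{1}{\binom{n}{|F|-1}}+\sum_{F\in\mathcal{F},\ |F|>n/2}\frac{1}{\binom{n}{|F|}}\le 2. \]
   Context: $[n]=\{1,\dots,n\}$. A family is intersecting if any two of its members have nonempty intersection. The butterfly poset $B$ has four elements $w,x,y,z$ with relations $w,x\le y,z$. A family $\mathcal{F}$ is $B$-free if there are no four distinct sets $A_1,A_2,A_3,A_4\in\mathcal{F}$ with $A_1,A_2\subseteq A_3$ and $A_1,A_2\subseteq A_4$. -}

module Defs where

open import Data.Nat as ℕ using (ℕ; zero; suc; _*_; _≤_; _>_)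
open import Data.Nat.Combinatorics using (_C_)
open import Data.Integer using (+_)
open import Data.Rational using (ℚ; _/_; 0ℚ; _+_)
open import Data.Fin.Subset using (Subset; _⊆_; _∩_; ∣_∣; Nonempty)
open import Data.List using (List; []; _∷_)
open import Data.List.Membership.Propositional using (_∈_)
open import Data.List.Relation.Unary.Unique.Propositional using (Unique)
open import Data.Product using (_×_)
open import Relation.Binary.PropositionalEquality using (_≢_)
open import Relation.Nullary using (¬_; yes; no)

-- 1 / m as a rational, with the (never used here) convention 1/0 = 0
inv : ℕ → ℚ
inv zero = 0ℚ
inv (suc m) = + 1 / suc m

-- A family of subsets of [n] is a duplicate-free list of subsets.
Intersecting : ∀ {n} → List (Subset n) → Set
Intersecting {n} 𝓕 = ∀ {A B} → A ∈ 𝓕 → B ∈ 𝓕 → Nonempty (A ∩ B)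

BFree : ∀ {n} → List (Subset n) → Set
BFree {n} 𝓕 = ∀ {A₁ A₂ A₃ A₄} → A₁ ∈ 𝓕 → A₂ ∈ 𝓕 → A₃ ∈ 𝓕 → A₄ ∈ 𝓕 →
  A₁ ≢ A₂ → A₁ ≢ A₃ → A₁ ≢ A₄ → A₂ ≢ A₃ → A₂ ≢ A₄ → A₃ ≢ A₄ →
  ¬ (A₁ ⊆ A₃ × A₂ ⊆ A₃ × A₁ ⊆ A₄ × A₂ ⊆ A₄)

weight : ℕ → ℕ → ℚ
weight n k with 2 * k ℕ.≤? n
... | yes _ = inv (n C (k ℕ.∸ 1))
... | no _  = inv (n C k)

lhs : ∀ {n} → List (Subset n) → ℚ
lhs [] = 0ℚ
lhs {n} (F ∷ 𝓕) = weight n ∣ F ∣ + lhs 𝓕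

{-# OPTIONS --safe #-}
-- Greene, Katona and Kleitman: the members of an intersecting antichain that are intervals of a cyclic
-- ordering of [n], weighted by C(n,k) times the weight of a k-set, have total weight at most n.  On each
-- cycle this applies to the minimal and to the maximal intervals of 𝓕.  In a butterfly-free family a member
-- M lying strictly between two others has exactly one member A below it and one member C above it, so on a
-- cycle the two antichains together miss M only when A and C are both present, and they count M twice when
-- both are absent.  Averaged over all cycles this is harmless as soon as the probabilities that A,
-- respectively C, is an interval, given that M is one, add up to at most 1.  They are at most 2/|M| and
-- 2/(n-|M|), which settles n ≥ 9.  For n ≤ 5 there is no such M, and for n = 6, 7, 8 the deficit is paid by
-- the slack of the inequality on the cycles where |A| = 2, |M| = 3 or |M| = n-3, |C| = n-2; that slack is
-- verified by enumerating all intersecting antichains of intervals.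
module Submission where

open import Defs
open import Data.Bool.Base using (Bool; true; false; _∧_; _∨_; not; if_then_else_; T)
open import Data.Bool.ListAction using (all)
open import Data.Bool.Properties as Bool using (∧-conicalˡ; ∧-conicalʳ; T-∧; T-∨; T-≡; ∨-zeroʳ)
open import Data.Empty using (⊥; ⊥-elim)
open import Data.Fin.Base as Fin using (Fin)
import Data.Fin.Properties as Fin
open import Data.Fin.Subset using (Subset; ∣_∣; ⊤; _⊆_; _∩_; Nonempty)
open import Data.Fin.Subset.Properties using (_⊆?_; ⊆-antisym; ∣p∣≤n; x∈p∩q⁻; ⊆-trans)
import Data.Integer as ℤ
import Data.Integer
import Data.Integer.Properties as ℤ
import Data.Integer.Tactic.RingSolver as ℤSolver
open import Data.List.Base as List using (List; []; _∷_; _++_; map; length; applyUpTo; upTo; _∷ʳ_; allFin; replicate; cartesianProduct; tabulate)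
open import Data.List.Membership.Propositional using (_∈_)
open import Data.List.Membership.Propositional.Properties using (∈-allFin; ∈-applyUpTo⁺; ∈-upTo⁻; ∈-upTo⁺; ∈-cartesianProduct⁺; ∈-++⁺ˡ; ∈-++⁺ʳ)
open import Data.List.Properties as List using (length-applyUpTo)
open import Data.List.Relation.Binary.Pointwise as Pointwise using (Pointwise; []; _∷_)
open import Data.List.Relation.Unary.All as All using (All; []; _∷_)
open import Data.List.Relation.Unary.AllPairs using ([]; _∷_)
open import Data.List.Relation.Unary.Any using (here; there)
open import Data.List.Relation.Unary.Unique.Propositional using (Unique)
open import Data.List.Relation.Unary.Unique.Propositional.Properties as Unique using (allFin⁺)
open import Data.Nat as ℕ
open import Data.Nat.Combinatorics using (_C_; nCk≡n!/k![n-k]!; k![n∸k]!∣n!)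
open import Data.Nat.DivMod using (_/_; _%_; m/n*n≡m; m≡m%n+[m/n]*n; m%n<n)
open import Data.Nat.Divisibility using (_∣_; ∣-trans; m∣m*n; m≤n⇒m!∣n!)
open import Data.Nat.Properties
open import Data.Nat.Tactic.RingSolver using (solve-∀)
open import Data.Product using (_×_; _,_; proj₁; proj₂; ∃-syntax; uncurry)
open import Data.Product.Properties using (≡-dec)
open import Data.Rational as Q using (toℚᵘ)
import Data.Rational.Properties as Q
open import Data.Rational.Unnormalised as ℚᵘ using (ℚᵘ; mkℚᵘ; _≃_; *≡*; *≤*)
import Data.Rational.Unnormalised.Properties as ℚᵘ
open import Data.Sum using (_⊎_; inj₁; inj₂)
open import Data.Vec.Base as Vec using ([]; _∷_; lookup; _[_]≔_)
open import Data.Vec.Properties as Vec using (lookup∘update; lookup∘update′; []≔-commutes; lookup-replicate; []=⇒lookup; lookup⇒[]=)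
open import Function using (_∘_; id)
open import Function.Bundles using (Equivalence)
open import Relation.Binary.Definitions using (DecidableEquality; tri<; tri≈; tri>)
open import Relation.Binary.PropositionalEquality
open import Relation.Nullary using (¬_; Dec; yes; no; does)
open import Relation.Nullary.Decidable using (_→-dec_; from-yes; _×-dec_)

-- Finite sums

-- Why a sum of at most 1 suffices: by inclusion and exclusion, the probability that A and C are
-- both present minus the probability that both are absent is P(A) + P(C) - 1, however the two
-- events depend on each other. So only pairs of sets have to be counted. Inside an interval M of
-- size m, a subset of size a is an interval with probability (m - a + 1) / C(m,a); for 2 ≤ a < m
-- this is at most 2/m, with equality at a = 2 and a = m - 1. The bound for C is the same one
-- applied to complements. Both m and n - m are at least 3, and the critical case of 2n ≤ m(n - m)
-- is m = 3, which gives n ≥ 9. Cyclic orderings are modelled by all n! linear orderings, each read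
-- from n starting points; positions are natural numbers, and periodicity takes the place of
-- reduction modulo n. Weights are scaled by n!, so that everything before the final passage to
-- rationals is an inequality of natural numbers. Instead of subtracting, the argument adds the
-- second count of the middle sets to both sides and cancels it at the end.

⟦_⟧ : Bool → ℕ
⟦ true ⟧ = 1
⟦ false ⟧ = 0

⟦⟧≤1 : ∀ b → ⟦ b ⟧ ≤ 1
⟦⟧≤1 true = ≤-refl
⟦⟧≤1 false = z≤n

⟦yes⟧ : ∀ {p} {P : Set p} (d : Dec P) → P → ⟦ does d ⟧ ≡ 1
⟦yes⟧ (yes _) _ = refl
⟦yes⟧ (no ¬p) p = ⊥-elim (¬p p)

⟦no⟧ : ∀ {p} {P : Set p} (d : Dec P) → ¬ P → ⟦ does d ⟧ ≡ 0
⟦no⟧ (yes p) ¬p = ⊥-elim (¬p p)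
⟦no⟧ (no _) _ = refl

⟦⟧⁺ : ∀ {p} {P : Set p} (d : Dec P) → 0 < ⟦ does d ⟧ → P
⟦⟧⁺ (yes p) _ = p

pos-*ˡ : ∀ a b → 0 < a * b → 0 < a
pos-*ˡ (suc a) b _ = z<s

pos-*ʳ : ∀ a b → 0 < a * b → 0 < b
pos-*ʳ a zero p = ⊥-elim (<-irrefl refl (subst (0 <_) (*-zeroʳ a) p))
pos-*ʳ a (suc b) _ = z<s

pos-* : ∀ {a b} → 0 < a → 0 < b → 0 < a * b
pos-* {suc a} {suc b} _ _ = z<s

module _ {a} {A : Set a} where

  ∑ : List A → (A → ℕ) → ℕ
  ∑ [] f = 0
  ∑ (x ∷ xs) f = f x + ∑ xs f

  ∑-cong : ∀ xs {f g : A → ℕ} → (∀ {x} → x ∈ xs → f x ≡ g x) → ∑ xs f ≡ ∑ xs g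
  ∑-cong [] e = refl
  ∑-cong (x ∷ xs) e = cong₂ _+_ (e (here refl)) (∑-cong xs (e ∘ there))

  ∑-mono : ∀ xs {f g : A → ℕ} → (∀ {x} → x ∈ xs → f x ≤ g x) → ∑ xs f ≤ ∑ xs g
  ∑-mono [] e = z≤n
  ∑-mono (x ∷ xs) e = +-mono-≤ (e (here refl)) (∑-mono xs (e ∘ there))

  ∑-zero : ∀ xs → ∑ xs (λ _ → 0) ≡ 0
  ∑-zero [] = refl
  ∑-zero (x ∷ xs) = ∑-zero xs

  ∑-+ : ∀ xs (f g : A → ℕ) → ∑ xs (λ x → f x + g x) ≡ ∑ xs f + ∑ xs g
  ∑-+ [] f g = refl
  ∑-+ (x ∷ xs) f g rewrite ∑-+ xs f g = lemma (f x) (g x) (∑ xs f) (∑ xs g)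
    where
    lemma : ∀ a b c d → a + b + (c + d) ≡ a + c + (b + d)
    lemma = solve-∀

  ∑-*ˡ : ∀ c xs (f : A → ℕ) → ∑ xs (λ x → c * f x) ≡ c * ∑ xs f
  ∑-*ˡ c [] f = sym (*-zeroʳ c)
  ∑-*ˡ c (x ∷ xs) f rewrite ∑-*ˡ c xs f = sym (*-distribˡ-+ c (f x) (∑ xs f))

  ∑-*ʳ : ∀ c xs (f : A → ℕ) → ∑ xs (λ x → f x * c) ≡ ∑ xs f * c
  ∑-*ʳ c [] f = refl
  ∑-*ʳ c (x ∷ xs) f rewrite ∑-*ʳ c xs f = sym (*-distribʳ-+ c (f x) (∑ xs f))

  ∑-const : ∀ xs c → ∑ xs (λ _ → c) ≡ length xs * c
  ∑-const [] c = refl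
  ∑-const (x ∷ xs) c = cong (c +_) (∑-const xs c)

  ∑-++ : ∀ xs ys f → ∑ (xs ++ ys) f ≡ ∑ xs f + ∑ ys f
  ∑-++ [] ys f = refl
  ∑-++ (x ∷ xs) ys f rewrite ∑-++ xs ys f = sym (+-assoc (f x) (∑ xs f) (∑ ys f))

  ∑-term : ∀ {xs x} f → x ∈ xs → f x ≤ ∑ xs f
  ∑-term f (here refl) = m≤m+n _ _
  ∑-term f (there p) = ≤-trans (∑-term f p) (m≤n+m _ _)

  ∑-pos : ∀ xs f → 0 < ∑ xs f → ∃[ x ] (x ∈ xs × 0 < f x)
  ∑-pos (x ∷ xs) f p with f x in eq
  ... | suc _ = x , here refl , subst (0 <_) (sym eq) z<s
  ... | zero with y , y∈ , q ← ∑-pos xs f p = y , there y∈ , q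

  ∑-null : ∀ xs f → (∀ {x} → x ∈ xs → ¬ 0 < f x) → ∑ xs f ≡ 0
  ∑-null xs f none with ∑ xs f in eq
  ... | zero = refl
  ... | suc _ with x , x∈ , q ← ∑-pos xs f (subst (0 <_) (sym eq) z<s) = ⊥-elim (none x∈ q)

  ∑-single : ∀ {xs} f b → Unique xs → (∀ {x} → x ∈ xs → f x ≤ b) →
             (∀ {x y} → x ∈ xs → y ∈ xs → 0 < f x → 0 < f y → x ≡ y) → ∑ xs f ≤ b
  ∑-single {[]} f b u le one = z≤n
  ∑-single {x ∷ xs} f b (x∉ ∷ u) le one with f x in eq
  ... | zero = ∑-single f b u (le ∘ there) (λ p q → one (there p) (there q))
  ... | suc m = begin
    suc m + ∑ xs f ≡⟨ cong (suc m +_) (∑-null xs f λ y∈ p →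
                        All.lookup x∉ y∈ (one (here refl) (there y∈) (subst (0 <_) (sym eq) z<s) p)) ⟩
    suc m + 0      ≡⟨ +-identityʳ _ ⟩
    suc m          ≡⟨ eq ⟨
    f x            ≤⟨ le (here refl) ⟩
    b              ∎
    where open ≤-Reasoning

  ∑-only : ∀ {xs} f {x} → Unique xs → x ∈ xs → (∀ {y} → y ∈ xs → 0 < f y → y ≡ x) → ∑ xs f ≡ f x
  ∑-only f {x} u x∈ one = ≤-antisym
    (∑-single (λ y → f y) (f x) u bound (λ p q a b → trans (one p a) (sym (one q b))))
    (∑-term f x∈)
    where
    bound : ∀ {y} → y ∈ _ → f y ≤ f x
    bound {y} y∈ with f y in eq
    ... | zero = z≤n
    ... | suc _ = ≤-reflexive (trans (sym eq) (cong f (one y∈ (subst (0 <_) (sym eq) z<s))))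

∑-map : ∀ {a b} {A : Set a} {B : Set b} (h : A → B) xs f → ∑ (map h xs) f ≡ ∑ xs (f ∘ h)
∑-map h [] f = refl
∑-map h (x ∷ xs) f = cong (f (h x) +_) (∑-map h xs f)

∑-swap : ∀ {a b} {A : Set a} {B : Set b} (xs : List A) (ys : List B) (f : A → B → ℕ) →
         ∑ xs (λ x → ∑ ys (f x)) ≡ ∑ ys (λ y → ∑ xs (λ x → f x y))
∑-swap [] ys f = sym (∑-zero ys)
∑-swap (x ∷ xs) ys f = trans (cong (∑ ys (f x) +_) (∑-swap xs ys f))
                             (sym (∑-+ ys (f x) (λ y → ∑ xs (λ x → f x y))))

∑-applyUpTo : ∀ {a b} {A : Set a} {B : Set b} (h : A → B) (g : ℕ → A) n f →
              ∑ (applyUpTo (h ∘ g) n) f ≡ ∑ (applyUpTo g n) (f ∘ h)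
∑-applyUpTo h g zero f = refl
∑-applyUpTo h g (suc n) f = cong (f (h (g 0)) +_) (∑-applyUpTo h (g ∘ suc) n f)

∑< : ℕ → (ℕ → ℕ) → ℕ
∑< n = ∑ (upTo n)

∑<-suc : ∀ n f → ∑< (suc n) f ≡ f 0 + ∑< n (f ∘ suc)
∑<-suc n f = cong (f 0 +_) (∑-applyUpTo suc id n f)

∑<-+ : ∀ m n f → ∑< (m + n) f ≡ ∑< m f + ∑< n (f ∘ (m +_))
∑<-+ zero n f = refl
∑<-+ (suc m) n f = begin
  ∑< (suc (m + n)) f ≡⟨ ∑<-suc (m + n) f ⟩
  f 0 + ∑< (m + n) (f ∘ suc) ≡⟨ cong (f 0 +_) (∑<-+ m n (f ∘ suc)) ⟩
  f 0 + (∑< m (f ∘ suc) + rest) ≡⟨ +-assoc (f 0) (∑< m (f ∘ suc)) rest ⟨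
  f 0 + ∑< m (f ∘ suc) + rest ≡⟨ cong (_+ rest) (∑<-suc m f) ⟨
  ∑< (suc m) f + rest ∎
  where
  open ≡-Reasoning
  rest = ∑< n (λ x → f (suc (m + x)))

∑<-const : ∀ n c → ∑< n (λ _ → c) ≡ n * c
∑<-const n c = trans (∑-const (upTo n) c) (cong (_* c) (length-applyUpTo id n))

∑<-rotate : ∀ n f → (∀ s → f (s + n) ≡ f s) → ∑< n (f ∘ suc) ≡ ∑< n f
∑<-rotate n f per = +-cancelˡ-≡ (f 0) _ _ (begin
  f 0 + ∑< n (f ∘ suc)  ≡⟨ ∑<-suc n f ⟨
  ∑< (suc n) f          ≡⟨ cong (λ k → ∑< k f) (+-comm 1 n) ⟩
  ∑< (n + 1) f          ≡⟨ ∑<-+ n 1 f ⟩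
  ∑< n f + (f (n + 0) + 0) ≡⟨ cong (∑< n f +_) (trans (+-identityʳ _) (trans (cong f (+-identityʳ n)) (per 0))) ⟩
  ∑< n f + f 0          ≡⟨ +-comm (∑< n f) (f 0) ⟩
  f 0 + ∑< n f          ∎)
  where open ≡-Reasoning

-- Translation over a full period. It serves to move a shortest interval to 0, and to re-index a
-- pair of nested intervals by the start of the outer one.
∑<-shift : ∀ n f k → (∀ s → f (s + n) ≡ f s) → ∑< n (f ∘ (k +_)) ≡ ∑< n f
∑<-shift n f zero per = refl
∑<-shift n f (suc k) per = trans (∑-cong (upTo n) (λ {s} _ → cong f (sym (+-suc k s))))
  (trans (∑<-rotate n (f ∘ (k +_)) (λ s → trans (cong f (sym (+-assoc k s n))) (per (k + s))))
         (∑<-shift n f k per))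

-- Sums over the orderings of a set

module _ {n : ℕ} where

  infixl 6 _∖_
  _∖_ : Subset n → Fin n → Subset n
  R ∖ x = R [ x ]≔ false

  ∑F : (Fin n → ℕ) → ℕ
  ∑F = ∑ (allFin n)

  size : Subset n → ℕ
  size R = ∑F λ x → ⟦ lookup R x ⟧

  ∑F-at : ∀ x (g : Fin n → ℕ) → ∑F (λ y → ⟦ does (y Fin.≟ x) ⟧ * g y) ≡ g x
  ∑F-at x g = begin
    ∑F (λ y → ⟦ does (y Fin.≟ x) ⟧ * g y)
      ≡⟨ ∑-only _ (allFin⁺ n) (∈-allFin x) (λ {y} _ p → ⟦⟧⁺ (y Fin.≟ x) (pos-*ˡ _ (g y) p)) ⟩
    ⟦ does (x Fin.≟ x) ⟧ * g x ≡⟨ cong (_* g x) (⟦yes⟧ (x Fin.≟ x) refl) ⟩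
    1 * g x                    ≡⟨ *-identityˡ (g x) ⟩
    g x                        ∎
    where open ≡-Reasoning

  lookup-∖ : ∀ (R : Subset n) {x} y → lookup R x ≡ true →
             ⟦ lookup R y ⟧ ≡ ⟦ does (y Fin.≟ x) ⟧ + ⟦ lookup (R ∖ x) y ⟧
  lookup-∖ R {x} y Rx with y Fin.≟ x
  ... | yes refl rewrite lookup∘update x R false | Rx = refl
  ... | no y≢x rewrite lookup∘update′ y≢x R false = refl

  ∑F-∖ : ∀ (R : Subset n) {x} (g : Fin n → ℕ) → lookup R x ≡ true →
         ∑F (λ y → ⟦ lookup R y ⟧ * g y) ≡ g x + ∑F (λ y → ⟦ lookup (R ∖ x) y ⟧ * g y)
  ∑F-∖ R {x} g Rx = begin
    ∑F (λ y → ⟦ lookup R y ⟧ * g y)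
      ≡⟨ ∑-cong (allFin n) (λ {y} _ → trans (cong (_* g y) (lookup-∖ R y Rx))
           (*-distribʳ-+ (g y) ⟦ does (y Fin.≟ x) ⟧ _)) ⟩
    ∑F (λ y → ⟦ does (y Fin.≟ x) ⟧ * g y + ⟦ lookup (R ∖ x) y ⟧ * g y)
      ≡⟨ ∑-+ (allFin n) _ _ ⟩
    ∑F (λ y → ⟦ does (y Fin.≟ x) ⟧ * g y) + ∑F (λ y → ⟦ lookup (R ∖ x) y ⟧ * g y)
      ≡⟨ cong (_+ ∑F (λ y → ⟦ lookup (R ∖ x) y ⟧ * g y)) (∑F-at x g) ⟩
    g x + ∑F (λ y → ⟦ lookup (R ∖ x) y ⟧ * g y) ∎
    where open ≡-Reasoning

  ∖-comm : ∀ (R : Subset n) {x y} → x ≢ y → R ∖ x ∖ y ≡ R ∖ y ∖ x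
  ∖-comm R {x} {y} x≢y = []≔-commutes R x y x≢y

  size-∖ : ∀ (R : Subset n) {x} → lookup R x ≡ true → size R ≡ suc (size (R ∖ x))
  size-∖ R {x} Rx = begin
    size R ≡⟨ ∑-cong (allFin n) (λ _ → sym (*-identityʳ _)) ⟩
    ∑F (λ y → ⟦ lookup R y ⟧ * 1) ≡⟨ ∑F-∖ R (λ _ → 1) Rx ⟩
    suc (∑F (λ y → ⟦ lookup (R ∖ x) y ⟧ * 1)) ≡⟨ cong suc (∑-cong (allFin n) (λ _ → *-identityʳ _)) ⟩
    suc (size (R ∖ x)) ∎
    where open ≡-Reasoning

  -- The sum of f over all orderings of a k-element set R.
  E : ℕ → Subset n → (List (Fin n) → ℕ) → ℕ
  E zero    R f = f []
  E (suc k) R f = ∑F λ x → ⟦ lookup R x ⟧ * E k (R ∖ x) (f ∘ (x ∷_))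

  -- The two facts that the argument on a single cycle draws on: the length makes the n-th rotation
  -- the identity, and occurrence lets letterwise comparisons of words pass to all elements.
  record OrderingOf (k : ℕ) (R : Subset n) (π : List (Fin n)) : Set where
    constructor ordering
    field
      len : length π ≡ k
      all-occur : ∀ x → lookup R x ≡ true → x ∈ π

  E-mono : ∀ k R {f g} → size R ≡ k → (∀ π → OrderingOf k R π → f π ≤ g π) → E k R f ≤ E k R g
  E-mono zero R sz h = h [] (ordering refl λ x Rx → ⊥-elim
    (<-irrefl refl (subst (0 <_) (trans (sym (size-∖ R Rx)) sz) z<s)))
  E-mono (suc k) R {f} {g} sz h = ∑-mono (allFin n) λ {x} _ → step x (lookup R x) refl
    where
    step : ∀ x b → lookup R x ≡ b → ⟦ b ⟧ * E k (R ∖ x) (f ∘ (x ∷_)) ≤ ⟦ b ⟧ * E k (R ∖ x) (g ∘ (x ∷_))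
    step x false _ = z≤n
    step x true Rx = *-monoʳ-≤ 1 (E-mono k (R ∖ x) (suc-injective (trans (sym (size-∖ R Rx)) sz))
      λ π (ordering len occ) → h (x ∷ π) (ordering (cong suc len) λ y Ry → occurs occ y Ry))
      where
      occurs : ∀ {π} → (∀ y → lookup (R ∖ x) y ≡ true → y ∈ π) → ∀ y → lookup R y ≡ true → y ∈ x ∷ π
      occurs occ y Ry with y Fin.≟ x
      ... | yes refl = here refl
      ... | no y≢x = there (occ y (trans (lookup∘update′ y≢x R false) Ry))

  E-cong : ∀ k R {f g} → size R ≡ k → (∀ π → OrderingOf k R π → f π ≡ g π) → E k R f ≡ E k R g
  E-cong k R sz h = ≤-antisym (E-mono k R sz λ π o → ≤-reflexive (h π o))
                              (E-mono k R sz λ π o → ≤-reflexive (sym (h π o)))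

  E-ext : ∀ k R {f g} → (∀ π → f π ≡ g π) → E k R f ≡ E k R g
  E-ext zero R h = h []
  E-ext (suc k) R h = ∑-cong (allFin n) λ {x} _ → cong (⟦ lookup R x ⟧ *_) (E-ext k (R ∖ x) (h ∘ (x ∷_)))

  E-+ : ∀ k R f g → E k R (λ π → f π + g π) ≡ E k R f + E k R g
  E-+ zero R f g = refl
  E-+ (suc k) R f g = trans
    (∑-cong (allFin n) λ {x} _ → trans (cong (⟦ lookup R x ⟧ *_) (E-+ k (R ∖ x) _ _))
                                       (*-distribˡ-+ ⟦ lookup R x ⟧ _ _))
    (∑-+ (allFin n) _ _)

  E-0 : ∀ k R → E k R (λ _ → 0) ≡ 0
  E-0 zero R = refl
  E-0 (suc k) R = trans (∑-cong (allFin n) λ {x} _ → trans (cong (⟦ lookup R x ⟧ *_) (E-0 k (R ∖ x))) (*-zeroʳ ⟦ lookup R x ⟧))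
                        (∑-zero (allFin n))

  E-∑ : ∀ k R {a} {A : Set a} (xs : List A) (f : A → List (Fin n) → ℕ) →
        E k R (λ π → ∑ xs (λ x → f x π)) ≡ ∑ xs (λ x → E k R (f x))
  E-∑ k R [] f = E-0 k R
  E-∑ k R (x ∷ xs) f = trans (E-+ k R (f x) _) (cong (E k R (f x) +_) (E-∑ k R xs f))

  E-* : ∀ k R c f → E k R (λ π → c * f π) ≡ c * E k R f
  E-* k R c f = begin
    E k R (λ π → c * f π)            ≡⟨ E-ext k R (λ π → sym (∑<-const c (f π))) ⟩
    E k R (λ π → ∑< c (λ _ → f π))   ≡⟨ E-∑ k R (upTo c) (λ _ → f) ⟩
    ∑< c (λ _ → E k R f)             ≡⟨ ∑<-const c (E k R f) ⟩
    c * E k R f                      ∎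
    where open ≡-Reasoning

  -- By induction, choose the first element x and then the last element y. The remaining set
  -- `R ∖ x ∖ y` does not depend on the order of these choices, so the two outer sums can be
  -- exchanged.
  E-last : ∀ k R f → E (suc k) R f ≡ ∑F λ x → ⟦ lookup R x ⟧ * E k (R ∖ x) (λ π → f (π ∷ʳ x))
  E-last zero R f = refl
  E-last (suc k) R f = begin
    ∑F (λ x → ⟦ lookup R x ⟧ * E (suc k) (R ∖ x) (f ∘ (x ∷_)))
      ≡⟨ ∑-cong (allFin n) (λ {x} _ → trans (cong (⟦ lookup R x ⟧ *_) (E-last k (R ∖ x) (f ∘ (x ∷_)))) (sym (∑-*ˡ ⟦ lookup R x ⟧ (allFin n) _))) ⟩
    ∑F (λ x → ∑F λ y → ⟦ lookup R x ⟧ * (⟦ lookup (R ∖ x) y ⟧ * E k (R ∖ x ∖ y) (λ π → f (x ∷ π ∷ʳ y))))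
      ≡⟨ ∑-swap (allFin n) (allFin n) _ ⟩
    ∑F (λ y → ∑F λ x → ⟦ lookup R x ⟧ * (⟦ lookup (R ∖ x) y ⟧ * E k (R ∖ x ∖ y) (λ π → f (x ∷ π ∷ʳ y))))
      ≡⟨ ∑-cong (allFin n) (λ {y} _ → trans (∑-cong (allFin n) (λ {x} _ → exchange x y _)) (∑-*ˡ ⟦ lookup R y ⟧ (allFin n) _)) ⟩
    ∑F (λ y → ⟦ lookup R y ⟧ * E (suc k) (R ∖ y) (λ π → f (π ∷ʳ y))) ∎
    where
    open ≡-Reasoning
    swap : ∀ a b c → a * (b * c) ≡ b * (a * c)
    swap = solve-∀
    exchange : ∀ x y h → ⟦ lookup R x ⟧ * (⟦ lookup (R ∖ x) y ⟧ * E k (R ∖ x ∖ y) h) ≡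
                         ⟦ lookup R y ⟧ * (⟦ lookup (R ∖ y) x ⟧ * E k (R ∖ y ∖ x) h)
    exchange x y h with x Fin.≟ y
    ... | yes refl = refl
    ... | no x≢y rewrite lookup∘update′ x≢y R false | lookup∘update′ (x≢y ∘ sym) R false
                       | ∖-comm R x≢y = swap ⟦ lookup R x ⟧ ⟦ lookup R y ⟧ _

-- Rotations, and orderings with a prescribed word of colours

rot : ∀ {a} {A : Set a} → List A → List A
rot [] = []
rot (x ∷ xs) = xs ∷ʳ x

rot^ : ∀ {a} {A : Set a} → ℕ → List A → List A
rot^ zero xs = xs
rot^ (suc s) xs = rot^ s (rot xs)

E-rot : ∀ {n} k (R : Subset n) f → E k R (f ∘ rot) ≡ E k R f
E-rot zero R f = refl
E-rot (suc k) R f = sym (E-last k R f)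

E-rot^ : ∀ {n} k (R : Subset n) f s → E k R (f ∘ rot^ s) ≡ E k R f
E-rot^ k R f zero = refl
E-rot^ k R f (suc s) = trans (E-rot k R (f ∘ rot^ s)) (E-rot^ k R f s)

module Colouring {K : Set} (_≟_ : DecidableEquality K) where

  infix 4 _≟ˡ_
  _≟ˡ_ : DecidableEquality (List K)
  _≟ˡ_ = List.≡-dec _≟_

  count : K → List K → ℕ
  count c [] = 0
  count c (d ∷ ds) = ⟦ does (d ≟ c) ⟧ + count c ds

  -- This is the product of the factorials of the colour multiplicities, arranged as the places are
  -- filled from the left.
  fact : List K → ℕ
  fact [] = 1
  fact (c ∷ cs) = count c (c ∷ cs) * fact cs

  -- Exactly `count c (c ∷ p)` elements can stand first, and deleting any of them lowers only the
  -- count of its own colour, so the hypothesis passes to the tail.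
  E-count : ∀ {n} (col : Fin n → K) p (R : Subset n) →
            (∀ c → ∑F (λ x → ⟦ lookup R x ⟧ * ⟦ does (col x ≟ c) ⟧) ≡ count c p) →
            E (length p) R (λ π → ⟦ does (map col π ≟ˡ p) ⟧) ≡ fact p
  E-count col [] R h = refl
  E-count {n} col (c ∷ p) R h = begin
    ∑F (λ x → ⟦ lookup R x ⟧ * E (length p) (R ∖ x) (λ π → ⟦ does (col x ∷ map col π ≟ˡ c ∷ p) ⟧))
      ≡⟨ ∑-cong (allFin n) (λ {x} _ → trans (step x (lookup R x) refl) (sym (*-assoc ⟦ lookup R x ⟧ _ _))) ⟩
    ∑F (λ x → ⟦ lookup R x ⟧ * ⟦ does (col x ≟ c) ⟧ * fact p)
      ≡⟨ ∑-*ʳ (fact p) (allFin n) _ ⟩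
    ∑F (λ x → ⟦ lookup R x ⟧ * ⟦ does (col x ≟ c) ⟧) * fact p
      ≡⟨ cong (_* fact p) (h c) ⟩
    count c (c ∷ p) * fact p ∎
    where
    open ≡-Reasoning
    cons : ∀ x π → ⟦ does (col x ∷ map col π ≟ˡ c ∷ p) ⟧ ≡ ⟦ does (col x ≟ c) ⟧ * ⟦ does (map col π ≟ˡ p) ⟧
    cons x π with col x ≟ c
    ... | no _ = refl
    ... | yes _ = sym (+-identityʳ _)
    step : ∀ x b → lookup R x ≡ b →
           ⟦ b ⟧ * E (length p) (R ∖ x) (λ π → ⟦ does (col x ∷ map col π ≟ˡ c ∷ p) ⟧) ≡
           ⟦ b ⟧ * (⟦ does (col x ≟ c) ⟧ * fact p)
    step x false _ = refl
    step x true Rx = cong (1 *_) (trans (E-ext (length p) (R ∖ x) (cons x))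
      (trans (E-* (length p) (R ∖ x) ⟦ does (col x ≟ c) ⟧ _) (rest (col x ≟ c))))
      where
      rest : (d : Dec (col x ≡ c)) → ⟦ does d ⟧ * E (length p) (R ∖ x) (λ π → ⟦ does (map col π ≟ˡ p) ⟧) ≡ ⟦ does d ⟧ * fact p
      rest (no _) = refl
      rest (yes cx) = cong (1 *_) (E-count col p (R ∖ x) λ c' → +-cancelˡ-≡ ⟦ does (col x ≟ c') ⟧ _ _
        (trans (sym (∑F-∖ R (λ y → ⟦ does (col y ≟ c') ⟧) Rx))
               (trans (h c') (cong (λ d → ⟦ does (d ≟ c') ⟧ + count c' p) (sym cx)))))

-- Intersecting antichains of intervals of a cycle

-- W n l / n! is C(n,l) times the weight of an l-set.
W : ℕ → ℕ → ℕ
W n zero = 0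
W n l@(suc _) with 2 * l ≤? n
... | yes _ = (suc n ∸ l) * (n ! / l)
... | no _ = n !

W-large : ∀ {n l} → n < 2 * l → W n l ≡ n !
W-large {n} {zero} ()
W-large {n} {l@(suc _)} n<2l with 2 * l ≤? n
... | yes 2l≤n = ⊥-elim (<-irrefl refl (<-≤-trans n<2l 2l≤n))
... | no _ = refl

W-small : ∀ {n l} → 0 < l → 2 * l ≤ n → W n l * l ≡ (suc n ∸ l) * n !
W-small {n} {l@(suc l-1)} _ 2l≤n with 2 * l ≤? n
... | no 2l≰n = ⊥-elim (2l≰n 2l≤n)
... | yes _ = trans (*-assoc (suc n ∸ l) (n ! / l) l) (cong ((suc n ∸ l) *_) (m/n*n≡m l∣n!))
  where
  l∣n! : l ∣ n !
  l∣n! = ∣-trans (m∣m*n (l-1 !)) (m≤n⇒m!∣n! (≤-trans (m≤m+n l _) 2l≤n))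

-- The factor (n + 1 - l) / l decreases in l, and it is at least 1 as long as 2l ≤ n. Multiplying by
-- the lengths clears the divisions.
W-antitone : ∀ {n k l} → 0 < k → 2 * k ≤ n → k ≤ l → W n l ≤ W n k
W-antitone {n} {k@(suc _)} {l} 0<k 2k≤n k≤l with 2 * l ≤? n
... | no 2l≰n rewrite W-large {n} {l} (≰⇒> 2l≰n) = *-cancelʳ-≤ (n !) (W n k) k (begin
  n ! * k             ≡⟨ *-comm (n !) k ⟩
  k * n !             ≤⟨ *-monoˡ-≤ (n !) (m+n≤o⇒m≤o∸n k (≤-trans (≤-reflexive (cong (k +_) (sym (+-identityʳ k)))) (≤-trans 2k≤n (n≤1+n n)))) ⟩
  (suc n ∸ k) * n !   ≡⟨ W-small 0<k 2k≤n ⟨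
  W n k * k           ∎)
  where open ≤-Reasoning
... | yes 2l≤n = *-cancelʳ-≤ (W n l) (W n k) (l * k) {{m*n≢0 l k {{>-nonZero (≤-trans 0<k k≤l)}}}} (begin
  W n l * (l * k)           ≡⟨ *-assoc (W n l) l k ⟨
  W n l * l * k             ≡⟨ cong (_* k) (W-small (≤-trans 0<k k≤l) 2l≤n) ⟩
  (suc n ∸ l) * n ! * k     ≤⟨ *-mono-≤ (*-monoˡ-≤ (n !) (∸-monoʳ-≤ (suc n) k≤l)) k≤l ⟩
  (suc n ∸ k) * n ! * l     ≡⟨ cong (_* l) (W-small 0<k 2k≤n) ⟨
  W n k * k * l             ≡⟨ *-assoc (W n k) k l ⟩
  W n k * (k * l)           ≡⟨ cong (W n k *_) (*-comm k l) ⟩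
  W n k * (l * k)           ∎)
  where open ≤-Reasoning

lens : ℕ → List ℕ
lens n = applyUpTo (2 +_) (n ∸ 3)

lens! : ∀ n → Unique (lens n)
lens! n = Unique.applyUpTo⁺₁ (2 +_) (n ∸ 3) (λ i<j _ e → <⇒≢ i<j (+-cancelˡ-≡ 2 _ _ e))

∈-lens : ∀ {n l} → 2 ≤ l → l + 2 ≤ n → l ∈ lens n
∈-lens {n} {suc (suc l)} (s≤s (s≤s z≤n)) l+2≤n =
  ∈-applyUpTo⁺ (2 +_) (m+n≤o⇒m≤o∸n (suc l) (≤-trans (≤-reflexive (eq l)) l+2≤n))
  where
  eq : ∀ l → suc l + 3 ≡ 2 + l + 2
  eq = solve-∀

-- How two intervals of an n-cycle, of lengths l and l' and with the second starting d places
-- after the first, can fail to be intersecting and incomparable.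
data Clash (n l d l' : ℕ) : Set where
  nested : l' < l → d + l' ≤ l → Clash n l d l'
  apart  : l ≤ d → d + l' ≤ n → Clash n l d l'

-- B s l is 1 if the interval of length l starting at s is in the family, and 0 otherwise.
record IntersectingAntichain (n : ℕ) (B : ℕ → ℕ → ℕ) : Set where
  field
    periodic : ∀ s l → B (s + n) l ≡ B s l
    ≤1       : ∀ s l → B s l ≤ 1
    range    : ∀ s l → 0 < B s l → 2 ≤ l × l + 2 ≤ n
    no-clash : ∀ s l d l' → 0 < B s l → 0 < B (s + d) l' → ¬ Clash n l d l'

  0<l : ∀ {s l} → 0 < B s l → 0 < l
  0<l b = ≤-trans (s≤s z≤n) (proj₁ (range _ _ b))

  periodic* : ∀ s l m → B (s + m * n) l ≡ B s l
  periodic* s l zero = cong (λ t → B t l) (+-identityʳ s)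
  periodic* s l (suc m) = trans (cong (λ t → B t l) (trans (cong (s +_) (+-comm n (m * n))) (sym (+-assoc s (m * n) n))))
                                (trans (periodic (s + m * n) l) (periodic* s l m))

  mod : .{{_ : NonZero n}} → ∀ s l → B s l ≡ B (s % n) l
  mod s l = trans (cong (λ t → B t l) (m≡m%n+[m/n]*n s n)) (periodic* (s % n) l (s / n))

  one-length : ∀ {s l l'} → 0 < B s l → 0 < B s l' → l ≡ l'
  one-length {s} {l} {l'} b b' with <-cmp l l'
  ... | tri≈ _ eq _ = eq
  ... | tri< l<l' _ _ = ⊥-elim (no-clash s l' 0 l b' (subst (λ t → 0 < B t l) (sym (+-identityʳ s)) b) (nested l<l' (<⇒≤ l<l')))
  ... | tri> _ _ l'<l = ⊥-elim (no-clash s l 0 l' b (subst (λ t → 0 < B t l') (sym (+-identityʳ s)) b') (nested l'<l (<⇒≤ l'<l)))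

  private
    later : ∀ {s l s' l'} → 0 < B s l → 0 < B s' l' → s + l ≡ s' + l' → ¬ s < s'
    later {s} {l} {s'} {l'} b b' eq s<s' with d , refl ← m≤n⇒∃[o]m+o≡n (<⇒≤ s<s') =
      no-clash s l d l' b b' (nested (subst (l' <_) (sym len) (m<n+m l' (n≢0⇒n>0 d≢0))) (≤-reflexive (sym len)))
      where
      len : l ≡ d + l'
      len = +-cancelˡ-≡ s l (d + l') (trans eq (+-assoc s d l'))
      d≢0 : d ≢ 0
      d≢0 refl = <-irrefl (sym (+-identityʳ s)) s<s'

  one-end : ∀ {s l s' l'} → 0 < B s l → 0 < B s' l' → s + l ≡ s' + l' → s ≡ s'
  one-end {s} {l} {s'} {l'} b b' eq with <-cmp s s'
  ... | tri≈ _ s≡s' _ = s≡s'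
  ... | tri< s<s' _ _ = ⊥-elim (later b b' eq s<s')
  ... | tri> _ _ s'<s = ⊥-elim (later b' b (sym eq) s'<s)

  at : ℕ → ℕ
  at s = ∑ (lens n) λ l → W n l * B s l

  WB≤ : ∀ {b} s l → (0 < B s l → W n l ≤ b) → W n l * B s l ≤ b
  WB≤ {b} s l h with B s l | ≤1 s l
  ... | zero | _ = ≤-trans (≤-reflexive (*-zeroʳ (W n l))) z≤n
  ... | suc zero | _ = ≤-trans (≤-reflexive (*-identityʳ (W n l))) (h z<s)
  ... | suc (suc _) | s≤s ()

  at≤ : ∀ {b} s → (∀ l → 0 < B s l → W n l ≤ b) → at s ≤ b
  at≤ {b} s h = ∑-single _ b (lens! n) (λ {l} _ → WB≤ s l (h l))
    λ {l} {l'} _ _ p q → one-length (pos-*ʳ (W n l) _ p) (pos-*ʳ (W n l') _ q)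

  total : ℕ
  total = ∑< n at

  total≤-large : (∀ s l → 0 < B s l → n < 2 * l) → total ≤ n * n !
  total≤-large h = begin
    ∑< n at ≤⟨ ∑-mono (upTo n) (λ {s} _ → at≤ s λ l b → ≤-reflexive (W-large {l = l} (h s l b))) ⟩
    ∑< n (λ _ → n !) ≡⟨ ∑<-const n (n !) ⟩
    n * n ! ∎
    where open ≤-Reasoning

module _ {n B} (sys : IntersectingAntichain n B) where
  open IntersectingAntichain sys

  shift : ∀ s₀ → IntersectingAntichain n (λ s → B (s₀ + s))
  shift s₀ = record
    { periodic = λ s l → trans (cong (λ t → B t l) (sym (+-assoc s₀ s n))) (periodic (s₀ + s) l)
    ; ≤1 = λ s → ≤1 (s₀ + s)
    ; range = λ s → range (s₀ + s)
    ; no-clash = λ s l d l' b b' → no-clash (s₀ + s) l d l' b (subst (λ t → 0 < B t l') (sym (+-assoc s₀ s d)) b')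
    }

  total-shift : ∀ s₀ → IntersectingAntichain.total (shift s₀) ≡ total
  total-shift s₀ = ∑<-shift n at s₀ λ s → ∑-cong (lens n) λ {l} _ → cong (W n l *_) (periodic s l)

-- With [0,k) a shortest member and k ≤ n/2, every other member either starts at some 1 ≤ g < k
-- or ends at some n + g; two members sharing a gap g are not both short, since they intersect.
module Gaps {k' r B} (sys : IntersectingAntichain (suc k' + r) B) (b₀ : 0 < B 0 (suc k'))
            (2k≤n : 2 * suc k' ≤ suc k' + r) (shortest : ∀ {s l} → 0 < B s l → suc k' ≤ l) where
  open IntersectingAntichain sys

  private
    k n : ℕ
    k = suc k'
    n = k + r

  short : ∀ {s l} → 0 < B s l → W n l ≤ W n k
  short b = W-antitone z<s 2k≤n (shortest b)

  ending : ℕ → ℕ → ℕ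
  ending s g = ∑ (lens n) λ l → W n l * B s l * ⟦ does (s + l ≟ suc (n + g)) ⟧

  ending⁺ : ∀ {s g l} → 0 < W n l * B s l * ⟦ does (s + l ≟ suc (n + g)) ⟧ → 0 < B s l × s + l ≡ suc (n + g)
  ending⁺ {s} {g} {l} p = pos-*ʳ (W n l) _ (pos-*ˡ _ _ p) , ⟦⟧⁺ (s + l ≟ suc (n + g)) (pos-*ʳ (W n l * B s l) _ p)

  -- A member starting outside [0,k) must run past n in order to meet [0,k), and must stop before n
  -- + k because it would otherwise contain the copy [n,n+k).
  end-gap : ∀ i l → 0 < B (k + i) l → i < r → ∃[ g ] (g < k' × k + i + l ≡ suc (n + g))
  end-gap i l b i<r with k + i + l ≤? n
  ... | yes fits = ⊥-elim (no-clash 0 k (k + i) l b₀ b (apart (m≤m+n k i) fits))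
  ... | no over with g , eq ← m≤n⇒∃[o]m+o≡n (≰⇒> over) with g <? k'
  ...   | yes g<k' = g , g<k' , sym eq
  ...   | no g≮k' with d , n≡ ← m≤n⇒∃[o]m+o≡n (<⇒≤ (+-monoʳ-< k i<r)) = ⊥-elim (no-clash (k + i) l d k b
            (subst (λ t → 0 < B t k) (sym n≡) (subst (0 <_) (sym (periodic 0 k)) b₀))
            (nested k<l d+k≤l))
    where
    open ≤-Reasoning
    d+k≤l : d + k ≤ l
    d+k≤l = +-cancelˡ-≤ (k + i) (d + k) l (begin
      k + i + (d + k)  ≡⟨ +-assoc (k + i) d k ⟨
      k + i + d + k    ≡⟨ cong (_+ k) n≡ ⟩
      n + suc k'       ≡⟨ +-suc n k' ⟩
      suc (n + k')     ≤⟨ s≤s (+-monoʳ-≤ n (≮⇒≥ g≮k')) ⟩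
      suc (n + g)      ≡⟨ eq ⟩
      k + i + l        ∎)
    d≢0 : d ≢ 0
    d≢0 refl = <-irrefl (trans (sym (+-identityʳ (k + i))) n≡) (+-monoʳ-< k i<r)
    k<l : k < l
    k<l = <-≤-trans (m<n+m k (n≢0⇒n>0 d≢0)) d+k≤l

  tail≤ : ∀ i → i < r → at (k + i) ≤ ∑< k' (ending (k + i))
  tail≤ i i<r = begin
    ∑ (lens n) (λ l → W n l * B (k + i) l)
      ≤⟨ ∑-mono (lens n) (λ {l} _ → term l) ⟩
    ∑ (lens n) (λ l → ∑< k' λ g → W n l * B (k + i) l * ⟦ does (k + i + l ≟ suc (n + g)) ⟧)
      ≡⟨ ∑-swap (lens n) (upTo k') _ ⟩
    ∑< k' (ending (k + i)) ∎
    where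
    open ≤-Reasoning
    term : ∀ l → W n l * B (k + i) l ≤ ∑< k' λ g → W n l * B (k + i) l * ⟦ does (k + i + l ≟ suc (n + g)) ⟧
    term l with 0 <? B (k + i) l
    ... | no b≮0 rewrite n≤0⇒n≡0 (≮⇒≥ b≮0) | *-zeroʳ (W n l) = z≤n
    ... | yes b with g , g<k' , eq ← end-gap i l b i<r = begin
      W n l * B (k + i) l ≡⟨ *-identityʳ _ ⟨
      W n l * B (k + i) l * 1 ≡⟨ cong (W n l * B (k + i) l *_) (⟦yes⟧ (k + i + l ≟ suc (n + g)) eq) ⟨
      W n l * B (k + i) l * ⟦ does (k + i + l ≟ suc (n + g)) ⟧ ≤⟨ ∑-term _ (∈-upTo⁺ g<k') ⟩
      ∑< k' (λ g → W n l * B (k + i) l * ⟦ does (k + i + l ≟ suc (n + g)) ⟧) ∎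

  endings : ℕ → ℕ
  endings g = ∑< r λ i → ending (k + i) g

  endings≤ : ∀ {b} g → (∀ s l → 0 < B s l → s + l ≡ suc (n + g) → W n l ≤ b) → endings g ≤ b
  endings≤ {b} g h = ∑-single _ b (Unique.upTo⁺ r)
    (λ {i} _ → ∑-single _ b (lens! n) (λ {l} _ → bound (k + i) l)
      λ {l} {l'} _ _ p q → one-length (proj₁ (ending⁺ {k + i} {g} {l} p)) (proj₁ (ending⁺ {k + i} {g} {l'} q)))
    λ {i} {i'} _ _ p q → +-cancelˡ-≡ k i i' (unique (k + i) (k + i') p q)
    where
    bound : ∀ s l → W n l * B s l * ⟦ does (s + l ≟ suc (n + g)) ⟧ ≤ b
    bound s l = by (s + l ≟ suc (n + g))
      where
      by : (d : Dec (s + l ≡ suc (n + g))) → W n l * B s l * ⟦ does d ⟧ ≤ b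
      by (yes eq) = ≤-trans (≤-reflexive (*-identityʳ _)) (WB≤ s l λ b → h s l b eq)
      by (no _) = ≤-trans (≤-reflexive (*-zeroʳ (W n l * B s l))) z≤n
    unique : ∀ s s' → 0 < ending s g → 0 < ending s' g → s ≡ s'
    unique s s' p q with l , _ , pl ← ∑-pos (lens n) _ p | l' , _ , ql ← ∑-pos (lens n) _ q
      with b , e ← ending⁺ {s} {g} {l} pl | b' , e' ← ending⁺ {s'} {g} {l'} ql = one-end b b' (trans e (sym e'))

  pair : ∀ g → at (suc g) + endings g ≤ W n k + n !
  pair g with 0 <? at (suc g)
  ... | no a≮0 rewrite n≤0⇒n≡0 (≮⇒≥ a≮0) = ≤-trans (endings≤ g λ s l b _ → short b) (m≤m+n _ _)
  ... | yes a with l , _ , p ← ∑-pos (lens n) _ a with n <? 2 * l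
  ...   | yes large = ≤-trans (+-mono-≤ {u = endings g} (at≤ (suc g) λ l' b → ≤-reflexive (trans (cong (W n) (one-length b (pos-*ʳ (W n l) _ p))) (W-large {l = l} large)))
                                (endings≤ g λ s l b _ → short b))
                              (≤-reflexive (+-comm (n !) (W n k)))
  ...   | no small = +-mono-≤ (at≤ (suc g) λ l b → short b) (endings≤ g λ s l' b' eq → ≤-reflexive (W-large {l = l'} (≰⇒> λ small' →
            disjoint s l' b' eq (≮⇒≥ small) small')))
    where
    open ≤-Reasoning
    -- The second interval ends at `suc g + n`, exactly where the first one begins a full turn
    -- later. Two such neighbours of length at most n/2 cannot overlap at their other ends either.
    disjoint : ∀ s l' → 0 < B s l' → s + l' ≡ suc (n + g) → 2 * l ≤ n → ¬ 2 * l' ≤ n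
    disjoint s l' b' eq small small' with d , e ← m≤n⇒∃[o]m+o≡n {suc g} {s} (+-cancelʳ-≤ l' (suc g) s (begin
         suc g + l' ≤⟨ +-monoʳ-≤ (suc g) (≤-trans (m≤m+n l' _) small') ⟩
         suc g + n  ≡⟨ cong suc (+-comm g n) ⟩
         suc (n + g) ≡⟨ eq ⟨
         s + l' ∎)) = no-clash (suc g) l d l' (pos-*ʳ (W n l) _ p) (subst (λ t → 0 < B t l') (sym e) b')
           (apart (+-cancelʳ-≤ l' l d (≤-trans l+l'≤n (≤-reflexive (sym d+l')))) (≤-reflexive d+l'))
      where
      d+l' : d + l' ≡ n
      d+l' = +-cancelˡ-≡ (suc g) (d + l') n (begin-equality
        suc g + (d + l') ≡⟨ +-assoc (suc g) d l' ⟨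
        suc g + d + l'   ≡⟨ cong (_+ l') e ⟩
        s + l'           ≡⟨ eq ⟩
        suc (n + g)      ≡⟨ cong suc (+-comm n g) ⟩
        suc g + n        ∎)
      l+l'≤n : l + l' ≤ n
      l+l'≤n = *-cancelˡ-≤ 2 (begin
        2 * (l + l')     ≡⟨ *-distribˡ-+ 2 l l' ⟩
        2 * l + 2 * l'   ≤⟨ +-mono-≤ small small' ⟩
        n + n            ≡⟨ cong (n +_) (+-identityʳ n) ⟨
        2 * n ∎)

  -- The member at 0 contributes at most `W n k`, and each of the k - 1 gaps at most `W n k + n !`.
  -- Since k times `W n k` is (n + 1 - k) n!, these bounds add up to exactly n times n!: the weight
  -- of short sets is the one that balances here.
  total≤-short : total ≤ n * n !
  total≤-short = begin
    ∑< n at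
      ≡⟨ ∑<-+ k r at ⟩
    ∑< k at + ∑< r (at ∘ (k +_))
      ≡⟨ cong (_+ ∑< r (at ∘ (k +_))) (∑<-suc k' at) ⟩
    at 0 + ∑< k' (at ∘ suc) + ∑< r (at ∘ (k +_))
      ≤⟨ +-monoʳ-≤ (at 0 + ∑< k' (at ∘ suc)) (∑-mono (upTo r) λ {i} i∈ → tail≤ i (∈-upTo⁻ i∈)) ⟩
    at 0 + ∑< k' (at ∘ suc) + ∑< r (λ i → ∑< k' (ending (k + i)))
      ≡⟨ cong (at 0 + ∑< k' (at ∘ suc) +_) (∑-swap (upTo r) (upTo k') λ i → ending (k + i)) ⟩
    at 0 + ∑< k' (at ∘ suc) + ∑< k' endings
      ≡⟨ +-assoc (at 0) _ _ ⟩
    at 0 + (∑< k' (at ∘ suc) + ∑< k' endings)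
      ≡⟨ cong (at 0 +_) (∑-+ (upTo k') (at ∘ suc) endings) ⟨
    at 0 + ∑< k' (λ g → at (suc g) + endings g)
      ≤⟨ +-mono-≤ (at≤ 0 λ l b → short b) (∑-mono (upTo k') λ {g} _ → pair g) ⟩
    W n k + ∑< k' (λ _ → W n k + n !)
      ≡⟨ cong (W n k +_) (∑<-const k' _) ⟩
    W n k + k' * (W n k + n !)
      ≡⟨ regroup k' (W n k) (n !) ⟩
    W n k * k + k' * n !
      ≡⟨ cong (_+ k' * n !) (W-small z<s 2k≤n) ⟩
    (n ∸ k') * n ! + k' * n !
      ≡⟨ *-distribʳ-+ (n !) (n ∸ k') k' ⟨
    (n ∸ k' + k') * n !
      ≡⟨ cong (_* n !) (m∸n+n≡m (≤-trans (m≤m+n k' r) (n≤1+n _))) ⟩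
    n * n ! ∎
    where
    open ≤-Reasoning
    regroup : ∀ a w d → w + a * (w + d) ≡ w * suc a + a * d
    regroup = solve-∀

-- If all lengths exceed n/2, each start carries at most n!; a search that finds no length up to n
-- ends in this case too. Otherwise a shortest member is rotated to 0 and the gap argument applies.
gkk : ∀ {n B} → (sys : IntersectingAntichain n B) → IntersectingAntichain.total sys ≤ n * n !
gkk {zero} sys = z≤n
gkk {n@(suc _)} {B} sys = cases (search (suc n))
  where
  open IntersectingAntichain sys
  none-short : ℕ → Set
  none-short k = ∀ {s l} → 0 < B s l → k ≤ l
  search : ∀ j → none-short j ⊎ ∃[ k ] ∃[ s ] (0 < B s k × none-short k)
  search zero = inj₁ λ _ → z≤n
  search (suc j) with search j
  ... | inj₂ found = inj₂ found
  ... | inj₁ none with anyUpTo? (λ s → 0 <? B s j) n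
  ...   | yes (s , _ , b) = inj₂ (j , s , b , none)
  ...   | no nothing = inj₁ λ {s} {l} b → ≤∧≢⇒< (none b) λ { refl →
            nothing (s % n , m%n<n s n , subst (0 <_) (mod s j) b) }
  cases : none-short (suc n) ⊎ ∃[ k ] ∃[ s ] (0 < B s k × none-short k) → total ≤ n * n !
  cases (inj₁ none) = total≤-large λ s l b → ≤-trans (none b) (m≤m+n l _)
  cases (inj₂ (k , s , b , none)) with 2 * k ≤? n
  ... | no large = total≤-large λ s l b → <-≤-trans (≰⇒> large) (*-monoʳ-≤ 2 (none b))
  ... | yes 2k≤n = ≤-trans (≤-reflexive (sym (total-shift sys s))) (short-case k b 2k≤n none)
    where
    short-case : ∀ k → 0 < B s k → 2 * k ≤ n → none-short k → IntersectingAntichain.total (shift sys s) ≤ n * n !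
    short-case k b 2k≤n none with 0<l b | m≤n⇒∃[o]m+o≡n (≤-trans (m≤m+n k _) 2k≤n)
    short-case (suc k') b 2k≤n none | _ | r , refl =
      Gaps.total≤-short {k'} {r} (shift sys s) (subst (λ t → 0 < B t (suc k')) (sym (+-identityʳ s)) b) 2k≤n none

-- The slack for n = 6, 7, 8, by exhaustive search

gap : ℕ → ℕ → ℕ → ℕ
gap n s s' = if s ≤ᵇ s' then s' ∸ s else n + s' ∸ s

gap-spec : ∀ {n s} s' → s < n → s + gap n s s' ≡ s' ⊎ s + gap n s s' ≡ s' + n
gap-spec {n} {s} s' s<n with s ≤ᵇ s' in eq
... | true = inj₁ (m+[n∸m]≡n (≤ᵇ⇒≤ s s' (subst T (sym eq) _)))
... | false = inj₂ (trans (m+[n∸m]≡n (≤-trans (<⇒≤ s<n) (m≤m+n n s'))) (+-comm n s'))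

next : ℕ → ℕ → ℕ
next n s = if suc s ≡ᵇ n then 0 else suc s

next-spec : ∀ n s → next n s ≡ suc s ⊎ next n s + n ≡ suc s
next-spec n s with suc s ≡ᵇ n in eq
... | true = inj₂ (sym (≡ᵇ⇒≡ (suc s) n (subst T (sym eq) _)))
... | false = inj₁ refl

next< : ∀ {n s} → s < n → next n s < n
next< {n} {s} s<n with suc s ≡ᵇ n in eq
... | true = ≤-trans (s≤s z≤n) s<n
... | false = ≤∧≢⇒< s<n λ e → subst T eq (≡⇒≡ᵇ (suc s) n e)

clash : ℕ → ℕ → ℕ → ℕ → Bool
clash n l d l' = ((l' <ᵇ l) ∧ (d + l' ≤ᵇ l)) ∨ ((l ≤ᵇ d) ∧ (d + l' ≤ᵇ n))

clash⇒Clash : ∀ n l d l' → T (clash n l d l') → Clash n l d l'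
clash⇒Clash n l d l' t with Equivalence.to T-∨ t
... | inj₁ i with p , q ← Equivalence.to (T-∧ {l' <ᵇ l}) i = nested (<ᵇ⇒< l' l p) (≤ᵇ⇒≤ (d + l') l q)
... | inj₂ a with p , q ← Equivalence.to (T-∧ {l ≤ᵇ d}) a = apart (≤ᵇ⇒≤ l d p) (≤ᵇ⇒≤ (d + l') n q)

Interval : Set
Interval = ℕ × ℕ

Compatible : ℕ → Interval → Interval → Set
Compatible n (s , l) (s' , l') = ¬ Clash n l (gap n s s') l' × ¬ Clash n l' (gap n s' s) l

compat : ℕ → Interval → Interval → Bool
compat n (s , l) (s' , l') = not (clash n l (gap n s s') l') ∧ not (clash n l' (gap n s' s) l)

compat⁺ : ∀ {n} c d → Compatible n c d → compat n c d ≡ true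
compat⁺ {n} (s , l) (s' , l') (p , q)
  with clash n l (gap n s s') l' in e | clash n l' (gap n s' s) l in e'
... | true | _ = ⊥-elim (p (clash⇒Clash n l _ l' (subst T (sym e) _)))
... | false | true = ⊥-elim (q (clash⇒Clash n l' _ l (subst T (sym e') _)))
... | false | false = refl

same : Interval → Interval → Bool
same (s , l) (s' , l') = (s ≡ᵇ s') ∧ (l ≡ᵇ l')

same-refl : ∀ c → same c c ≡ true
same-refl (s , l) rewrite Equivalence.to T-≡ (≡⇒≡ᵇ s s refl) = Equivalence.to T-≡ (≡⇒≡ᵇ l l refl)

member : Interval → List Interval → Bool
member c [] = false
member c (d ∷ ds) = same c d ∨ member c ds

member⁺ : ∀ {c ds} → c ∈ ds → member c ds ≡ true
member⁺ {c} (here refl) rewrite same-refl c = refl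
member⁺ {c} {d ∷ ds} (there p) rewrite member⁺ p = ∨-zeroʳ (same c d)

all⁺ : ∀ {a} {A : Set a} {p : A → Bool} xs → (∀ {x} → x ∈ xs → p x ≡ true) → all p xs ≡ true
all⁺ [] h = refl
all⁺ (x ∷ xs) h rewrite h (here refl) = all⁺ xs (h ∘ there)

-- m could be added to the chosen antichain, were it not for its comparability with a.
extends : ℕ → Interval → Interval → List Interval → Bool
extends n a m ch = member a ch ∧ all (λ b → same b a ∨ compat n b m) ch

-- pen₁ is charged for a middle set [s,s+3) above a minimal set [s,s+2), and pen₂ for a middle
-- set [s+1,s+n-2) below a maximal set [s,s+n-2).  The slack of the inequality gkk pays for both.
pen₁ : ℕ → ℕ
pen₁ 6 = 720
pen₁ 7 = 5040
pen₁ 8 = 40320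
pen₁ _ = 0

pen₂ : ℕ → ℕ
pen₂ 6 = 240
pen₂ 7 = 2520
pen₂ 8 = 20160
pen₂ _ = 0

charge : ℕ → List Interval → ℕ → ℕ
charge n ch s = pen₁ n * ⟦ extends n (s , 2) (s , 3) ch ⟧
              + pen₂ n * ⟦ extends n (s , n ∸ 2) (next n s , n ∸ 3) ch ⟧

-- A depth-first search over all pairwise compatible sets of candidates: the first conjunct discards
-- c, the second takes it unless it clashes with an earlier choice. `acc` carries the weight chosen
-- so far, and the inequality is tested at the leaves.
check : ℕ → List Interval → List Interval → ℕ → Bool
check n [] ch acc = acc + ∑< n (charge n ch) ≤ᵇ n * n !
check n (c ∷ cs) ch acc = check n cs ch acc ∧
  (if all (compat n c) ch then check n cs (c ∷ ch) (acc + W n (proj₂ c)) else true)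

intervals : ℕ → List Interval
intervals n = cartesianProduct (upTo n) (lens n)

∑-cartesianProduct : ∀ {A B : Set} (xs : List A) (ys : List B) f →
                     ∑ (cartesianProduct xs ys) f ≡ ∑ xs λ x → ∑ ys λ y → f (x , y)
∑-cartesianProduct [] ys f = refl
∑-cartesianProduct (x ∷ xs) ys f = trans (∑-++ (map (x ,_) ys) _ f)
  (cong₂ _+_ (∑-map (x ,_) ys f) (∑-cartesianProduct xs ys f))

module Sound {n} (P : Interval → Set) (P? : ∀ c → Dec (P c))
             (pairwise : ∀ {c d} → P c → P d → Compatible n c d) where

  select : List Interval → List Interval → List Interval
  select [] ch = ch
  select (c ∷ cs) ch with P? c
  ... | yes _ = select cs (c ∷ ch)
  ... | no _ = select cs ch

  select⁺ : ∀ cs {ch c} → P c → c ∈ cs ⊎ c ∈ ch → c ∈ select cs ch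
  select⁺ [] p (inj₂ c∈) = c∈
  select⁺ (d ∷ cs) p c∈ with P? d
  select⁺ (d ∷ cs) p (inj₁ (here refl)) | yes _ = select⁺ cs p (inj₂ (here refl))
  select⁺ (d ∷ cs) p (inj₁ (here refl)) | no ¬p = ⊥-elim (¬p p)
  select⁺ (d ∷ cs) p (inj₁ (there c∈)) | yes _ = select⁺ cs p (inj₁ c∈)
  select⁺ (d ∷ cs) p (inj₁ (there c∈)) | no _ = select⁺ cs p (inj₁ c∈)
  select⁺ (d ∷ cs) p (inj₂ c∈) | yes _ = select⁺ cs p (inj₂ (there c∈))
  select⁺ (d ∷ cs) p (inj₂ c∈) | no _ = select⁺ cs p (inj₂ c∈)

  select⁻ : ∀ cs {ch c} → (∀ {d} → d ∈ ch → P d) → c ∈ select cs ch → P c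
  select⁻ [] all c∈ = all c∈
  select⁻ (d ∷ cs) all c∈ with P? d
  ... | yes p = select⁻ cs (λ { (here refl) → p ; (there q) → all q }) c∈
  ... | no _ = select⁻ cs all c∈

  -- Deciding every candidate by `P?` traces one branch of the search, and `select` computes the
  -- choice at its leaf. Pairwise compatibility keeps this branch from being pruned, so its
  -- inequality has been tested.
  sound : ∀ cs ch acc → (∀ {d} → d ∈ ch → P d) → check n cs ch acc ≡ true →
          acc + ∑ cs (λ c → W n (proj₂ c) * ⟦ does (P? c) ⟧) + ∑< n (charge n (select cs ch)) ≤ n * n !
  sound [] ch acc all ok rewrite +-identityʳ acc = ≤ᵇ⇒≤ _ _ (subst T (sym ok) _)
  sound (c ∷ cs) ch acc all ok with P? c
  ... | no _ rewrite *-zeroʳ (W n (proj₂ c)) = sound cs ch acc all (∧-conicalˡ _ _ ok)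
  ... | yes p with ok' ← ∧-conicalʳ (check n cs ch acc) _ ok
    rewrite all⁺ {p = compat n c} ch (λ {d} d∈ → compat⁺ c d (pairwise p (all d∈)))
          | *-identityʳ (W n (proj₂ c))
          | sym (+-assoc acc (W n (proj₂ c)) (∑ cs (λ c → W n (proj₂ c) * ⟦ does (P? c) ⟧)))
          = sound cs (c ∷ ch) (acc + W n (proj₂ c)) (λ { (here refl) → p ; (there q) → all q }) ok'

-- For n = 6, 7, 8 the proof `refl` runs the exhaustive search.
small-or-free : ∀ n → check n (intervals n) [] 0 ≡ true ⊎ pen₁ n ≡ 0 × pen₂ n ≡ 0
small-or-free 0 = inj₂ (refl , refl)
small-or-free 1 = inj₂ (refl , refl)
small-or-free 2 = inj₂ (refl , refl)
small-or-free 3 = inj₂ (refl , refl)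
small-or-free 4 = inj₂ (refl , refl)
small-or-free 5 = inj₂ (refl , refl)
small-or-free 6 = inj₁ refl
small-or-free 7 = inj₁ refl
small-or-free 8 = inj₁ refl
small-or-free (suc (suc (suc (suc (suc (suc (suc (suc (suc n))))))))) = inj₂ (refl , refl)

-- Charging the slack on an arbitrary system of intervals

module Charged {n B} (sys : IntersectingAntichain n B) where
  open IntersectingAntichain sys

  Extends : Interval → Interval → Set
  Extends a m = ∀ {s l} → s < n → 0 < B s l → (s , l) ≡ a ⊎ Compatible n (s , l) m

  -- `τ` marks the starts s at which the comparability of `a s` with `m s` is charged. There `a s`
  -- is the only member that may clash with `m s`, which is what the boolean test `extends` looks
  -- for.
  record Chargeable (τ : ℕ → ℕ) (a m : ℕ → Interval) : Set where
    field
      τ≤1 : ∀ {s} → s < n → τ s ≤ 1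
      member! : ∀ {s} → s < n → 0 < τ s → uncurry B (a s) > 0
      extend : ∀ {s} → s < n → 0 < τ s → Extends (a s) (m s)

  lower upper : ℕ → Interval
  lower s = s , 2
  upper s = s , n ∸ 2

  private
    P : Interval → Set
    P (s , l) = s < n × 0 < B s l

    P? : ∀ c → Dec (P c)
    P? (s , l) with s <? n | 0 <? B s l
    ... | yes p | yes q = yes (p , q)
    ... | no ¬p | _ = no (¬p ∘ proj₁)
    ... | _ | no ¬q = no (¬q ∘ proj₂)

    no-gap-clash : ∀ {s l s' l'} → s < n → 0 < B s l → 0 < B s' l' → ¬ Clash n l (gap n s s') l'
    no-gap-clash {s} {l} {s'} {l'} s<n b b' = no-clash s l _ l' b (by (gap-spec s' s<n))
      where
      by : s + gap n s s' ≡ s' ⊎ s + gap n s s' ≡ s' + n → 0 < B (s + gap n s s') l'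
      by (inj₁ e) rewrite e = b'
      by (inj₂ e) rewrite e | periodic s' l' = b'

    open Sound P P? (λ (s<n , b) (s'<n , b') → no-gap-clash s<n b b' , no-gap-clash s'<n b' b)

    chosen : List Interval
    chosen = select (intervals n) []

    charged : ∀ {τ a m} → Chargeable τ a m → (∀ s → proj₁ (a s) ≡ s) → ∀ {s} → s < n → τ s ≤ ⟦ extends n (a s) (m s) chosen ⟧
    charged {τ} {a} {m} c start {s} s<n with 0 <? τ s
    ... | no ¬p rewrite n≤0⇒n≡0 (≮⇒≥ ¬p) = z≤n
    ... | yes p = ≤-trans (Chargeable.τ≤1 c s<n) (≤-reflexive (cong ⟦_⟧ (sym ok)))
      where
      ba = Chargeable.member! c s<n p
      a∈ : a s ∈ chosen
      a∈ = select⁺ (intervals n) (subst (_< n) (sym (start s)) s<n , ba)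
             (inj₁ (∈-cartesianProduct⁺ (∈-upTo⁺ (subst (_< n) (sym (start s)) s<n)) (uncurry ∈-lens (range _ _ ba))))
      fine : ∀ {b} → b ∈ chosen → same b (a s) ∨ compat n b (m s) ≡ true
      fine {b} b∈ with t<n , bb ← select⁻ (intervals n) (λ ()) b∈ with Chargeable.extend c s<n p t<n bb
      ... | inj₁ e rewrite e | same-refl (a s) = refl
      ... | inj₂ ext rewrite compat⁺ b (m s) ext = ∨-zeroʳ (same b (a s))
      ok : extends n (a s) (m s) chosen ≡ true
      ok rewrite member⁺ a∈ = all⁺ chosen fine

  checked : ∀ {τ₁ τ₂} → check n (intervals n) [] 0 ≡ true →
            Chargeable τ₁ lower (λ s → s , 3) → Chargeable τ₂ upper (λ s → next n s , n ∸ 3) →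
            total + ∑< n (λ s → pen₁ n * τ₁ s + pen₂ n * τ₂ s) ≤ n * n !
  checked {τ₁} {τ₂} ok c₁ c₂ = begin
    total + ∑< n (λ s → pen₁ n * τ₁ s + pen₂ n * τ₂ s)
      ≤⟨ +-mono-≤ (≤-reflexive total≡) (∑-mono (upTo n) λ {s} s∈ → +-mono-≤
           (*-monoʳ-≤ (pen₁ n) (charged c₁ (λ _ → refl) (∈-upTo⁻ s∈)))
           (*-monoʳ-≤ (pen₂ n) (charged c₂ (λ _ → refl) (∈-upTo⁻ s∈)))) ⟩
    ∑ (intervals n) (λ c → W n (proj₂ c) * ⟦ does (P? c) ⟧) + ∑< n (charge n chosen)
      ≤⟨ sound (intervals n) [] 0 (λ ()) ok ⟩
    n * n ! ∎
    where
    open ≤-Reasoning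
    indicator : ∀ {s} l → s < n → B s l ≡ ⟦ does (P? (s , l)) ⟧
    indicator {s} l s<n with s <? n | 0 <? B s l
    ... | no s≮n | _ = ⊥-elim (s≮n s<n)
    ... | yes _ | yes b = ≤-antisym (≤1 s l) b
    ... | yes _ | no b = n≤0⇒n≡0 (≮⇒≥ b)
    total≡ : total ≡ ∑ (intervals n) (λ c → W n (proj₂ c) * ⟦ does (P? c) ⟧)
    total≡ = trans (∑-cong (upTo n) λ {s} s∈ → ∑-cong (lens n) λ {l} _ → cong (W n l *_) (indicator l (∈-upTo⁻ s∈)))
                   (sym (∑-cartesianProduct (upTo n) (lens n) _))

  gkk-charged : ∀ {τ₁ τ₂} → Chargeable τ₁ lower (λ s → s , 3) → Chargeable τ₂ upper (λ s → next n s , n ∸ 3) →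
                total + ∑< n (λ s → pen₁ n * τ₁ s + pen₂ n * τ₂ s) ≤ n * n !
  gkk-charged {τ₁} {τ₂} c₁ c₂ with small-or-free n
  ... | inj₁ ok = checked ok c₁ c₂
  ... | inj₂ (free₁ , free₂) = begin
    total + ∑< n (λ s → pen₁ n * τ₁ s + pen₂ n * τ₂ s)
      ≡⟨ cong (total +_) (trans (∑-cong (upTo n) λ {s} _ → cong₂ (λ p q → p * τ₁ s + q * τ₂ s) free₁ free₂) (∑-zero (upTo n))) ⟩
    total + 0 ≡⟨ +-identityʳ total ⟩
    total ≤⟨ gkk sys ⟩
    n * n ! ∎
    where open ≤-Reasoning

-- The proportion of orderings in which nested sets are intervals

-- The number of orderings in which two fixed nested sets of sizes a and m occupy prescribed nested
-- intervals, whatever the offset of the inner one; see `pair-count`.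
flags : ℕ → ℕ → ℕ → ℕ
flags n a m = a ! * (m ∸ a) ! * (n ∸ m) !

-- Divided by `W n m * (m ! * (n ∸ m) !)`, the left side is the expected number of covers present on
-- a cycle, given that the middle set is an interval: there are `suc (m ∸ a)` offsets for the set
-- below and `suc (c ∸ m)` for the one above. The penalties carry no such factor, because a pair is
-- charged at only one of its two offsets.
MiddleBound : ℕ → ℕ → ℕ → ℕ → Set
MiddleBound n a m c =
  W n m * (suc (m ∸ a) * flags n a m + suc (c ∸ m) * flags n m c) ≤
  W n m * (m ! * (n ∸ m) !) + (pen₁ n * (⟦ does (m ≟ 3) ⟧ * ⟦ does (a ≟ 2) ⟧ * flags n a m)
                             + pen₂ n * (⟦ does (m ≟ n ∸ 3) ⟧ * ⟦ does (c ≟ n ∸ 2) ⟧ * flags n m c))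

middleBound? : ∀ n a m c → Dec (MiddleBound n a m c)
middleBound? n a m c = _ ≤? _

-- The penalties get their sizes here. For n = 6 the only sizes are 2, 3, 4, and equality holds
-- since `pen₁ 6` and `pen₂ 6` add up to `W 6 3`, which is 960. For n = 7 equality holds at m = 4, c
-- = 5, so 2520 is the least possible `pen₂ 7`. For n = 8 and m = 4 the expected number of covers is
-- exactly 1 without any charge.
middle-small : ∀ {n} → n < 9 → ∀ {c} → c < n → ∀ {m} → m < c → ∀ {a} → a < m → 2 ≤ a → c + 2 ≤ n → MiddleBound n a m c
middle-small = from-yes (allUpTo? (λ n → allUpTo? (λ c → allUpTo? (λ m → allUpTo? (λ a →
  (2 ≤? a) →-dec (c + 2 ≤? n) →-dec middleBound? n a m c) m) c) n) 9)

-- Equality at e = 0, the case of two-element sets; each further step multiplies the left side by 3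
-- + e and the right side by the larger or equal 3 + i + e.
factorials : ∀ i e → (2 + i) ! * (2 + e) ! ≤ 2 * (2 + i + e) !
factorials i zero rewrite +-identityʳ i = ≤-reflexive (*-comm ((2 + i) !) 2)
factorials i (suc e) = begin
  (2 + i) ! * ((3 + e) * (2 + e) !)   ≡⟨ comm ((2 + i) !) (3 + e) ((2 + e) !) ⟩
  (3 + e) * ((2 + i) ! * (2 + e) !)   ≤⟨ *-mono-≤ (+-monoʳ-≤ 3 (m≤n+m e i)) (factorials i e) ⟩
  (3 + (i + e)) * (2 * (2 + i + e) !) ≡⟨ comm (3 + (i + e)) 2 ((2 + i + e) !) ⟩
  2 * ((3 + (i + e)) * (2 + i + e) !) ≡⟨ cong (λ k → 2 * k !) (cong (2 +_) (+-suc i e)) ⟨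
  2 * (2 + i + suc e) !               ∎
  where
  open ≤-Reasoning
  comm : ∀ a b c → a * (b * c) ≡ b * (a * c)
  comm = solve-∀

-- A set of size b contained in an interval of size b + j is itself an interval
-- in a proportion of at most 2 / (b + j) of the orderings.
interval-proportion : ∀ {b j} → 2 ≤ b → 0 < j → (b + j) * (suc j * (b ! * j !)) ≤ 2 * (b + j) !
interval-proportion {suc (suc e)} {suc i} (s≤s (s≤s z≤n)) _ = begin
  (2 + e + suc i) * (suc (suc i) * ((2 + e) ! * suc i !))
    ≡⟨ cong ((2 + e + suc i) *_) (regroup (suc (suc i)) ((2 + e) !) (suc i !)) ⟩
  (2 + e + suc i) * ((2 + i) ! * (2 + e) !)
    ≤⟨ *-monoʳ-≤ (2 + e + suc i) (factorials i e) ⟩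
  (2 + e + suc i) * (2 * (2 + i + e) !)
    ≡⟨ cong (λ k → (2 + e + suc i) * (2 * k !)) (eq i e) ⟩
  (2 + e + suc i) * (2 * suc (e + suc i) !)
    ≡⟨ regroup′ (2 + e + suc i) 2 (suc (e + suc i) !) ⟩
  2 * (2 + e + suc i) ! ∎
  where
  open ≤-Reasoning
  regroup : ∀ a b c → a * (b * c) ≡ a * c * b
  regroup = solve-∀
  regroup′ : ∀ a b c → a * (b * c) ≡ b * (a * c)
  regroup′ = solve-∀
  eq : ∀ i e → 2 + i + e ≡ suc (e + suc i)
  eq = solve-∀

-- For n ≥ 9 the two proportions 2/m and 2/(n - m) add up to at most 1.
proportions : ∀ {m k} → 3 ≤ m → 3 ≤ k → 9 ≤ m + k → 2 * (m + k) ≤ m * k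
proportions {suc (suc (suc x))} {suc (suc (suc y))} (s≤s (s≤s (s≤s z≤n))) (s≤s (s≤s (s≤s z≤n))) 9≤ = begin
  2 * (3 + x + (3 + y))             ≡⟨ lhs≡ x y ⟩
  9 + (2 * x + 2 * y) + 3           ≤⟨ +-monoʳ-≤ (9 + (2 * x + 2 * y)) 3≤x+y ⟩
  9 + (2 * x + 2 * y) + (x + y)     ≤⟨ m≤m+n _ (x * y) ⟩
  9 + (2 * x + 2 * y) + (x + y) + x * y ≡⟨ rhs≡ x y ⟩
  (3 + x) * (3 + y)                 ∎
  where
  open ≤-Reasoning
  lhs≡ : ∀ x y → 2 * (3 + x + (3 + y)) ≡ 9 + (2 * x + 2 * y) + 3
  lhs≡ = solve-∀
  rhs≡ : ∀ x y → 9 + (2 * x + 2 * y) + (x + y) + x * y ≡ (3 + x) * (3 + y)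
  rhs≡ = solve-∀
  six : ∀ x y → 3 + x + (3 + y) ≡ 6 + (x + y)
  six = solve-∀
  3≤x+y : 3 ≤ x + y
  3≤x+y = +-cancelˡ-≤ 6 3 (x + y) (≤-trans 9≤ (≤-reflexive (six x y)))

-- Here b is the size of the complement of C, which lies in the complement of M, of size b + i. Thus
-- `interval-proportion` bounds both summands, and multiplying by the sizes of M and of its
-- complement clears the denominators of 2/m and 2/(n - m).
middle-large : ∀ a j i b → 2 ≤ a → 0 < j → 0 < i → 2 ≤ b → 9 ≤ a + j + (b + i) →
               suc j * (a ! * j ! * (b + i) !) + suc i * ((a + j) ! * i ! * b !) ≤ (a + j) ! * (b + i) !
middle-large a j i b 2≤a 0<j 0<i 2≤b 9≤ = *-cancelˡ-≤ (m * k) {{m*n≢0 m k {{>-nonZero (≤-trans (s≤s z≤n) 3≤m)}} {{>-nonZero (≤-trans (s≤s z≤n) 3≤k)}}}} (begin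
  m * k * (suc j * (a ! * j ! * k !) + suc i * (m ! * i ! * b !))
    ≡⟨ expand m k (suc j) (a !) (j !) (k !) (suc i) (m !) (i !) (b !) ⟩
  k * k ! * (m * (suc j * (a ! * j !))) + m * m ! * (k * (suc i * (b ! * i !)))
    ≤⟨ +-mono-≤ (*-monoʳ-≤ (k * k !) (interval-proportion 2≤a 0<j)) (*-monoʳ-≤ (m * m !) (interval-proportion 2≤b 0<i)) ⟩
  k * k ! * (2 * m !) + m * m ! * (2 * k !)
    ≡⟨ collect m k (m !) (k !) ⟩
  2 * (m + k) * (m ! * k !)
    ≤⟨ *-monoˡ-≤ (m ! * k !) (proportions 3≤m 3≤k 9≤) ⟩
  m * k * (m ! * k !) ∎)
  where
  open ≤-Reasoning
  m = a + j
  k = b + i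
  3≤m : 3 ≤ m
  3≤m = +-mono-≤ 2≤a 0<j
  3≤k : 3 ≤ k
  3≤k = +-mono-≤ 2≤b 0<i
  expand : ∀ m k j' a! j! k! i' m! i! b! → m * k * (j' * (a! * j! * k!) + i' * (m! * i! * b!)) ≡
           k * k! * (m * (j' * (a! * j!))) + m * m! * (k * (i' * (b! * i!)))
  expand = solve-∀
  collect : ∀ m k m! k! → k * k! * (2 * m!) + m * m! * (2 * k!) ≡ 2 * (m + k) * (m! * k!)
  collect = solve-∀

middle-bound : ∀ {n a m c} → 2 ≤ a → a < m → m < c → c + 2 ≤ n → MiddleBound n a m c
middle-bound {n} {a} {m} {c} 2≤a a<m m<c c+2≤n with n <? 9
... | yes n<9 = middle-small n<9 (≤-trans (≤-trans (≤-reflexive (+-comm 1 c)) (+-monoʳ-≤ c (s≤s z≤n))) c+2≤n) m<c a<m 2≤a c+2≤n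
... | no n≮9 = ≤-trans (*-monoʳ-≤ (W n m) (by 2≤a a<m m<c c+2≤n (≮⇒≥ n≮9))) (m≤m+n _ _)
  where
  eq : ∀ m i f → m + i + 2 + f ≡ m + (2 + f + i)
  eq = solve-∀
  eq′ : ∀ m i f → m + (2 + f + i) ≡ m + i + (2 + f)
  eq′ = solve-∀
  pos : ∀ {a j} → a < a + j → 0 < j
  pos {a} {zero} lt = ⊥-elim (<-irrefl (sym (+-identityʳ a)) lt)
  pos {a} {suc j} _ = z<s
  by : ∀ {n a m c} → 2 ≤ a → a < m → m < c → c + 2 ≤ n → 9 ≤ n →
       suc (m ∸ a) * flags n a m + suc (c ∸ m) * flags n m c ≤ m ! * (n ∸ m) !
  by {a = a} 2≤a a<m m<c c+2≤n 9≤n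
    with j , refl ← m≤n⇒∃[o]m+o≡n (<⇒≤ a<m)
    with i , refl ← m≤n⇒∃[o]m+o≡n (<⇒≤ m<c)
    with f , refl ← m≤n⇒∃[o]m+o≡n c+2≤n
    rewrite eq (a + j) i f | m+n∸m≡n a j | m+n∸m≡n (a + j) (2 + f + i) | m+n∸m≡n (a + j) i
          | eq′ (a + j) i f | m+n∸m≡n (a + j + i) (2 + f) =
    middle-large a j i (2 + f) 2≤a (pos a<m) (pos m<c) (s≤s (s≤s z≤n)) (≤-trans 9≤n (≤-reflexive (sym (eq′ (a + j) i f))))

-- Sets that are intervals of an ordering

module _ {a} {A : Set a} where

  rot^-++ : ∀ (xs ys : List A) → rot^ (length xs) (xs ++ ys) ≡ ys ++ xs
  rot^-++ [] ys = sym (List.++-identityʳ ys)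
  rot^-++ (x ∷ xs) ys = begin
    rot^ (length xs) ((xs ++ ys) ∷ʳ x)   ≡⟨ cong (rot^ (length xs)) (List.++-assoc xs ys _) ⟩
    rot^ (length xs) (xs ++ (ys ∷ʳ x))   ≡⟨ rot^-++ xs (ys ∷ʳ x) ⟩
    (ys ∷ʳ x) ++ xs                      ≡⟨ List.∷ʳ-++ ys x xs ⟩
    ys ++ x ∷ xs                         ∎
    where open ≡-Reasoning

  rot^-length : ∀ (xs : List A) → rot^ (length xs) xs ≡ xs
  rot^-length xs = trans (cong (rot^ (length xs)) (sym (List.++-identityʳ xs))) (rot^-++ xs [])

  rot^-+ : ∀ s d (xs : List A) → rot^ (s + d) xs ≡ rot^ d (rot^ s xs)
  rot^-+ zero d xs = refl
  rot^-+ (suc s) d xs = rot^-+ s d (rot xs)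

  length-rot^ : ∀ s (xs : List A) → length (rot^ s xs) ≡ length xs
  length-rot^ zero xs = refl
  length-rot^ (suc s) [] = length-rot^ s []
  length-rot^ (suc s) (x ∷ xs) = trans (length-rot^ s (xs ∷ʳ x)) (List.length-++-comm xs (x ∷ []))

  ∈-rot^ : ∀ s {xs : List A} {x} → x ∈ xs → x ∈ rot^ s xs
  ∈-rot^ zero x∈ = x∈
  ∈-rot^ (suc s) {y ∷ xs} (here refl) = ∈-rot^ s (∈-++⁺ʳ xs (here refl))
  ∈-rot^ (suc s) {y ∷ xs} (there x∈) = ∈-rot^ s (∈-++⁺ˡ x∈)

  rot-injective : ∀ (xs ys : List A) → rot xs ≡ rot ys → xs ≡ ys
  rot-injective [] [] _ = refl
  rot-injective [] (y ∷ []) ()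
  rot-injective [] (y ∷ _ ∷ ys) ()
  rot-injective (x ∷ []) [] ()
  rot-injective (x ∷ _ ∷ xs) [] ()
  rot-injective (x ∷ xs) (y ∷ ys) eq = uncurry (λ e e' → cong₂ _∷_ e' e) (List.∷ʳ-injective xs ys eq)

  rot^-injective : ∀ s (xs ys : List A) → rot^ s xs ≡ rot^ s ys → xs ≡ ys
  rot^-injective zero xs ys eq = eq
  rot^-injective (suc s) xs ys eq = rot-injective xs ys (rot^-injective s (rot xs) (rot ys) eq)

  replicate-+ : ∀ m n {x : A} → replicate (m + n) x ≡ replicate m x ++ replicate n x
  replicate-+ zero n = refl
  replicate-+ (suc m) n = cong (_ ∷_) (replicate-+ m n)

  pointwise-∈ : ∀ {b} {B : Set b} {Q : B → B → Set} (f g : A → B) {xs x} →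
                Pointwise Q (map f xs) (map g xs) → x ∈ xs → Q (f x) (g x)
  pointwise-∈ f g (q ∷ _) (here refl) = q
  pointwise-∈ f g (_ ∷ qs) (there x∈) = pointwise-∈ f g qs x∈

map-rot^ : ∀ {a b} {A : Set a} {B : Set b} (f : A → B) s xs → map f (rot^ s xs) ≡ rot^ s (map f xs)
map-rot^ f zero xs = refl
map-rot^ f (suc s) [] = map-rot^ f s []
map-rot^ f (suc s) (x ∷ xs) = trans (map-rot^ f s (xs ∷ʳ x)) (cong (rot^ s) (List.map-++ f xs (x ∷ [])))

block : ℕ → ℕ → ℕ → List Bool
block d l k = replicate d false ++ replicate l true ++ replicate k false

rot^-block : ∀ d l k → rot^ d (block d l k) ≡ block 0 l (k + d)
rot^-block d l k = begin
  rot^ d (block d l k)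
    ≡⟨ cong (λ e → rot^ e (block d l k)) (List.length-replicate d) ⟨
  rot^ (length (replicate d false)) (block d l k)
    ≡⟨ rot^-++ (replicate d false) (replicate l true ++ replicate k false) ⟩
  (replicate l true ++ replicate k false) ++ replicate d false
    ≡⟨ List.++-assoc (replicate l true) _ _ ⟩
  replicate l true ++ (replicate k false ++ replicate d false)
    ≡⟨ cong (replicate l true ++_) (replicate-+ k d) ⟨
  block 0 l (k + d) ∎
  where open ≡-Reasoning

private
  _⇐_ Apart : Bool → Bool → Set
  a ⇐ b = b ≡ true → a ≡ true
  Apart a b = a ≡ true → b ≡ true → ⊥

  block-inside : ∀ d l' e k → Pointwise _⇐_ (block 0 (d + (l' + e)) k) (block d l' (e + k))
  block-inside d l' e k
    rewrite replicate-+ d (l' + e) {true} | replicate-+ l' e {true} | replicate-+ e k {false}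
          | List.++-assoc (replicate d true) (replicate l' true ++ replicate e true) (replicate k false)
          | List.++-assoc (replicate l' true) (replicate e true) (replicate k false)
    = Pointwise.++⁺ (Pointwise.replicate⁺ (λ _ → refl) d) (Pointwise.++⁺ (Pointwise.replicate⁺ id l')
        (Pointwise.++⁺ (Pointwise.replicate⁺ (λ _ → refl) e) (Pointwise.replicate⁺ id k)))

  block-apart : ∀ l e l' k → Pointwise Apart (block 0 l (e + (l' + k))) (block (l + e) l' k)
  block-apart l e l' k
    rewrite replicate-+ l e {false} | replicate-+ e (l' + k) {false} | replicate-+ l' k {false}
          | List.++-assoc (replicate l false) (replicate e false) (replicate l' true ++ replicate k false)
    = Pointwise.++⁺ (Pointwise.replicate⁺ (λ _ ()) l) (Pointwise.++⁺ (Pointwise.replicate⁺ (λ ()) e)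
        (Pointwise.++⁺ (Pointwise.replicate⁺ (λ ()) l') (Pointwise.replicate⁺ (λ ()) k)))

  rot^-prefix : ∀ d {a : Bool} ys → rot^ d (replicate d a ++ ys) ≡ ys ++ replicate d a
  rot^-prefix d {a} ys = subst (λ e → rot^ e (replicate d a ++ ys) ≡ ys ++ replicate d a)
    (List.length-replicate d) (rot^-++ (replicate d a) ys)

  snoc : ∀ xs m (b : Bool) → (xs ++ replicate m b) ∷ʳ b ≡ xs ++ replicate (suc m) b
  snoc xs m b = trans (List.++-assoc xs (replicate m b) (b ∷ []))
    (cong (xs ++_) (trans (sym (replicate-+ m 1)) (cong (λ i → replicate i b) (+-comm m 1))))

  ends-differ : ∀ xs ys m k → xs ++ replicate (suc m) true ≢ ys ++ replicate (suc k) false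
  ends-differ xs ys m k eq with () ← List.∷ʳ-injectiveʳ (xs ++ replicate m true) (ys ++ replicate k false)
    (trans (snoc xs m true) (trans eq (sym (snoc ys k false))))

  -- A rotation by d ≤ l brings a `true` to the end of the word, while the block ends in `false`; a
  -- rotation by more than l brings a `false` to the front, while the block begins with `true`.
  block-aperiodic : ∀ l k d → 0 < l → 0 < k → 0 < d → d < l + k → rot^ d (block 0 l k) ≢ block 0 l k
  block-aperiodic l@(suc _) (suc k) (suc d) _ _ _ d<n eq with suc d ≤? l
  ... | yes d≤l = ends-differ (replicate (l ∸ suc d) true ++ replicate (suc k) false) (replicate l true) d k
    (trans (sym rotated) eq)
    where
    open ≡-Reasoning
    rotated : rot^ (suc d) (block 0 l (suc k)) ≡ (replicate (l ∸ suc d) true ++ replicate (suc k) false) ++ replicate (suc d) true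
    rotated = begin
      rot^ (suc d) (replicate l true ++ rest)
        ≡⟨ cong (λ i → rot^ (suc d) (replicate i true ++ rest)) (m+[n∸m]≡n d≤l) ⟨
      rot^ (suc d) (replicate (suc d + (l ∸ suc d)) true ++ rest)
        ≡⟨ cong (λ xs → rot^ (suc d) (xs ++ rest)) (replicate-+ (suc d) (l ∸ suc d)) ⟩
      rot^ (suc d) ((replicate (suc d) true ++ replicate (l ∸ suc d) true) ++ rest)
        ≡⟨ cong (rot^ (suc d)) (List.++-assoc (replicate (suc d) true) _ rest) ⟩
      rot^ (suc d) (replicate (suc d) true ++ (replicate (l ∸ suc d) true ++ rest))
        ≡⟨ rot^-prefix (suc d) _ ⟩
      (replicate (l ∸ suc d) true ++ rest) ++ replicate (suc d) true ∎
      where rest = replicate (suc k) false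
  ... | no d≰l with e , d≡ ← m≤n⇒∃[o]m+o≡n (<⇒≤ (≰⇒> d≰l))
               with f , k≡ ← m≤n⇒∃[o]m+o≡n (+-cancelˡ-< l e (suc k) (subst (_< l + suc k) (sym d≡) d<n))
    = contradict (trans (sym rotated) eq)
    where
    open ≡-Reasoning
    split : block 0 l (suc k) ≡ (replicate l true ++ replicate e false) ++ replicate (suc f) false
    split = begin
      replicate l true ++ replicate (suc k) false
        ≡⟨ cong (λ i → replicate l true ++ replicate i false) (trans (+-suc e f) k≡) ⟨
      replicate l true ++ replicate (e + suc f) false
        ≡⟨ cong (replicate l true ++_) (replicate-+ e (suc f)) ⟩
      replicate l true ++ (replicate e false ++ replicate (suc f) false)
        ≡⟨ List.++-assoc (replicate l true) _ _ ⟨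
      (replicate l true ++ replicate e false) ++ replicate (suc f) false ∎
    len : length (replicate l true ++ replicate e false) ≡ suc d
    len = trans (List.length-++ (replicate l true)) (trans (cong₂ _+_ (List.length-replicate l) (List.length-replicate e)) d≡)
    rotated : rot^ (suc d) (block 0 l (suc k)) ≡ replicate (suc f) false ++ (replicate l true ++ replicate e false)
    rotated = trans (cong₂ rot^ (sym len) split) (rot^-++ (replicate l true ++ replicate e false) (replicate (suc f) false))
    contradict : replicate (suc f) false ++ (replicate l true ++ replicate e false) ≢ block 0 l (suc k)
    contradict ()

module OnOrdering {n : ℕ} {π : List (Fin n)} (o : OrderingOf n ⊤ π) where
  open OrderingOf o

  -- F is the interval starting at s if the word of F, read cyclically from place s, is a single run
  -- of members followed by non-members.
  record _At_ (F : Subset n) (s : ℕ) : Set where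
    constructor at
    field word : map (lookup F) (rot^ s π) ≡ block 0 ∣ F ∣ (n ∸ ∣ F ∣)
  open _At_

  occurs : ∀ s x → x ∈ rot^ s π
  occurs s x = ∈-rot^ s (all-occur x (lookup-replicate x true))

  rot^-periodic : ∀ s → rot^ (s + n) π ≡ rot^ s π
  rot^-periodic s = trans (rot^-+ s n π) (trans (cong (λ m → rot^ m (rot^ s π)) (sym (trans (length-rot^ s π) len))) (rot^-length (rot^ s π)))

  -- Two intervals can be compared letter by letter only when read from the same place. The bound on
  -- d + |G| keeps the run of G from wrapping around, and injectivity of rotation carries its word
  -- back from place s + d to s.
  shifted : ∀ {G s} d → G At (s + d) → d + ∣ G ∣ ≤ n → map (lookup G) (rot^ s π) ≡ block d ∣ G ∣ (n ∸ (d + ∣ G ∣))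
  shifted {G} {s} d g d+l≤n = rot^-injective d _ _ (begin
    rot^ d (map (lookup G) (rot^ s π))     ≡⟨ map-rot^ (lookup G) d (rot^ s π) ⟨
    map (lookup G) (rot^ d (rot^ s π))     ≡⟨ cong (map (lookup G)) (rot^-+ s d π) ⟨
    map (lookup G) (rot^ (s + d) π)        ≡⟨ word g ⟩
    block 0 l (n ∸ l)                      ≡⟨ cong (block 0 l) gap≡ ⟨
    block 0 l (n ∸ (d + l) + d)            ≡⟨ rot^-block d l (n ∸ (d + l)) ⟨
    rot^ d (block d l (n ∸ (d + l)))       ∎)
    where
    open ≡-Reasoning
    l = ∣ G ∣
    gap≡ : n ∸ (d + l) + d ≡ n ∸ l
    gap≡ = trans (cong (_+ d) (trans (cong (n ∸_) (+-comm d l)) (sym (∸-+-assoc n l d))))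
                 (m∸n+n≡m (m+n≤o⇒m≤o∸n d d+l≤n))

  subset : ∀ {F G : Subset n} → (∀ x → lookup G x ≡ true → lookup F x ≡ true) → G ⊆ F
  subset {F} h {x} x∈ = lookup⇒[]= x F (h x ([]=⇒lookup x∈))

  At-inside : ∀ {F G s d} → F At s → G At (s + d) → d + ∣ G ∣ ≤ ∣ F ∣ → G ⊆ F
  At-inside {F} {G} {s} {d} f g d+l≤ with e , eq ← m≤n⇒∃[o]m+o≡n d+l≤ = subset λ x →
    pointwise-∈ (lookup F) (lookup G) (subst₂ (Pointwise _⇐_) (sym f′) (sym g′) (block-inside d (∣ G ∣) e (n ∸ ∣ F ∣))) (occurs s x)
    where
    len≡ : d + (∣ G ∣ + e) ≡ ∣ F ∣
    len≡ = trans (sym (+-assoc d ∣ G ∣ e)) eq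
    n≡ : n ∸ (d + ∣ G ∣) ≡ e + (n ∸ ∣ F ∣)
    n≡ = +-cancelˡ-≡ (d + ∣ G ∣) _ _ (trans (m+[n∸m]≡n (≤-trans d+l≤ (∣p∣≤n F)))
      (sym (trans (sym (+-assoc (d + ∣ G ∣) e _)) (trans (cong (_+ (n ∸ ∣ F ∣)) eq) (m+[n∸m]≡n (∣p∣≤n F))))))
    f′ : map (lookup F) (rot^ s π) ≡ block 0 (d + (∣ G ∣ + e)) (n ∸ ∣ F ∣)
    f′ = trans (word f) (cong (λ l → block 0 l (n ∸ ∣ F ∣)) (sym len≡))
    g′ : map (lookup G) (rot^ s π) ≡ block d ∣ G ∣ (e + (n ∸ ∣ F ∣))
    g′ = trans (shifted d g (≤-trans d+l≤ (∣p∣≤n F))) (cong (block d ∣ G ∣) n≡)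

  At-apart : ∀ {F G s d} → F At s → G At (s + d) → ∣ F ∣ ≤ d → d + ∣ G ∣ ≤ n → ¬ Nonempty (F ∩ G)
  At-apart {F} {G} {s} {d} f g l≤d d+l≤n (x , x∈) with e , eq ← m≤n⇒∃[o]m+o≡n l≤d with x∈F , x∈G ← x∈p∩q⁻ F G x∈ =
    pointwise-∈ (lookup F) (lookup G) (subst₂ (Pointwise Apart) (sym f′) (sym g′) (block-apart (∣ F ∣) e (∣ G ∣) (n ∸ (d + ∣ G ∣))))
      (occurs s x) ([]=⇒lookup x∈F) ([]=⇒lookup x∈G)
    where
    n≡ : n ∸ ∣ F ∣ ≡ e + (∣ G ∣ + (n ∸ (d + ∣ G ∣)))
    n≡ = +-cancelˡ-≡ ∣ F ∣ _ _ (trans (m+[n∸m]≡n (∣p∣≤n F)) (sym (trans (sym (+-assoc ∣ F ∣ e _))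
      (trans (cong (_+ (∣ G ∣ + (n ∸ (d + ∣ G ∣)))) eq) (trans (sym (+-assoc d ∣ G ∣ _)) (m+[n∸m]≡n d+l≤n))))))
    f′ : map (lookup F) (rot^ s π) ≡ block 0 ∣ F ∣ (e + (∣ G ∣ + (n ∸ (d + ∣ G ∣))))
    f′ = trans (word f) (cong (block 0 ∣ F ∣) n≡)
    g′ : map (lookup G) (rot^ s π) ≡ block (∣ F ∣ + e) (∣ G ∣) (n ∸ (d + ∣ G ∣))
    g′ = trans (shifted d g d+l≤n) (cong (λ i → block i ∣ G ∣ (n ∸ (d + ∣ G ∣))) (sym eq))

  At-injective : ∀ {F G s} → F At s → G At s → ∣ F ∣ ≡ ∣ G ∣ → F ≡ G
  At-injective {F} {G} {s} f g eq = ⊆-antisym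
    (At-inside g (subst (F At_) (sym (+-identityʳ s)) f) (≤-reflexive eq))
    (At-inside f (subst (G At_) (sym (+-identityʳ s)) g) (≤-reflexive (sym eq)))

  private
    At-later : ∀ {F s s'} → 0 < ∣ F ∣ → ∣ F ∣ < n → s < s' → s' < n → F At s → ¬ F At s'
    At-later {F} {s} 0<l l<n s<s' s'<n f f' with d , refl ← m≤n⇒∃[o]m+o≡n (<⇒≤ s<s') =
      block-aperiodic (∣ F ∣) (n ∸ ∣ F ∣) d 0<l (m<n⇒0<n∸m l<n)
        (n≢0⇒n>0 λ { refl → <-irrefl (sym (+-identityʳ s)) s<s' })
        (subst (d <_) (sym (m+[n∸m]≡n (<⇒≤ l<n))) (≤-<-trans (m≤n+m d s) s'<n))
        (trans (cong (rot^ d) (sym (word f))) (trans (sym (map-rot^ (lookup F) d (rot^ s π)))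
          (trans (cong (map (lookup F)) (sym (rot^-+ s d π))) (word f'))))

  At-unique : ∀ {F s s'} → 0 < ∣ F ∣ → ∣ F ∣ < n → s < n → s' < n → F At s → F At s' → s ≡ s'
  At-unique {F} {s} {s'} 0<l l<n s<n s'<n f f' with <-cmp s s'
  ... | tri≈ _ s≡s' _ = s≡s'
  ... | tri< s<s' _ _ = ⊥-elim (At-later 0<l l<n s<s' s'<n f f')
  ... | tri> _ _ s'<s = ⊥-elim (At-later 0<l l<n s'<s s<n f' f)

-- Counting the orderings in which given sets are intervals

_≟ʷ_ : (xs ys : List Bool) → Dec (xs ≡ ys)
_≟ʷ_ = List.≡-dec Bool._≟_

⟦⟧-× : ∀ {p q r} {P : Set p} {Q : Set q} {R : Set r} (p? : Dec P) (q? : Dec Q) (r? : Dec R) →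
       (P → Q → R) → (R → P) → (R → Q) → ⟦ does p? ⟧ * ⟦ does q? ⟧ ≡ ⟦ does r? ⟧
⟦⟧-× (yes p) (yes q) r? to _ _ = sym (⟦yes⟧ r? (to p q))
⟦⟧-× (no ¬p) q? r? _ fr₁ _ = sym (⟦no⟧ r? (¬p ∘ fr₁))
⟦⟧-× (yes p) (no ¬q) r? _ _ fr₂ = sym (⟦no⟧ r? (¬q ∘ fr₂))

opaque
  hit : ∀ {n} → List (Fin n) → Subset n → ℕ → ℕ
  hit {n} π F s = ⟦ does (map (lookup F) (rot^ s π) ≟ʷ block 0 ∣ F ∣ (n ∸ ∣ F ∣)) ⟧

  hit⁻ : ∀ {n} {π} {F : Subset n} {s} → 0 < hit π F s → map (lookup F) (rot^ s π) ≡ block 0 ∣ F ∣ (n ∸ ∣ F ∣)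
  hit⁻ {π = π} {F} {s} = ⟦⟧⁺ (map (lookup F) (rot^ s π) ≟ʷ _)

  hit⁺ : ∀ {n} {π} {F : Subset n} {s} → map (lookup F) (rot^ s π) ≡ block 0 ∣ F ∣ (n ∸ ∣ F ∣) → hit π F s ≡ 1
  hit⁺ {π = π} {F} {s} = ⟦yes⟧ (map (lookup F) (rot^ s π) ≟ʷ _)

  hit≤1 : ∀ {n} π (F : Subset n) s → hit π F s ≤ 1
  hit≤1 π F s = ⟦⟧≤1 _

  hit-rot^ : ∀ {n} π (F : Subset n) s t → hit π F (s + t) ≡ hit (rot^ s π) F t
  hit-rot^ {n} π F s t = cong (λ xs → ⟦ does (map (lookup F) xs ≟ʷ block 0 ∣ F ∣ (n ∸ ∣ F ∣)) ⟧) (rot^-+ s t π)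

  hit-× : ∀ {n} {K : Set} (π : List (Fin n)) (F G : Subset n) t (k? : Dec K) →
          (map (lookup F) π ≡ block 0 ∣ F ∣ (n ∸ ∣ F ∣) → map (lookup G) (rot^ t π) ≡ block 0 ∣ G ∣ (n ∸ ∣ G ∣) → K) →
          (K → map (lookup F) π ≡ block 0 ∣ F ∣ (n ∸ ∣ F ∣)) → (K → map (lookup G) (rot^ t π) ≡ block 0 ∣ G ∣ (n ∸ ∣ G ∣)) →
          hit π F 0 * hit π G t ≡ ⟦ does k? ⟧
  hit-× {n} π F G t k? = ⟦⟧-× (map (lookup F) π ≟ʷ block 0 ∣ F ∣ (n ∸ ∣ F ∣)) (map (lookup G) (rot^ t π) ≟ʷ block 0 ∣ G ∣ (n ∸ ∣ G ∣)) k?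

hit-0 : ∀ {n} π (F : Subset n) s → hit π F s ≡ hit (rot^ s π) F 0
hit-0 π F s = trans (cong (hit π F) (sym (+-identityʳ s))) (hit-rot^ π F s 0)

∑-tabulate : ∀ {a b} {A : Set a} {B : Set b} {n} (h : A → B) (f : Fin n → A) g →
             ∑ (tabulate (h ∘ f)) g ≡ ∑ (tabulate f) (g ∘ h)
∑-tabulate {n = zero} h f g = refl
∑-tabulate {n = suc n} h f g = cong (g (h (f Fin.zero)) +_) (∑-tabulate h (f ∘ Fin.suc) g)

size≡∣∣ : ∀ {n} (F : Subset n) → size F ≡ ∣ F ∣
size≡∣∣ [] = refl
size≡∣∣ (x ∷ F) with tail ← trans (∑-tabulate Fin.suc id (λ i → ⟦ lookup (x ∷ F) i ⟧)) (size≡∣∣ F) | x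
... | true = cong suc tail
... | false = tail

size-⊤ : ∀ n → size {n} ⊤ ≡ n
size-⊤ n = trans (∑-cong (allFin n) (λ {x} _ → cong ⟦_⟧ (lookup-replicate x true)))
  (trans (∑-const (allFin n) 1) (trans (*-identityʳ _) (List.length-tabulate id)))

module Colours = Colouring (≡-dec Bool._≟_ Bool._≟_)
open Colours

count-++ : ∀ c p q → count c (p ++ q) ≡ count c p + count c q
count-++ c [] q = refl
count-++ c (d ∷ p) q = trans (cong (_ +_) (count-++ c p q)) (sym (+-assoc _ (count c p) (count c q)))

count-replicate : ∀ c d m → count c (replicate m d) ≡ m * ⟦ does (≡-dec Bool._≟_ Bool._≟_ d c) ⟧
count-replicate c d zero = refl
count-replicate c d (suc m) = cong (_ +_) (count-replicate c d m)

-- A run of t letters raises a multiplicity m to t + m, hence contributes (t + m)! / m!; the product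
-- form avoids the division.
fact-replicate : ∀ c t q → fact (replicate t c ++ q) * count c q ! ≡ (t + count c q) ! * fact q
fact-replicate c zero q = *-comm (fact q) _
fact-replicate c (suc t) q = begin
  count c (c ∷ replicate t c ++ q) * fact (replicate t c ++ q) * count c q !
    ≡⟨ *-assoc (count c (c ∷ replicate t c ++ q)) _ _ ⟩
  count c (c ∷ replicate t c ++ q) * (fact (replicate t c ++ q) * count c q !)
    ≡⟨ cong₂ _*_ head (fact-replicate c t q) ⟩
  suc (t + count c q) * ((t + count c q) ! * fact q)
    ≡⟨ *-assoc (suc (t + count c q)) ((t + count c q) !) (fact q) ⟨
  (suc t + count c q) ! * fact q ∎
  where
  open ≡-Reasoning
  self : ⟦ does (≡-dec Bool._≟_ Bool._≟_ c c) ⟧ ≡ 1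
  self = ⟦yes⟧ (≡-dec Bool._≟_ Bool._≟_ c c) refl
  head : count c (c ∷ replicate t c ++ q) ≡ suc (t + count c q)
  head = cong₂ _+_ self (trans (count-++ c (replicate t c) q) (cong (_+ count c q)
    (trans (count-replicate c c t) (trans (cong (t *_) self) (*-identityʳ t)))))

module _ (t a r k : ℕ) where

  -- The letters record membership in F and in G. This is the word of an ordering in which F fills
  -- the first t + a + r places and G the a places after the first t.
  pattern₂ : List (Bool × Bool)
  pattern₂ = replicate t (true , false) ++ replicate a (true , true) ++ replicate r (true , false) ++ replicate k (false , false)

  private
    project : ∀ {f : Bool × Bool → Bool} → map f pattern₂ ≡ replicate t (f (true , false)) ++ replicate a (f (true , true))
              ++ replicate r (f (true , false)) ++ replicate k (f (false , false))
    project {f}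
      rewrite List.map-++ f (replicate t (true , false)) (replicate a (true , true) ++ replicate r (true , false) ++ replicate k (false , false))
            | List.map-++ f (replicate a (true , true)) (replicate r (true , false) ++ replicate k (false , false))
            | List.map-++ f (replicate r (true , false)) (replicate k (false , false))
            | List.map-replicate f t (true , false) | List.map-replicate f a (true , true)
            | List.map-replicate f r (true , false) | List.map-replicate f k (false , false) = refl

  map-proj₁ : map proj₁ pattern₂ ≡ block 0 (t + (a + r)) k
  map-proj₁ = trans project (sym (begin
    replicate (t + (a + r)) true ++ K
      ≡⟨ cong (_++ K) (trans (replicate-+ t (a + r)) (cong (replicate t true ++_) (replicate-+ a r))) ⟩
    (replicate t true ++ replicate a true ++ replicate r true) ++ K
      ≡⟨ List.++-assoc (replicate t true) _ K ⟩
    replicate t true ++ (replicate a true ++ replicate r true) ++ K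
      ≡⟨ cong (replicate t true ++_) (List.++-assoc (replicate a true) _ K) ⟩
    replicate t true ++ replicate a true ++ replicate r true ++ K ∎))
    where
    open ≡-Reasoning
    K = replicate k false

  map-proj₂ : map proj₂ pattern₂ ≡ block t a (r + k)
  map-proj₂ = trans project (cong (λ xs → replicate t false ++ replicate a true ++ xs) (sym (replicate-+ r k)))

  length-pattern₂ : length pattern₂ ≡ t + (a + r) + k
  length-pattern₂ = trans (sym (List.length-map proj₁ pattern₂)) (trans (cong length map-proj₁)
    (trans (List.length-++ (replicate (t + (a + r)) true)) (cong₂ _+_ (List.length-replicate (t + (a + r))) (List.length-replicate k))))

  count-pattern₂ : ∀ c → count c pattern₂ ≡ t * ⟦ does (≡-dec Bool._≟_ Bool._≟_ (true , false) c) ⟧ + (a * ⟦ does (≡-dec Bool._≟_ Bool._≟_ (true , true) c) ⟧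
      + (r * ⟦ does (≡-dec Bool._≟_ Bool._≟_ (true , false) c) ⟧ + k * ⟦ does (≡-dec Bool._≟_ Bool._≟_ (false , false) c) ⟧))
  count-pattern₂ c
    rewrite count-++ c (replicate t (true , false)) (replicate a (true , true) ++ replicate r (true , false) ++ replicate k (false , false))
          | count-++ c (replicate a (true , true)) (replicate r (true , false) ++ replicate k (false , false))
          | count-++ c (replicate r (true , false)) (replicate k (false , false))
          | count-replicate c (true , false) t | count-replicate c (true , true) a
          | count-replicate c (true , false) r | count-replicate c (false , false) k = refl

  -- The runs before and after G have the same colour and together contribute (t + r)!. In
  -- `pair-count` the sum t + r is |F| - |G|, so the count is the same for every offset t, and later
  -- sums over offsets become multiplications.
  fact-pattern₂ : fact pattern₂ ≡ a ! * (t + r) ! * k !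
  fact-pattern₂ = *-cancelʳ-≡ (fact pattern₂) _ (r !) {{r !≢0}} (begin
    fact pattern₂ * r !                       ≡⟨ cong (λ m → fact pattern₂ * m !) c₂ ⟨
    fact pattern₂ * count (true , false) p₂ ! ≡⟨ fact-replicate (true , false) t p₂ ⟩
    (t + count (true , false) p₂) ! * fact p₂ ≡⟨ cong₂ (λ m f → (t + m) ! * f) c₂ f₂ ⟩
    (t + r) ! * (a ! * (r ! * k !))           ≡⟨ regroup ((t + r) !) (a !) (r !) (k !) ⟩
    a ! * (t + r) ! * k ! * r !               ∎)
    where
    open ≡-Reasoning
    regroup : ∀ x y z w → x * (y * (z * w)) ≡ y * x * w * z
    regroup = solve-∀
    p₀ = replicate k (false , false)
    p₁ = replicate r (true , false) ++ p₀
    p₂ = replicate a (true , true) ++ p₁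
    block-fact : ∀ c m p → count c p ≡ 0 → fact (replicate m c ++ p) ≡ m ! * fact p
    block-fact c m p none = begin
      fact (replicate m c ++ p)                 ≡⟨ *-identityʳ _ ⟨
      fact (replicate m c ++ p) * 0 !           ≡⟨ cong (λ i → fact (replicate m c ++ p) * i !) none ⟨
      fact (replicate m c ++ p) * count c p !   ≡⟨ fact-replicate c m p ⟩
      (m + count c p) ! * fact p                ≡⟨ cong (λ i → (m + i) ! * fact p) none ⟩
      (m + 0) ! * fact p                        ≡⟨ cong (λ i → i ! * fact p) (+-identityʳ m) ⟩
      m ! * fact p                              ∎
    f₀ : fact p₀ ≡ k !
    f₀ = trans (cong fact (sym (List.++-identityʳ p₀))) (trans (block-fact (false , false) k [] refl) (*-identityʳ _))
    f₁ : fact p₁ ≡ r ! * k !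
    f₁ = trans (block-fact (true , false) r p₀ (trans (count-replicate _ _ k) (*-zeroʳ k))) (cong (r ! *_) f₀)
    f₂ : fact p₂ ≡ a ! * (r ! * k !)
    f₂ = trans (block-fact (true , true) a p₁ (trans (count-++ _ (replicate r _) p₀)
      (cong₂ _+_ (trans (count-replicate _ _ r) (*-zeroʳ r)) (trans (count-replicate _ _ k) (*-zeroʳ k))))) (cong (a ! *_) f₁)
    c₂ : count (true , false) p₂ ≡ r
    c₂ = trans (count-++ _ (replicate a _) p₁) (trans (cong₂ _+_ (trans (count-replicate _ _ a) (*-zeroʳ a))
      (trans (count-++ _ (replicate r _) p₀) (cong₂ _+_ (trans (count-replicate _ _ r) (*-identityʳ r))
        (trans (count-replicate _ _ k) (*-zeroʳ k))))) (+-identityʳ r))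

map-pair-injective : ∀ {a b c} {A : Set a} {B : Set b} {C : Set c} (f : A → B) (g : A → C) xs ys →
                     map f xs ≡ map proj₁ ys → map g xs ≡ map proj₂ ys → map (λ x → f x , g x) xs ≡ ys
map-pair-injective f g [] [] _ _ = refl
map-pair-injective f g (x ∷ xs) (y ∷ ys) e e' =
  cong₂ _∷_ (cong₂ _,_ (List.∷-injectiveˡ e) (List.∷-injectiveˡ e'))
            (map-pair-injective f g xs ys (List.∷-injectiveʳ e) (List.∷-injectiveʳ e'))

module _ {n} {F G : Subset n} (G⊆F : G ⊆ F) where

  private
    col : Fin n → Bool × Bool
    col x = lookup F x , lookup G x

    colours : ∀ c → ℕ
    colours c = ∑F λ x → ⟦ lookup ⊤ x ⟧ * ⟦ does (≡-dec Bool._≟_ Bool._≟_ (col x) c) ⟧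

    at-colour : ∀ x → ∀ c → ⟦ lookup ⊤ x ⟧ * ⟦ does (≡-dec Bool._≟_ Bool._≟_ (col x) c) ⟧ ≡ ⟦ does (≡-dec Bool._≟_ Bool._≟_ (col x) c) ⟧
    at-colour x c rewrite lookup-replicate x true = +-identityʳ _

    drop-⊤ : ∀ c → colours c ≡ ∑F λ x → ⟦ does (≡-dec Bool._≟_ Bool._≟_ (col x) c) ⟧
    drop-⊤ c = ∑-cong (allFin n) λ {x} _ → at-colour x c

    implies : ∀ x → lookup G x ≡ true → lookup F x ≡ true
    implies x Gx = []=⇒lookup (G⊆F (lookup⇒[]= x G Gx))

    colours-TT : colours (true , true) ≡ ∣ G ∣
    colours-TT = trans (drop-⊤ _) (trans (∑-cong (allFin n) λ {x} _ → by (lookup F x) (lookup G x) (implies x)) (size≡∣∣ G))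
      where
      by : ∀ f g → (g ≡ true → f ≡ true) → ⟦ does (≡-dec Bool._≟_ Bool._≟_ (f , g) (true , true)) ⟧ ≡ ⟦ g ⟧
      by true true _ = refl
      by true false _ = refl
      by false true h with () ← h refl
      by false false _ = refl

    colours-FT : colours (false , true) ≡ 0
    colours-FT = trans (drop-⊤ _) (trans (∑-cong (allFin n) λ {x} _ → by (lookup F x) (lookup G x) (implies x)) (∑-zero (allFin n)))
      where
      by : ∀ f g → (g ≡ true → f ≡ true) → ⟦ does (≡-dec Bool._≟_ Bool._≟_ (f , g) (false , true)) ⟧ ≡ 0
      by true true _ = refl
      by true false _ = refl
      by false true h with () ← h refl
      by false false _ = refl

    colours-TF : colours (true , false) + ∣ G ∣ ≡ ∣ F ∣
    colours-TF = begin
      colours (true , false) + ∣ G ∣ ≡⟨ cong₂ _+_ (drop-⊤ _) (sym (size≡∣∣ G)) ⟩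
      ∑F (λ x → ⟦ does (≡-dec Bool._≟_ Bool._≟_ (col x) (true , false)) ⟧) + size G ≡⟨ ∑-+ (allFin n) _ _ ⟨
      ∑F (λ x → ⟦ does (≡-dec Bool._≟_ Bool._≟_ (col x) (true , false)) ⟧ + ⟦ lookup G x ⟧)
        ≡⟨ ∑-cong (allFin n) (λ {x} _ → by (lookup F x) (lookup G x) (implies x)) ⟩
      size F ≡⟨ size≡∣∣ F ⟩
      ∣ F ∣ ∎
      where
      open ≡-Reasoning
      by : ∀ f g → (g ≡ true → f ≡ true) → ⟦ does (≡-dec Bool._≟_ Bool._≟_ (f , g) (true , false)) ⟧ + ⟦ g ⟧ ≡ ⟦ f ⟧
      by true true _ = refl
      by true false _ = refl
      by false true h with () ← h refl
      by false false _ = refl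

    colours-FF : colours (false , false) + ∣ F ∣ ≡ n
    colours-FF = begin
      colours (false , false) + ∣ F ∣ ≡⟨ cong₂ _+_ (drop-⊤ _) (sym (size≡∣∣ F)) ⟩
      ∑F (λ x → ⟦ does (≡-dec Bool._≟_ Bool._≟_ (col x) (false , false)) ⟧) + size F ≡⟨ ∑-+ (allFin n) _ _ ⟨
      ∑F (λ x → ⟦ does (≡-dec Bool._≟_ Bool._≟_ (col x) (false , false)) ⟧ + ⟦ lookup F x ⟧)
        ≡⟨ ∑-cong (allFin n) (λ {x} _ → trans (by (lookup F x) (lookup G x) (implies x)) (cong ⟦_⟧ (sym (lookup-replicate x true)))) ⟩
      size {n} ⊤ ≡⟨ size-⊤ n ⟩
      n ∎
      where
      open ≡-Reasoning
      by : ∀ f g → (g ≡ true → f ≡ true) → ⟦ does (≡-dec Bool._≟_ Bool._≟_ (f , g) (false , false)) ⟧ + ⟦ f ⟧ ≡ 1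
      by true true _ = refl
      by true false _ = refl
      by false true h with () ← h refl
      by false false _ = refl

  -- Placing F at 0 and G at t determines the whole word of colours, so `E-count` applies; the
  -- inclusion excludes the colour (false , true).
  pair-count : ∀ t → t + ∣ G ∣ ≤ ∣ F ∣ → E n ⊤ (λ π → hit π F 0 * hit π G t) ≡ flags n ∣ G ∣ ∣ F ∣
  pair-count t t+a≤m = begin
    E n ⊤ (λ π → hit π F 0 * hit π G t)
      ≡⟨ E-ext n ⊤ (λ π → hit-× π F G t (map col π ≟ˡ p) (to π) (from₁ π) (from₂ π)) ⟩
    E n ⊤ (λ π → ⟦ does (map col π ≟ˡ p) ⟧)
      ≡⟨ cong (λ i → E i ⊤ (λ π → ⟦ does (map col π ≟ˡ p) ⟧)) (sym length≡) ⟩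
    E (length p) ⊤ (λ π → ⟦ does (map col π ≟ˡ p) ⟧)
      ≡⟨ E-count col p ⊤ counts ⟩
    fact p
      ≡⟨ fact-pattern₂ t a r k ⟩
    a ! * (t + r) ! * k !
      ≡⟨ cong (λ i → a ! * i ! * k !) t+r≡ ⟩
    flags n a m ∎
    where
    open ≡-Reasoning
    a = ∣ G ∣
    m = ∣ F ∣
    r = m ∸ (t + a)
    k = n ∸ m
    p = pattern₂ t a r k
    m≡ : t + (a + r) ≡ m
    m≡ = trans (sym (+-assoc t a r)) (m+[n∸m]≡n t+a≤m)
    length≡ : length p ≡ n
    length≡ = trans (length-pattern₂ t a r k) (trans (cong (_+ k) m≡) (m+[n∸m]≡n (∣p∣≤n F)))
    comm : ∀ a t r → a + (t + r) ≡ t + (a + r)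
    comm = solve-∀
    t+r≡ : t + r ≡ m ∸ a
    t+r≡ = trans (sym (m+n∸m≡n a (t + r))) (cong (_∸ a) (trans (comm a t r) m≡))
    r+k+t≡ : r + k + t ≡ n ∸ a
    r+k+t≡ = trans (sym (m+n∸m≡n a (r + k + t))) (cong (_∸ a) (trans (shuffle a r k t) (trans (cong (_+ k) m≡) (m+[n∸m]≡n (∣p∣≤n F)))))
      where
      shuffle : ∀ a r k t → a + (r + k + t) ≡ t + (a + r) + k
      shuffle = solve-∀
    first : map proj₁ p ≡ block 0 m k
    first = trans (map-proj₁ t a r k) (cong (λ i → block 0 i k) m≡)
    second : rot^ t (map proj₂ p) ≡ block 0 a (n ∸ a)
    second = trans (cong (rot^ t) (map-proj₂ t a r k)) (trans (rot^-block t a (r + k)) (cong (block 0 a) r+k+t≡))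
    to : ∀ π → map (lookup F) π ≡ block 0 m k → map (lookup G) (rot^ t π) ≡ block 0 a (n ∸ a) → map col π ≡ p
    to π f g = map-pair-injective (lookup F) (lookup G) π p (trans f (sym first))
      (rot^-injective t _ _ (trans (sym (map-rot^ (lookup G) t π)) (trans g (sym second))))
    from₁ : ∀ π → map col π ≡ p → map (lookup F) π ≡ block 0 m k
    from₁ π e = trans (List.map-∘ π) (trans (cong (map proj₁) e) first)
    from₂ : ∀ π → map col π ≡ p → map (lookup G) (rot^ t π) ≡ block 0 a (n ∸ a)
    from₂ π e = trans (map-rot^ (lookup G) t π) (trans (cong (rot^ t) (trans (List.map-∘ π) (cong (map proj₂) e))) second)
    counts : ∀ c → colours c ≡ count c p
    counts c = trans (by c) (sym (count-pattern₂ t a r k c))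
      where
      only : ∀ x y z w → x * 0 + (y * 1 + (z * 0 + w * 0)) ≡ y
      only = solve-∀
      by : ∀ c → colours c ≡ t * ⟦ does (≡-dec Bool._≟_ Bool._≟_ (true , false) c) ⟧ + (a * ⟦ does (≡-dec Bool._≟_ Bool._≟_ (true , true) c) ⟧
        + (r * ⟦ does (≡-dec Bool._≟_ Bool._≟_ (true , false) c) ⟧ + k * ⟦ does (≡-dec Bool._≟_ Bool._≟_ (false , false) c) ⟧))
      by (true , true) = trans colours-TT (sym (only t a r k))
      by (false , true) = trans colours-FT (sym (none t a r k))
        where
        none : ∀ x y z w → x * 0 + (y * 0 + (z * 0 + w * 0)) ≡ 0
        none = solve-∀
      by (true , false) = +-cancelʳ-≡ a _ _ (trans colours-TF (sym (trans (eq t a r k) m≡)))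
        where
        eq : ∀ t a r k → t * 1 + (a * 0 + (r * 1 + k * 0)) + a ≡ t + (a + r)
        eq = solve-∀
      by (false , false) = +-cancelʳ-≡ m _ _ (trans colours-FF (sym (trans (cong (_+ m) (eq t a r k)) (m∸n+n≡m (∣p∣≤n F)))))
        where
        eq : ∀ t a r k → t * 0 + (a * 0 + (r * 0 + k * 1)) ≡ k
        eq = solve-∀

E-rotations : ∀ n (f : List (Fin n) → ℕ) → E n ⊤ (λ π → ∑< n λ s → f (rot^ s π)) ≡ n * E n ⊤ f
E-rotations n f = trans (E-∑ n ⊤ (upTo n) (λ s π → f (rot^ s π)))
  (trans (∑-cong (upTo n) λ {s} _ → E-rot^ n ⊤ f s) (∑<-const n (E n ⊤ f)))

hit-pair : ∀ {n} {F G : Subset n} t → G ⊆ F → t + ∣ G ∣ ≤ ∣ F ∣ →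
           E n ⊤ (λ π → ∑< n λ s → hit π F s * hit π G (s + t)) ≡ n * flags n ∣ G ∣ ∣ F ∣
hit-pair {n} {F} {G} t G⊆F le = trans
  (E-ext n ⊤ λ π → ∑-cong (upTo n) λ {s} _ → cong₂ _*_ (hit-0 π F s) (hit-rot^ π G s t))
  (trans (E-rotations n (λ π → hit π F 0 * hit π G t)) (cong (n *_) (pair-count G⊆F t le)))

-- An indicator equals its square, so this is `hit-pair` for F paired with itself at offset 0.
hit-one : ∀ {n} (F : Subset n) → E n ⊤ (λ π → ∑< n λ s → hit π F s) ≡ n * (∣ F ∣ ! * (n ∸ ∣ F ∣) !)
hit-one {n} F = begin
  E n ⊤ (λ π → ∑< n λ s → hit π F s)
    ≡⟨ E-ext n ⊤ (λ π → ∑-cong (upTo n) λ {s} _ → trans (idem (hit π F s) (hit≤1 π F s))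
        (cong (λ i → hit π F s * hit π F i) (sym (+-identityʳ s)))) ⟩
  E n ⊤ (λ π → ∑< n λ s → hit π F s * hit π F (s + 0))
    ≡⟨ hit-pair {F = F} {F} 0 id ≤-refl ⟩
  n * (∣ F ∣ ! * (∣ F ∣ ∸ ∣ F ∣) ! * (n ∸ ∣ F ∣) !)
    ≡⟨ cong (λ i → n * (∣ F ∣ ! * i ! * (n ∸ ∣ F ∣) !)) (n∸n≡0 ∣ F ∣) ⟩
  n * (∣ F ∣ ! * 1 * (n ∸ ∣ F ∣) !)
    ≡⟨ cong (λ i → n * (i * (n ∸ ∣ F ∣) !)) (*-identityʳ (∣ F ∣ !)) ⟩
  n * (∣ F ∣ ! * (n ∸ ∣ F ∣) !) ∎
  where
  open ≡-Reasoning
  idem : ∀ b → b ≤ 1 → b ≡ b * b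
  idem zero _ = refl
  idem (suc zero) _ = refl
  idem (suc (suc _)) (s≤s ())

E-const : ∀ {n} k (R : Subset n) c → size R ≡ k → E k R (λ _ → c) ≡ k ! * c
E-const zero R c _ = sym (+-identityʳ c)
E-const {n} (suc k) R c sz = begin
  ∑F (λ x → ⟦ lookup R x ⟧ * E k (R ∖ x) (λ _ → c))
    ≡⟨ ∑-cong (allFin n) (λ {x} _ → by x (lookup R x) refl) ⟩
  ∑F (λ x → ⟦ lookup R x ⟧ * (k ! * c)) ≡⟨ ∑-*ʳ (k ! * c) (allFin n) _ ⟩
  size R * (k ! * c)                    ≡⟨ cong (_* (k ! * c)) sz ⟩
  suc k * (k ! * c)                     ≡⟨ *-assoc (suc k) (k !) c ⟨
  suc k ! * c                           ∎
  where
  open ≡-Reasoning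
  by : ∀ x b → lookup R x ≡ b → ⟦ b ⟧ * E k (R ∖ x) (λ _ → c) ≡ ⟦ b ⟧ * (k ! * c)
  by x false _ = refl
  by x true Rx = cong (1 *_) (E-const k (R ∖ x) c (suc-injective (trans (sym (size-∖ R Rx)) sz)))

-- Butterfly-free families

private
  _≟ˢ_ : ∀ {n} (F G : Subset n) → Dec (F ≡ G)
  _≟ˢ_ = Vec.≡-dec Bool._≟_

*≤1 : ∀ {a b} → a ≤ 1 → b ≤ 1 → a * b ≤ 1
*≤1 = *-mono-≤

nil : ℕ → ℕ
nil zero = 1
nil (suc _) = 0

nil⁺ : ∀ {x} → 0 < nil x → x ≡ 0
nil⁺ {zero} _ = refl

module Family {n} (𝓕 : List (Subset n)) (unique : Unique 𝓕) (intersecting : Intersecting 𝓕) (bfree : BFree 𝓕)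
              (sizes : ∀ {F} → F ∈ 𝓕 → 2 ≤ ∣ F ∣ × ∣ F ∣ + 2 ≤ n) where

  opaque
    lt : Subset n → Subset n → ℕ
    lt G F = ⟦ does ((G ⊆? F) ×-dec (∣ G ∣ <? ∣ F ∣)) ⟧

    lt⁻ : ∀ {G F} → 0 < lt G F → G ⊆ F × ∣ G ∣ < ∣ F ∣
    lt⁻ {G} {F} = ⟦⟧⁺ ((G ⊆? F) ×-dec (∣ G ∣ <? ∣ F ∣))

    lt⁺ : ∀ {G F} → G ⊆ F × ∣ G ∣ < ∣ F ∣ → lt G F ≡ 1
    lt⁺ {G} {F} = ⟦yes⟧ ((G ⊆? F) ×-dec (∣ G ∣ <? ∣ F ∣))

    lt≤1 : ∀ G F → lt G F ≤ 1
    lt≤1 G F = ⟦⟧≤1 _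

  lower-covers upper-covers : Subset n → ℕ
  lower-covers F = ∑ 𝓕 λ G → lt G F
  upper-covers F = ∑ 𝓕 λ G → lt F G

  opaque
   mid : Subset n → ℕ
   mid F = ⟦ does (0 <? lower-covers F) ⟧ * ⟦ does (0 <? upper-covers F) ⟧

   mid≤1 : ∀ F → mid F ≤ 1
   mid≤1 F = *≤1 (⟦⟧≤1 (does (0 <? lower-covers F))) (⟦⟧≤1 (does (0 <? upper-covers F)))

   mid⁺ : ∀ {F} → 0 < lower-covers F → 0 < upper-covers F → mid F ≡ 1
   mid⁺ {F} p q = cong₂ _*_ (⟦yes⟧ (0 <? lower-covers F) p) (⟦yes⟧ (0 <? upper-covers F) q)

   mid⁻ : ∀ {F} → 0 < mid F → 0 < lower-covers F × 0 < upper-covers F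
   mid⁻ {F} p = ⟦⟧⁺ (0 <? lower-covers F) (pos-*ˡ _ _ p) ,
                ⟦⟧⁺ (0 <? upper-covers F) (pos-*ʳ ⟦ does (0 <? lower-covers F) ⟧ _ p)

  private
    ≢-size : ∀ {F G : Subset n} → ∣ F ∣ < ∣ G ∣ → F ≢ G
    ≢-size lt refl = <-irrefl refl lt

  -- Two members below F lie both below F and below any member C above F, which is a butterfly. In
  -- `unique-above` the butterfly consists of a member A below F and F itself, under two members
  -- above F.
  unique-below : ∀ {F G G'} → F ∈ 𝓕 → 0 < mid F → G ∈ 𝓕 → G' ∈ 𝓕 → 0 < lt G F → 0 < lt G' F → G ≡ G'
  unique-below {F} {G} {G'} F∈ m G∈ G'∈ p p' with G ≟ˢ G'
  ... | yes eq = eq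
  ... | no G≢G' with C , C∈ , q ← ∑-pos 𝓕 _ (proj₂ (mid⁻ {F} m))
    with G⊆F , G<F ← lt⁻ p | G'⊆F , G'<F ← lt⁻ p' | F⊆C , F<C ← lt⁻ q =
    ⊥-elim (bfree G∈ G'∈ F∈ C∈ G≢G' (≢-size G<F) (≢-size (<-trans G<F F<C)) (≢-size G'<F) (≢-size (<-trans G'<F F<C)) (≢-size F<C)
      (G⊆F , G'⊆F , ⊆-trans G⊆F F⊆C , ⊆-trans G'⊆F F⊆C))

  unique-above : ∀ {F G G'} → F ∈ 𝓕 → 0 < mid F → G ∈ 𝓕 → G' ∈ 𝓕 → 0 < lt F G → 0 < lt F G' → G ≡ G'
  unique-above {F} {G} {G'} F∈ m G∈ G'∈ p p' with G ≟ˢ G'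
  ... | yes eq = eq
  ... | no G≢G' with A , A∈ , q ← ∑-pos 𝓕 _ (proj₁ (mid⁻ {F} m))
    with F⊆G , F<G ← lt⁻ p | F⊆G' , F<G' ← lt⁻ p' | A⊆F , A<F ← lt⁻ q =
    ⊥-elim (bfree A∈ F∈ G∈ G'∈ (≢-size A<F) (≢-size (<-trans A<F F<G)) (≢-size (<-trans A<F F<G')) (≢-size F<G) (≢-size F<G') G≢G'
      (⊆-trans A⊆F F⊆G , F⊆G , ⊆-trans A⊆F F⊆G' , F⊆G'))

  module _ (π : List (Fin n)) where

    -- Occurrences of members of 𝓕, as intervals of π, inside and around the interval F placed at s.
    dn up : Subset n → ℕ → ℕ
    dn F s = ∑ 𝓕 λ G → lt G F * ∑< (suc (∣ F ∣ ∸ ∣ G ∣)) λ t → hit π G (s + t)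
    up F s = ∑ 𝓕 λ G → lt F G * ∑< (suc (∣ G ∣ ∸ ∣ F ∣)) λ t → hit π G (s + (n ∸ t))

    extremal : (Subset n → ℕ → ℕ) → ℕ → ℕ → ℕ
    extremal blk s l = ∑ 𝓕 λ F → ⟦ does (∣ F ∣ ≟ l) ⟧ * (hit π F s * nil (blk F s))

  opaque
    only : ∀ {P Q : Set} → Dec P → Dec Q → ℕ → ℕ → ℕ
    only p? q? m x = m * (⟦ does p? ⟧ * ⟦ does q? ⟧ * x)

    only≤1 : ∀ {P Q : Set} (p? : Dec P) (q? : Dec Q) {m x} → m ≤ 1 → x ≤ 1 → only p? q? m x ≤ 1
    only≤1 p? q? m≤1 x≤1 = *≤1 m≤1 (*≤1 (*≤1 (⟦⟧≤1 (does p?)) (⟦⟧≤1 (does q?))) x≤1)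

    only⁻ : ∀ {P Q : Set} (p? : Dec P) (q? : Dec Q) {m x} → 0 < only p? q? m x → 0 < m × P × Q × 0 < x
    only⁻ p? q? {m} {x} pos = pos-*ˡ m _ pos , ⟦⟧⁺ p? (pos-*ˡ _ ⟦ does q? ⟧ pq) , ⟦⟧⁺ q? (pos-*ʳ ⟦ does p? ⟧ _ pq) ,
                              pos-*ʳ (⟦ does p? ⟧ * ⟦ does q? ⟧) x rest
      where
      rest : 0 < ⟦ does p? ⟧ * ⟦ does q? ⟧ * x
      rest = pos-*ʳ m _ pos
      pq : 0 < ⟦ does p? ⟧ * ⟦ does q? ⟧
      pq = pos-*ˡ (⟦ does p? ⟧ * ⟦ does q? ⟧) x rest

    only-1 : ∀ {P Q : Set} (p? : Dec P) (q? : Dec Q) → only p? q? 1 1 ≡ ⟦ does p? ⟧ * ⟦ does q? ⟧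
    only-1 p? q? = trans (*-identityˡ _) (*-identityʳ _)

  -- κ₁ and κ₂ select the pairs charged pen₁ and pen₂, and τ₁ π s and τ₂ π s count the selected
  -- pairs placed at s in π.
  κ₁ κ₂ : Subset n → Subset n → ℕ
  κ₁ F G = only (∣ F ∣ ≟ 3) (∣ G ∣ ≟ 2) (mid F) (lt G F)
  κ₂ F G = only (∣ F ∣ ≟ n ∸ 3) (∣ G ∣ ≟ n ∸ 2) (mid F) (lt F G)

  κ₁≤1 : ∀ F G → κ₁ F G ≤ 1
  κ₁≤1 F G = only≤1 _ _ (mid≤1 F) (lt≤1 G F)

  κ₂≤1 : ∀ F G → κ₂ F G ≤ 1
  κ₂≤1 F G = only≤1 _ _ (mid≤1 F) (lt≤1 F G)

  κ₁⁻ : ∀ {F G} → 0 < κ₁ F G → 0 < mid F × ∣ F ∣ ≡ 3 × ∣ G ∣ ≡ 2 × 0 < lt G F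
  κ₁⁻ {F} {G} = only⁻ (∣ F ∣ ≟ 3) (∣ G ∣ ≟ 2)

  κ₂⁻ : ∀ {F G} → 0 < κ₂ F G → 0 < mid F × ∣ F ∣ ≡ n ∸ 3 × ∣ G ∣ ≡ n ∸ 2 × 0 < lt F G
  κ₂⁻ {F} {G} = only⁻ (∣ F ∣ ≟ n ∸ 3) (∣ G ∣ ≟ n ∸ 2)

  τ₁ τ₂ : List (Fin n) → ℕ → ℕ
  τ₁ π s = ∑ 𝓕 λ F → ∑ 𝓕 λ G → κ₁ F G * (hit π F s * hit π G (s + 0))
  τ₂ π s = ∑ 𝓕 λ F → ∑ 𝓕 λ G → κ₂ F G * (hit π F (s + 1) * hit π G s)

  -- The minimal and the maximal intervals on one cycle

  module PerCycle {π : List (Fin n)} (o : OrderingOf n ⊤ π) where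
    open OnOrdering o

    h : Subset n → ℕ → ℕ
    h = hit π

    h⁻ : ∀ {F s} → 0 < h F s → F At s
    h⁻ p = at (hit⁻ p)

    h⁺ : ∀ {F s} → F At s → h F s ≡ 1
    h⁺ (at w) = hit⁺ w

    h-periodic : ∀ F s → h F (s + n) ≡ h F s
    h-periodic F s = trans (hit-0 π F (s + n)) (trans (cong (λ xs → hit xs F 0) (rot^-periodic s)) (sym (hit-0 π F s)))

    At-periodic : ∀ {F s} → F At s → F At (s + n)
    At-periodic {F} {s} f = h⁻ (subst (0 <_) (sym (trans (h-periodic F s) (h⁺ f))) z<s)

    At-gap : ∀ {F s s'} → s < n → F At s' → F At (s + gap n s s')
    At-gap {F} {s} {s'} s<n f with gap-spec s' s<n
    ... | inj₁ e = subst (F At_) (sym e) f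
    ... | inj₂ e = subst (F At_) (sym e) (At-periodic f)

    dn-periodic : ∀ F s → dn π F (s + n) ≡ dn π F s
    dn-periodic F s = ∑-cong 𝓕 λ {G} _ → cong (lt G F *_) (∑-cong (upTo (suc (∣ F ∣ ∸ ∣ G ∣))) λ {t} _ →
      trans (cong (h G) (comm s n t)) (h-periodic G (s + t)))
      where
      comm : ∀ s n t → s + n + t ≡ s + t + n
      comm = solve-∀

    up-periodic : ∀ F s → up π F (s + n) ≡ up π F s
    up-periodic F s = ∑-cong 𝓕 λ {G} _ → cong (lt F G *_) (∑-cong (upTo (suc (∣ G ∣ ∸ ∣ F ∣))) λ {t} _ →
      trans (cong (h G) (comm s n (n ∸ t))) (h-periodic G (s + (n ∸ t))))
      where
      comm : ∀ s n t → s + n + t ≡ s + t + n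
      comm = solve-∀

    -- Disjointness contradicts the intersecting property, so a clash is a proper inclusion. It
    -- witnesses both that the outer interval is not minimal and that the inner one is not maximal,
    -- which serves both antichains at once.
    clash⇒below : ∀ {F G s d} → F ∈ 𝓕 → G ∈ 𝓕 → F At s → G At (s + d) → Clash n (∣ F ∣) d (∣ G ∣) →
                  0 < lt G F × 0 < dn π F s × 0 < up π G (s + d)
    clash⇒below F∈ G∈ f g (apart l≤d d+l'≤n) = ⊥-elim (At-apart f g l≤d d+l'≤n (intersecting F∈ G∈))
    clash⇒below {F} {G} {s} {d} F∈ G∈ f g (nested l'<l d+l'≤l) = G<F ,
      <-≤-trans (pos-* G<F (<-≤-trans (subst (0 <_) (sym (h⁺ g)) z<s) (∑-term (λ t → h G (s + t)) d∈)))
                (∑-term (λ G → lt G F * ∑< (suc (∣ F ∣ ∸ ∣ G ∣)) λ t → h G (s + t)) G∈) ,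
      <-≤-trans (pos-* G<F (<-≤-trans (subst (0 <_) (sym f′) z<s) (∑-term (λ t → h F (s + d + (n ∸ t))) d∈)))
                (∑-term (λ F → lt G F * ∑< (suc (∣ F ∣ ∸ ∣ G ∣)) λ t → h F (s + d + (n ∸ t))) F∈)
      where
      G<F : 0 < lt G F
      G<F = subst (0 <_) (sym (lt⁺ (At-inside f g d+l'≤l , l'<l))) z<s
      d∈ : d ∈ upTo (suc (∣ F ∣ ∸ ∣ G ∣))
      d∈ = ∈-upTo⁺ (s≤s (m+n≤o⇒m≤o∸n d d+l'≤l))
      d≤n : d ≤ n
      d≤n = ≤-trans (m≤m+n d _) (≤-trans d+l'≤l (∣p∣≤n F))
      f′ : h F (s + d + (n ∸ d)) ≡ 1
      f′ = trans (cong (h F) (trans (+-assoc s d (n ∸ d)) (cong (s +_) (m+[n∸m]≡n d≤n)))) (trans (h-periodic F s) (h⁺ f))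

    -- One construction for both antichains: all it needs is that in a nested pair one of the two
    -- intervals is blocked, the outer one by `dn`, the inner one by `up`.
    module Extremal (blk : Subset n → ℕ → ℕ) (blk-periodic : ∀ F s → blk F (s + n) ≡ blk F s)
                    (blocks : ∀ {F G s d} → 0 < dn π F s × 0 < up π G (s + d) → blk F s ≡ 0 → blk G (s + d) ≢ 0) where

      B : ℕ → ℕ → ℕ
      B = extremal π blk

      B⁻ : ∀ {s l} → 0 < B s l → ∃[ F ] (F ∈ 𝓕 × ∣ F ∣ ≡ l × F At s × blk F s ≡ 0)
      B⁻ {s} {l} b with F , F∈ , p ← ∑-pos 𝓕 _ b = F , F∈ , ⟦⟧⁺ (∣ F ∣ ≟ l) (pos-*ˡ _ _ p) , h⁻ (pos-*ˡ _ _ q) , nil⁺ (pos-*ʳ (h F s) _ q)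
        where q = pos-*ʳ ⟦ does (∣ F ∣ ≟ l) ⟧ _ p

      B⁺ : ∀ {F s} → F ∈ 𝓕 → F At s → blk F s ≡ 0 → 0 < B s ∣ F ∣
      B⁺ {F} {s} F∈ f z = <-≤-trans (pos-* (subst (0 <_) (sym (⟦yes⟧ (∣ F ∣ ≟ ∣ F ∣) refl)) z<s)
        (pos-* (subst (0 <_) (sym (h⁺ f)) z<s) (subst (λ x → 0 < nil x) (sym z) z<s))) (∑-term _ F∈)

      system : IntersectingAntichain n B
      system = record
        { periodic = λ s l → ∑-cong 𝓕 λ {F} _ → cong (⟦ does (∣ F ∣ ≟ l) ⟧ *_) (cong₂ (λ x y → x * nil y) (h-periodic F s) (blk-periodic F s))
        ; ≤1 = λ s l → ∑-single _ 1 unique (λ {F} _ → *≤1 (⟦⟧≤1 (does (∣ F ∣ ≟ l))) (*≤1 (hit≤1 π F s) (nil≤1 (blk F s))))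
            λ {F} {G} _ _ p q → At-injective (h⁻ (pos-*ˡ _ _ (pos-*ʳ ⟦ does (∣ F ∣ ≟ l) ⟧ _ p))) (h⁻ (pos-*ˡ _ _ (pos-*ʳ ⟦ does (∣ G ∣ ≟ l) ⟧ _ q)))
              (trans (⟦⟧⁺ (∣ F ∣ ≟ l) (pos-*ˡ _ _ p)) (sym (⟦⟧⁺ (∣ G ∣ ≟ l) (pos-*ˡ _ _ q))))
        ; range = λ s l b → range (B⁻ b)
        ; no-clash = λ s l d l' b b' → no-clash (B⁻ b) (B⁻ b')
        }
        where
        nil≤1 : ∀ x → nil x ≤ 1
        nil≤1 zero = ≤-refl
        nil≤1 (suc x) = z≤n
        range : ∀ {s l} → ∃[ F ] (F ∈ 𝓕 × ∣ F ∣ ≡ l × F At s × blk F s ≡ 0) → 2 ≤ l × l + 2 ≤ n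
        range (F , F∈ , refl , _) = sizes F∈
        no-clash : ∀ {s l d l'} → ∃[ F ] (F ∈ 𝓕 × ∣ F ∣ ≡ l × F At s × blk F s ≡ 0) →
                   ∃[ F ] (F ∈ 𝓕 × ∣ F ∣ ≡ l' × F At (s + d) × blk F (s + d) ≡ 0) → ¬ Clash n l d l'
        no-clash (F , F∈ , refl , f , z) (G , G∈ , refl , g , z') c = blocks (proj₂ (clash⇒below F∈ G∈ f g c)) z z'

      total≡ : IntersectingAntichain.total system ≡ ∑< n λ s → ∑ 𝓕 λ F → W n ∣ F ∣ * (h F s * nil (blk F s))
      total≡ = ∑-cong (upTo n) λ {s} _ → begin
        ∑ (lens n) (λ l → W n l * ∑ 𝓕 (λ F → ⟦ does (∣ F ∣ ≟ l) ⟧ * x F s))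
          ≡⟨ ∑-cong (lens n) (λ {l} _ → sym (∑-*ˡ (W n l) 𝓕 _)) ⟩
        ∑ (lens n) (λ l → ∑ 𝓕 λ F → W n l * (⟦ does (∣ F ∣ ≟ l) ⟧ * x F s))
          ≡⟨ ∑-swap (lens n) 𝓕 _ ⟩
        ∑ 𝓕 (λ F → ∑ (lens n) λ l → W n l * (⟦ does (∣ F ∣ ≟ l) ⟧ * x F s))
          ≡⟨ ∑-cong 𝓕 (λ {F} F∈ → trans
               (∑-only (λ l → W n l * (⟦ does (∣ F ∣ ≟ l) ⟧ * x F s)) {∣ F ∣} (lens! n) (uncurry ∈-lens (sizes F∈))
                 λ {l} _ p → sym (⟦⟧⁺ (∣ F ∣ ≟ l) (pos-*ˡ _ _ (pos-*ʳ (W n l) _ p))))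
               (cong (W n ∣ F ∣ *_) (trans (cong (_* x F s) (⟦yes⟧ (∣ F ∣ ≟ ∣ F ∣) refl)) (*-identityˡ (x F s))))) ⟩
        ∑ 𝓕 (λ F → W n ∣ F ∣ * x F s) ∎
        where
        open ≡-Reasoning
        x : Subset n → ℕ → ℕ
        x F s = h F s * nil (blk F s)

    -- A set is determined by its position and its size, and κ prescribes both sizes.
    pair-sum≤1 : ∀ (κ : Subset n → Subset n → ℕ) {p q} → (∀ F G → κ F G ≤ 1) → (∀ {F G} → 0 < κ F G → ∣ F ∣ ≡ p × ∣ G ∣ ≡ q) →
                 ∀ s s' → (∑ 𝓕 λ F → ∑ 𝓕 λ G → κ F G * (h F s * h G s')) ≤ 1
    pair-sum≤1 κ κ≤1 κ-sizes s s' = ∑-single _ 1 unique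
      (λ {F} _ → ∑-single _ 1 unique (λ {G} _ → *≤1 (κ≤1 F G) (*≤1 (hit≤1 π F s) (hit≤1 π G s')))
        λ {G} {G'} _ _ p q → At-injective (second F G p) (second F G' q) (trans (proj₂ (κ-sizes (first p))) (sym (proj₂ (κ-sizes (first q))))))
      λ {F} {F'} _ _ p q → injective F F' p q
      where
      first : ∀ {F G} → 0 < κ F G * (h F s * h G s') → 0 < κ F G
      first p = pos-*ˡ _ _ p
      second : ∀ F G → 0 < κ F G * (h F s * h G s') → G At s'
      second F G p = h⁻ (pos-*ʳ (h F s) _ (pos-*ʳ (κ F G) _ p))
      injective : ∀ F F' → 0 < ∑ 𝓕 (λ G → κ F G * (h F s * h G s')) → 0 < ∑ 𝓕 (λ G → κ F' G * (h F' s * h G s')) → F ≡ F'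
      injective F F' p q with G , _ , p' ← ∑-pos 𝓕 _ p | G' , _ , q' ← ∑-pos 𝓕 _ q =
        At-injective (h⁻ (pos-*ˡ _ _ (pos-*ʳ (κ F G) _ p'))) (h⁻ (pos-*ˡ _ _ (pos-*ʳ (κ F' G') _ q')))
          (trans (proj₁ (κ-sizes (first p'))) (sym (proj₁ (κ-sizes (first q')))))

    pair-sum⁻ : ∀ (κ : Subset n → Subset n → ℕ) {s s'} → 0 < (∑ 𝓕 λ F → ∑ 𝓕 λ G → κ F G * (h F s * h G s')) →
                ∃[ F ] ∃[ G ] (F ∈ 𝓕 × G ∈ 𝓕 × 0 < κ F G × F At s × G At s')
    pair-sum⁻ κ {s} p with F , F∈ , q ← ∑-pos 𝓕 _ p with G , G∈ , r ← ∑-pos 𝓕 _ q =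
      F , G , F∈ , G∈ , pos-*ˡ _ _ r , h⁻ (pos-*ˡ _ _ hh) , h⁻ (pos-*ʳ (h F s) _ hh)
      where hh = pos-*ʳ (κ F G) _ r

    private
      dn-blocks : ∀ {F G s d} → 0 < dn π F s × 0 < up π G (s + d) → dn π F s ≡ 0 → dn π G (s + d) ≢ 0
      dn-blocks (p , _) z _ = <-irrefl (sym z) p

      up-blocks : ∀ {F G s d} → 0 < dn π F s × 0 < up π G (s + d) → up π F s ≡ 0 → up π G (s + d) ≢ 0
      up-blocks (_ , q) _ z = <-irrefl (sym z) q

    module Min = Extremal (dn π) dn-periodic (λ {F} {G} → dn-blocks {F} {G})
    module Max = Extremal (up π) up-periodic (λ {F} {G} → up-blocks {F} {G})
    module MinC = Charged Min.system
    module MaxC = Charged Max.system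

    position : ∀ {F s s'} → F ∈ 𝓕 → s < n → s' < n → F At s → F At s' → s ≡ s'
    position F∈ s<n s'<n f f' with 2≤ , ≤n ← sizes F∈ =
      At-unique (≤-trans (s≤s z≤n) 2≤) (≤-trans (m<m+n _ (s≤s z≤n)) ≤n) s<n s'<n f f'

    -- The 2-set G is minimal because no member is smaller. Another minimal H can clash with the
    -- middle set F only by containing it, so that H is not minimal, or by lying in it, so that H is
    -- G by `unique-below`.
    charge-min : MinC.Chargeable (τ₁ π) MinC.lower (λ s → s , 3)
    charge-min = record
      { τ≤1 = λ {s} _ → pair-sum≤1 κ₁ κ₁≤1 (λ p → let _ , e , e' , _ = κ₁⁻ p in e , e') s (s + 0)
      ; member! = λ {s} _ p → member! s (pair-sum⁻ κ₁ p)
      ; extend = λ {s} s<n p t<n b → extend s s<n (pair-sum⁻ κ₁ p) t<n (Min.B⁻ b)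
      }
      where
      Pair : ℕ → Set
      Pair s = ∃[ F ] ∃[ G ] (F ∈ 𝓕 × G ∈ 𝓕 × 0 < κ₁ F G × F At s × G At (s + 0))
      minimal : ∀ {G} s → ∣ G ∣ ≡ 2 → dn π G s ≡ 0
      minimal {G} s e = ∑-null 𝓕 _ λ {H} H∈ p → <⇒≱ (proj₂ (lt⁻ (pos-*ˡ (lt H G) _ p))) (subst (_≤ ∣ H ∣) (sym e) (proj₁ (sizes H∈)))
      member! : ∀ s → Pair s → 0 < Min.B s 2
      member! s (F , G , F∈ , G∈ , κ , f , g) with _ , _ , G2 , _ ← κ₁⁻ κ =
        subst (λ l → 0 < Min.B s l) G2 (Min.B⁺ G∈ (subst (G At_) (+-identityʳ s) g) (minimal s G2))
      extend : ∀ s → s < n → Pair s → ∀ {t l} → t < n → ∃[ H ] (H ∈ 𝓕 × ∣ H ∣ ≡ l × H At t × dn π H t ≡ 0) →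
               (t , l) ≡ MinC.lower s ⊎ Compatible n (t , l) (s , 3)
      extend s s<n (F , G , F∈ , G∈ , κ , f , g) {t} t<n (H , H∈ , refl , ht , z) with m , F3 , G2 , G<F ← κ₁⁻ κ with H ≟ˢ G
      ... | yes refl = inj₁ (cong₂ _,_ (position G∈ t<n s<n ht (subst (G At_) (+-identityʳ s) g)) G2)
      ... | no H≢G = inj₂
        ( (λ c → <-irrefl (sym z) (proj₁ (proj₂ (clash⇒below H∈ F∈ ht (At-gap t<n f) (subst (Clash n ∣ H ∣ (gap n t s)) (sym F3) c)))))
        , (λ c → H≢G (unique-below F∈ m H∈ G∈ (proj₁ (clash⇒below F∈ H∈ f (At-gap s<n ht) (subst (λ l → Clash n l (gap n s t) (∣ H ∣)) (sym F3) c))) G<F)) )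

    -- Dual to `charge-min`. The charged pair shares its right end, so the middle set starts one
    -- place after G; `next n s` is that place reduced to a start below n.
    charge-max : MaxC.Chargeable (τ₂ π) MaxC.upper (λ s → next n s , n ∸ 3)
    charge-max = record
      { τ≤1 = λ {s} _ → pair-sum≤1 κ₂ κ₂≤1 (λ p → let _ , e , e' , _ = κ₂⁻ p in e , e') (s + 1) s
      ; member! = λ {s} _ p → member! s (pair-sum⁻ κ₂ p)
      ; extend = λ {s} s<n p t<n b → extend s s<n (pair-sum⁻ κ₂ p) t<n (Max.B⁻ b)
      }
      where
      Pair : ℕ → Set
      Pair s = ∃[ F ] ∃[ G ] (F ∈ 𝓕 × G ∈ 𝓕 × 0 < κ₂ F G × F At (s + 1) × G At s)
      maximal : ∀ {G} s → ∣ G ∣ ≡ n ∸ 2 → up π G s ≡ 0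
      maximal {G} s e = ∑-null 𝓕 _ λ {H} H∈ p → <⇒≱ (proj₂ (lt⁻ (pos-*ˡ (lt G H) _ p)))
        (subst (∣ H ∣ ≤_) (sym e) (m+n≤o⇒m≤o∸n ∣ H ∣ (proj₂ (sizes H∈))))
      member! : ∀ s → Pair s → 0 < Max.B s (n ∸ 2)
      member! s (F , G , F∈ , G∈ , κ , f , g) with _ , _ , G≡ , _ ← κ₂⁻ κ =
        subst (λ l → 0 < Max.B s l) G≡ (Max.B⁺ G∈ g (maximal s G≡))
      At-next : ∀ {F s} → F At (s + 1) → F At (next n s)
      At-next {F} {s} f with next-spec n s
      ... | inj₁ e = subst (F At_) (trans (+-comm s 1) (sym e)) f
      ... | inj₂ e = h⁻ (subst (0 <_) (sym (trans (sym (h-periodic F (next n s))) (trans (cong (h F) (trans e (+-comm 1 s))) (h⁺ f)))) z<s)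
      up-gap : ∀ H {s t} → s < n → up π H (s + gap n s t) ≡ up π H t
      up-gap H {s} {t} s<n with gap-spec t s<n
      ... | inj₁ e = cong (up π H) e
      ... | inj₂ e = trans (cong (up π H) e) (up-periodic H t)
      extend : ∀ s → s < n → Pair s → ∀ {t l} → t < n → ∃[ H ] (H ∈ 𝓕 × ∣ H ∣ ≡ l × H At t × up π H t ≡ 0) →
               (t , l) ≡ MaxC.upper s ⊎ Compatible n (t , l) (next n s , n ∸ 3)
      extend s s<n (F , G , F∈ , G∈ , κ , f , g) {t} t<n (H , H∈ , refl , ht , z) with m , F≡ , G≡ , F<G ← κ₂⁻ κ with H ≟ˢ G
      ... | yes refl = inj₁ (cong₂ _,_ (position G∈ t<n s<n ht g) G≡)
      ... | no H≢G = inj₂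
        ( (λ c → H≢G (unique-above F∈ m H∈ G∈ (proj₁ (clash⇒below H∈ F∈ ht (At-gap t<n f′) (subst (Clash n ∣ H ∣ (gap n t (next n s))) (sym F≡) c))) F<G))
        , (λ c → <-irrefl (sym (trans (up-gap H (next< s<n)) z)) (proj₂ (proj₂ (clash⇒below F∈ H∈ f′ (At-gap (next< s<n) ht)
                   (subst (λ l → Clash n l (gap n (next n s) t) ∣ H ∣) (sym F≡) c))))) )
        where f′ = At-next f

-- Averaging over all orderings

module Average {n} (𝓕 : List (Subset n)) (unique : Unique 𝓕) (intersecting : Intersecting 𝓕) (bfree : BFree 𝓕)
               (sizes : ∀ {F} → F ∈ 𝓕 → 2 ≤ ∣ F ∣ × ∣ F ∣ + 2 ≤ n) where
  open Family 𝓕 unique intersecting bfree sizes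

  w : Subset n → ℕ
  w F = W n ∣ F ∣

  Φ : Subset n → Subset n → ℕ
  Φ F G = flags n (∣ F ∣) (∣ G ∣)

  charged : List (Fin n) → ℕ
  charged π = ∑< n (λ s → ∑ 𝓕 λ F → w F * (1 + mid F) * hit π F s) + (pen₁ n * ∑< n (τ₁ π) + pen₂ n * ∑< n (τ₂ π))

  covers : List (Fin n) → ℕ
  covers π = ∑< n λ s → ∑ 𝓕 λ F → w F * mid F * (hit π F s * dn π F s + hit π F s * up π F s)

  -- By `multiplicity`, the hits together with the second count of middle sets are covered by the
  -- two antichains and the covers. Each antichain, with its own penalties added, weighs at most n
  -- times n!.
  per-cycle : ∀ {π} → OrderingOf n ⊤ π → charged π ≤ 2 * (n * n !) + covers π
  per-cycle {π} o = begin
    charged π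
      ≤⟨ +-monoˡ-≤ (P₁ + P₂) hits≤ ⟩
    (X + Y + covers π) + (P₁ + P₂)
      ≡⟨ regroup X Y (covers π) P₁ P₂ ⟩
    (X + P₁) + (Y + P₂) + covers π
      ≤⟨ +-monoˡ-≤ (covers π) (+-mono-≤ min≤ max≤) ⟩
    n * n ! + n * n ! + covers π
      ≡⟨ cong (λ x → n * n ! + x + covers π) (+-identityʳ (n * n !)) ⟨
    2 * (n * n !) + covers π ∎
    where
    open ≤-Reasoning
    open PerCycle o
    regroup : ∀ x y c p q → x + y + c + (p + q) ≡ (x + p) + (y + q) + c
    regroup = solve-∀
    X = ∑< n λ s → ∑ 𝓕 λ F → w F * (h F s * nil (dn π F s))
    Y = ∑< n λ s → ∑ 𝓕 λ F → w F * (h F s * nil (up π F s))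
    P₁ = pen₁ n * ∑< n (τ₁ π)
    P₂ = pen₂ n * ∑< n (τ₂ π)

    min≤ : X + P₁ ≤ n * n !
    min≤ = ≤-trans (≤-reflexive (cong₂ _+_ (sym Min.total≡)
      (sym (trans (∑-cong (upTo n) (λ {s} _ → trans (cong (pen₁ n * τ₁ π s +_) (*-zeroʳ (pen₂ n))) (+-identityʳ _))) (∑-*ˡ (pen₁ n) (upTo n) (τ₁ π))))))
      (MinC.gkk-charged {τ₂ = λ _ → 0} charge-min (record { τ≤1 = λ _ → z≤n ; member! = λ _ () ; extend = λ _ () }))

    max≤ : Y + P₂ ≤ n * n !
    max≤ = ≤-trans (≤-reflexive (cong₂ _+_ (sym Max.total≡)
      (sym (trans (∑-cong (upTo n) (λ {s} _ → cong (_+ pen₂ n * τ₂ π s) (*-zeroʳ (pen₁ n)))) (∑-*ˡ (pen₂ n) (upTo n) (τ₂ π))))))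
      (MaxC.gkk-charged {τ₁ = λ _ → 0} (record { τ≤1 = λ _ → z≤n ; member! = λ _ () ; extend = λ _ () }) charge-max)

    -- A member counted by neither extremal antichain is a middle set with both its covers on the cycle.
    multiplicity : ∀ F s → 1 + mid F ≤ nil (dn π F s) + nil (up π F s) + mid F * (dn π F s + up π F s)
    multiplicity F s with dn π F s in d | up π F s in u
    ... | zero | zero = s≤s (≤-trans (mid≤1 F) (m≤m+n 1 _))
    ... | zero | suc u′ = s≤s (m≤m*n (mid F) (suc u′))
    ... | suc d′ | zero = s≤s (m≤m*n (mid F) (suc d′ + 0))
    ... | suc d′ | suc u′ = subst (λ m → 1 + m ≤ m * (suc d′ + suc u′)) (sym (mid⁺ {F} (covered-below d) (covered-above u)))
      (s≤s (≤-trans (s≤s z≤n) (≤-trans (m≤n+m (suc u′) d′) (m≤m+n _ 0))))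
      where
      covered-below : dn π F s ≡ suc d′ → 0 < lower-covers F
      covered-below d with G , G∈ , p ← ∑-pos 𝓕 _ (subst (0 <_) (sym d) z<s) = <-≤-trans (pos-*ˡ (lt G F) _ p) (∑-term (λ G → lt G F) G∈)
      covered-above : up π F s ≡ suc u′ → 0 < upper-covers F
      covered-above u with G , G∈ , p ← ∑-pos 𝓕 _ (subst (0 <_) (sym u) z<s) = <-≤-trans (pos-*ˡ (lt F G) _ p) (∑-term (λ G → lt F G) G∈)

    hits≤ : ∑< n (λ s → ∑ 𝓕 λ F → w F * (1 + mid F) * h F s) ≤ X + Y + covers π
    hits≤ = begin
      ∑< n (λ s → ∑ 𝓕 λ F → w F * (1 + mid F) * h F s)
        ≤⟨ ∑-mono (upTo n) (λ {s} _ → ∑-mono 𝓕 λ {F} _ → ≤-trans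
             (*-monoˡ-≤ (h F s) (*-monoʳ-≤ (w F) (multiplicity F s)))
             (≤-reflexive (expand (w F) (nil (dn π F s)) (nil (up π F s)) (mid F) (dn π F s) (up π F s) (h F s)))) ⟩
      ∑< n (λ s → ∑ 𝓕 λ F → w F * (h F s * nil (dn π F s)) + w F * (h F s * nil (up π F s))
                             + w F * mid F * (h F s * dn π F s + h F s * up π F s))
        ≡⟨ ∑-cong (upTo n) (λ {s} _ → trans (∑-+ 𝓕 _ _) (cong (_+ ∑ 𝓕 λ F → w F * mid F * (h F s * dn π F s + h F s * up π F s)) (∑-+ 𝓕 _ _))) ⟩
      ∑< n (λ s → ∑ 𝓕 (λ F → w F * (h F s * nil (dn π F s))) + ∑ 𝓕 (λ F → w F * (h F s * nil (up π F s)))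
                   + ∑ 𝓕 (λ F → w F * mid F * (h F s * dn π F s + h F s * up π F s)))
        ≡⟨ trans (∑-+ (upTo n) _ _) (cong (_+ covers π) (∑-+ (upTo n) _ _)) ⟩
      X + Y + covers π ∎
      where
      expand : ∀ w a b m d u h → w * (a + b + m * (d + u)) * h ≡ w * (h * a) + w * (h * b) + w * m * (h * d + h * u)
      expand = solve-∀

  𝔼 : (List (Fin n) → ℕ) → ℕ
  𝔼 = E n ⊤

  N : Subset n → ℕ
  N F = ∣ F ∣ ! * (n ∸ ∣ F ∣) !

  𝔼-sum : ∀ (c : Subset n → ℕ) (x : List (Fin n) → Subset n → ℕ → ℕ) →
          𝔼 (λ π → ∑< n λ s → ∑ 𝓕 λ F → c F * x π F s) ≡ ∑ 𝓕 λ F → c F * 𝔼 (λ π → ∑< n (x π F))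
  𝔼-sum c x = begin
    𝔼 (λ π → ∑< n λ s → ∑ 𝓕 λ F → c F * x π F s)
      ≡⟨ E-ext n ⊤ (λ π → trans (∑-swap (upTo n) 𝓕 _) (∑-cong 𝓕 λ {F} _ → ∑-*ˡ (c F) (upTo n) (x π F))) ⟩
    𝔼 (λ π → ∑ 𝓕 λ F → c F * ∑< n (x π F))
      ≡⟨ E-∑ n ⊤ 𝓕 (λ F π → c F * ∑< n (x π F)) ⟩
    ∑ 𝓕 (λ F → 𝔼 (λ π → c F * ∑< n (x π F)))
      ≡⟨ ∑-cong 𝓕 (λ {F} _ → E-* n ⊤ (c F) (λ π → ∑< n (x π F))) ⟩
    ∑ 𝓕 (λ F → c F * 𝔼 (λ π → ∑< n (x π F))) ∎
    where open ≡-Reasoning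

  module _ {F G : Subset n} (F<G : 0 < lt F G) where
    private
      F⊆G = proj₁ (lt⁻ F<G)
      ∣F∣<∣G∣ = proj₂ (lt⁻ F<G)

    hits-inside : 𝔼 (λ π → ∑< n λ s → hit π G s * ∑< (suc (∣ G ∣ ∸ ∣ F ∣)) λ t → hit π F (s + t)) ≡
                  n * (suc (∣ G ∣ ∸ ∣ F ∣) * Φ F G)
    hits-inside = begin
      𝔼 (λ π → ∑< n λ s → hit π G s * ∑ offsets λ t → hit π F (s + t))
        ≡⟨ E-ext n ⊤ (λ π → trans (∑-cong (upTo n) λ {s} _ → sym (∑-*ˡ (hit π G s) offsets _)) (∑-swap (upTo n) offsets _)) ⟩
      𝔼 (λ π → ∑ offsets λ t → ∑< n λ s → hit π G s * hit π F (s + t))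
        ≡⟨ E-∑ n ⊤ offsets (λ t π → ∑< n λ s → hit π G s * hit π F (s + t)) ⟩
      ∑ offsets (λ t → 𝔼 (λ π → ∑< n λ s → hit π G s * hit π F (s + t)))
        ≡⟨ ∑-cong offsets (λ {t} t∈ → hit-pair t F⊆G (m≤o∸n⇒m+n≤o t (<⇒≤ ∣F∣<∣G∣) (≤-pred (∈-upTo⁻ t∈)))) ⟩
      ∑ offsets (λ _ → n * Φ F G)
        ≡⟨ ∑<-const (suc (∣ G ∣ ∸ ∣ F ∣)) _ ⟩
      suc (∣ G ∣ ∸ ∣ F ∣) * (n * Φ F G)
        ≡⟨ comm (suc (∣ G ∣ ∸ ∣ F ∣)) n (Φ F G) ⟩
      n * (suc (∣ G ∣ ∸ ∣ F ∣) * Φ F G) ∎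
      where
      open ≡-Reasoning
      offsets = upTo (suc (∣ G ∣ ∸ ∣ F ∣))
      comm : ∀ a b c → a * (b * c) ≡ b * (a * c)
      comm = solve-∀

    -- A start `n ∸ t` places on is t places back on the cycle. Shifting the sum by t indexes each
    -- pair by the start of the outer set and reduces the claim to `hits-inside`; this uses
    -- periodicity, hence a genuine ordering π.
    hits-around : 𝔼 (λ π → ∑< n λ s → hit π F s * ∑< (suc (∣ G ∣ ∸ ∣ F ∣)) λ t → hit π G (s + (n ∸ t))) ≡
                  n * (suc (∣ G ∣ ∸ ∣ F ∣) * Φ F G)
    hits-around = trans (E-cong n ⊤ (size-⊤ n) λ π o → recentre o) hits-inside
      where
      open ≡-Reasoning
      offsets = upTo (suc (∣ G ∣ ∸ ∣ F ∣))
      recentre : ∀ {π} → OrderingOf n ⊤ π →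
                 ∑< n (λ s → hit π F s * ∑ offsets λ t → hit π G (s + (n ∸ t))) ≡ ∑< n (λ s → hit π G s * ∑ offsets λ t → hit π F (s + t))
      recentre {π} o = begin
        ∑< n (λ s → hit π F s * ∑ offsets λ t → hit π G (s + (n ∸ t)))
          ≡⟨ trans (∑-cong (upTo n) λ {s} _ → sym (∑-*ˡ (hit π F s) offsets _)) (∑-swap (upTo n) offsets _) ⟩
        ∑ offsets (λ t → ∑< n λ s → hit π F s * hit π G (s + (n ∸ t)))
          ≡⟨ ∑-cong offsets (λ {t} t∈ → trans (sym (∑<-shift n (λ s → hit π F s * hit π G (s + (n ∸ t))) t (periodic t)))
               (∑-cong (upTo n) λ {s} _ → trans (cong₂ _*_ (cong (hit π F) (+-comm t s)) (back t s (t≤n t∈))) (*-comm _ (hit π G s)))) ⟩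
        ∑ offsets (λ t → ∑< n λ s → hit π G s * hit π F (s + t))
          ≡⟨ trans (∑-swap offsets (upTo n) _) (∑-cong (upTo n) λ {s} _ → ∑-*ˡ (hit π G s) offsets _) ⟩
        ∑< n (λ s → hit π G s * ∑ offsets λ t → hit π F (s + t)) ∎
        where
        open PerCycle o using (h-periodic)
        t≤n : ∀ {t} → t ∈ offsets → t ≤ n
        t≤n t∈ = ≤-trans (≤-pred (∈-upTo⁻ t∈)) (≤-trans (m∸n≤m ∣ G ∣ ∣ F ∣) (∣p∣≤n G))
          where open import Data.Fin.Subset.Properties using (∣p∣≤n)
        periodic : ∀ t s → hit π F (s + n) * hit π G (s + n + (n ∸ t)) ≡ hit π F s * hit π G (s + (n ∸ t))
        periodic t s = cong₂ _*_ (h-periodic F s) (trans (cong (hit π G) (comm s n (n ∸ t))) (h-periodic G (s + (n ∸ t))))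
          where
          comm : ∀ s n t → s + n + t ≡ s + t + n
          comm = solve-∀
        back : ∀ t s → t ≤ n → hit π G (t + s + (n ∸ t)) ≡ hit π G s
        back t s t≤n = trans (cong (hit π G) (trans (comm t s (n ∸ t)) (cong (s +_) (m+[n∸m]≡n t≤n)))) (h-periodic G s)
          where
          comm : ∀ t s x → t + s + x ≡ s + (t + x)
          comm = solve-∀

  inside around : Subset n → ℕ
  inside F = ∑ 𝓕 λ G → lt G F * (suc (∣ F ∣ ∸ ∣ G ∣) * Φ G F)
  around F = ∑ 𝓕 λ G → lt F G * (suc (∣ G ∣ ∸ ∣ F ∣) * Φ F G)

  private
    when-positive : ∀ l {x y} → (0 < l → x ≡ y) → l * x ≡ l * y
    when-positive zero _ = refl
    when-positive (suc l) e = cong (suc l *_) (e z<s)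

    pull-n : ∀ (l x : Subset n → ℕ) → ∑ 𝓕 (λ G → l G * (n * x G)) ≡ n * ∑ 𝓕 (λ G → l G * x G)
    pull-n l x = trans (∑-cong 𝓕 λ {G} _ → comm (l G) n (x G)) (∑-*ˡ n 𝓕 _)
      where
      comm : ∀ a b c → a * (b * c) ≡ b * (a * c)
      comm = solve-∀

    𝔼-weighted : ∀ (l : Subset n → ℕ) (x : List (Fin n) → ℕ → ℕ) (y : List (Fin n) → Subset n → ℕ → ℕ) →
                 𝔼 (λ π → ∑< n λ s → x π s * ∑ 𝓕 λ G → l G * y π G s) ≡ ∑ 𝓕 λ G → l G * 𝔼 (λ π → ∑< n λ s → x π s * y π G s)
    𝔼-weighted l x y = trans (E-ext n ⊤ λ π → ∑-cong (upTo n) λ {s} _ →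
        trans (sym (∑-*ˡ (x π s) 𝓕 _)) (∑-cong 𝓕 λ {G} _ → comm (x π s) (l G) (y π G s)))
      (𝔼-sum l λ π G s → x π s * y π G s)
      where
      comm : ∀ a b c → a * (b * c) ≡ b * (a * c)
      comm = solve-∀

  𝔼-dn : ∀ F → 𝔼 (λ π → ∑< n λ s → hit π F s * dn π F s) ≡ n * inside F
  𝔼-dn F = trans (𝔼-weighted (λ G → lt G F) (λ π → hit π F) (λ π G s → ∑< (suc (∣ F ∣ ∸ ∣ G ∣)) λ t → hit π G (s + t)))
    (trans (∑-cong 𝓕 λ {G} _ → when-positive (lt G F) hits-inside) (pull-n (λ G → lt G F) _))

  𝔼-up : ∀ F → 𝔼 (λ π → ∑< n λ s → hit π F s * up π F s) ≡ n * around F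
  𝔼-up F = trans (𝔼-weighted (λ G → lt F G) (λ π → hit π F) (λ π G s → ∑< (suc (∣ G ∣ ∸ ∣ F ∣)) λ t → hit π G (s + (n ∸ t))))
    (trans (∑-cong 𝓕 λ {G} _ → when-positive (lt F G) hits-around) (pull-n (λ G → lt F G) _))

  𝔼-covers : 𝔼 covers ≡ n * ∑ 𝓕 λ F → w F * mid F * (inside F + around F)
  𝔼-covers = begin
    𝔼 covers
      ≡⟨ 𝔼-sum (λ F → w F * mid F) (λ π F s → hit π F s * dn π F s + hit π F s * up π F s) ⟩
    ∑ 𝓕 (λ F → w F * mid F * 𝔼 (λ π → ∑< n λ s → hit π F s * dn π F s + hit π F s * up π F s))
      ≡⟨ ∑-cong 𝓕 (λ {F} _ → cong (w F * mid F *_) (trans (E-ext n ⊤ λ π → ∑-+ (upTo n) _ _) (trans (E-+ n ⊤ _ _)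
           (trans (cong₂ _+_ (𝔼-dn F) (𝔼-up F)) (sym (*-distribˡ-+ n (inside F) (around F))))))) ⟩
    ∑ 𝓕 (λ F → w F * mid F * (n * (inside F + around F)))
      ≡⟨ pull-n (λ F → w F * mid F) _ ⟩
    n * ∑ 𝓕 (λ F → w F * mid F * (inside F + around F)) ∎
    where open ≡-Reasoning

  fines₁ fines₂ : Subset n → ℕ
  fines₁ F = ∑ 𝓕 λ G → κ₁ F G * Φ G F
  fines₂ F = ∑ 𝓕 λ G → κ₂ F G * Φ F G

  private
    𝔼-pairs : ∀ (κ : Subset n → Subset n → ℕ) (x : List (Fin n) → Subset n → Subset n → ℕ → ℕ) (y : Subset n → Subset n → ℕ) →
              (∀ {F G} → 0 < κ F G → 𝔼 (λ π → ∑< n (x π F G)) ≡ n * y F G) →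
              𝔼 (λ π → ∑< n λ s → ∑ 𝓕 λ F → ∑ 𝓕 λ G → κ F G * x π F G s) ≡ n * ∑ 𝓕 λ F → ∑ 𝓕 λ G → κ F G * y F G
    𝔼-pairs κ x y e = begin
      𝔼 (λ π → ∑< n λ s → ∑ 𝓕 λ F → ∑ 𝓕 λ G → κ F G * x π F G s)
        ≡⟨ E-ext n ⊤ (λ π → ∑-swap (upTo n) 𝓕 _) ⟩
      𝔼 (λ π → ∑ 𝓕 λ F → ∑< n λ s → ∑ 𝓕 λ G → κ F G * x π F G s)
        ≡⟨ E-∑ n ⊤ 𝓕 (λ F π → ∑< n λ s → ∑ 𝓕 λ G → κ F G * x π F G s) ⟩
      ∑ 𝓕 (λ F → 𝔼 (λ π → ∑< n λ s → ∑ 𝓕 λ G → κ F G * x π F G s))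
        ≡⟨ ∑-cong 𝓕 (λ {F} _ → trans (𝔼-sum (κ F) (λ π G s → x π F G s))
             (trans (∑-cong 𝓕 λ {G} _ → when-positive (κ F G) e) (pull-n (κ F) (y F)))) ⟩
      ∑ 𝓕 (λ F → n * ∑ 𝓕 λ G → κ F G * y F G)
        ≡⟨ ∑-*ˡ n 𝓕 _ ⟩
      n * ∑ 𝓕 (λ F → ∑ 𝓕 λ G → κ F G * y F G) ∎
      where open ≡-Reasoning

  𝔼-τ₁ : 𝔼 (λ π → ∑< n (τ₁ π)) ≡ n * ∑ 𝓕 fines₁
  𝔼-τ₁ = 𝔼-pairs κ₁ (λ π F G s → hit π F s * hit π G (s + 0)) (λ F G → Φ G F) λ {F} {G} p →
    let _ , _ , _ , q = κ₁⁻ p ; G⊆F , G<F = lt⁻ q in hit-pair 0 G⊆F (<⇒≤ G<F)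

  𝔼-τ₂ : 𝔼 (λ π → ∑< n (τ₂ π)) ≡ n * ∑ 𝓕 fines₂
  𝔼-τ₂ = 𝔼-pairs κ₂ (λ π F G s → hit π F (s + 1) * hit π G s) (λ F G → Φ F G) λ {F} {G} p →
    let _ , _ , _ , q = κ₂⁻ p ; F⊆G , F<G = lt⁻ q in
    trans (E-ext n ⊤ λ π → ∑-cong (upTo n) λ {s} _ → *-comm (hit π F (s + 1)) (hit π G s)) (hit-pair 1 F⊆G F<G)

  𝔼-charged : 𝔼 charged ≡ n * ∑ 𝓕 (λ F → w F * (1 + mid F) * N F) + (pen₁ n * (n * ∑ 𝓕 fines₁) + pen₂ n * (n * ∑ 𝓕 fines₂))
  𝔼-charged = trans (E-+ n ⊤ _ _) (cong₂ _+_
    (trans (𝔼-sum (λ F → w F * (1 + mid F)) (λ π F s → hit π F s))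
      (trans (∑-cong 𝓕 λ {F} _ → cong (w F * (1 + mid F) *_) (hit-one F)) (pull-n (λ F → w F * (1 + mid F)) N)))
    (trans (E-+ n ⊤ _ _) (cong₂ _+_ (trans (E-* n ⊤ (pen₁ n) _) (cong (pen₁ n *_) 𝔼-τ₁))
                                    (trans (E-* n ⊤ (pen₂ n) _) (cong (pen₂ n *_) 𝔼-τ₂)))))

  -- For a middle set, `unique-below` and `unique-above` collapse `inside` and `around` to one cover
  -- each, which leaves the purely numerical `MiddleBound`.
  middle : ∀ {F} → F ∈ 𝓕 → w F * mid F * (inside F + around F) ≤ w F * mid F * N F + (pen₁ n * fines₁ F + pen₂ n * fines₂ F)
  middle {F} F∈ with 0 <? mid F
  ... | no m≮0 rewrite n≤0⇒n≡0 (≮⇒≥ m≮0) | *-zeroʳ (w F) = z≤n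
  ... | yes m with mid≡1 ← ≤-antisym (mid≤1 F) m
              with A , A∈ , a ← ∑-pos 𝓕 _ (proj₁ (mid⁻ {F} m)) | C , C∈ , c ← ∑-pos 𝓕 _ (proj₂ (mid⁻ {F} m)) = begin
    w F * mid F * (inside F + around F)
      ≡⟨ cong₂ _*_ (trans (cong (w F *_) mid≡1) (*-identityʳ (w F))) (cong₂ _+_ inside≡ around≡) ⟩
    w F * (suc (∣ F ∣ ∸ ∣ A ∣) * Φ A F + suc (∣ C ∣ ∸ ∣ F ∣) * Φ F C)
      ≤⟨ middle-bound (proj₁ (sizes A∈)) (proj₂ (lt⁻ a)) (proj₂ (lt⁻ c)) (proj₂ (sizes C∈)) ⟩
    w F * N F + (pen₁ n * (⟦ does (∣ F ∣ ≟ 3) ⟧ * ⟦ does (∣ A ∣ ≟ 2) ⟧ * Φ A F)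
               + pen₂ n * (⟦ does (∣ F ∣ ≟ n ∸ 3) ⟧ * ⟦ does (∣ C ∣ ≟ n ∸ 2) ⟧ * Φ F C))
      ≤⟨ +-mono-≤ (≤-reflexive (cong (_* N F) (sym (trans (cong (w F *_) mid≡1) (*-identityʳ (w F))))))
                  (+-mono-≤ (*-monoʳ-≤ (pen₁ n) fine₁) (*-monoʳ-≤ (pen₂ n) fine₂)) ⟩
    w F * mid F * N F + (pen₁ n * fines₁ F + pen₂ n * fines₂ F) ∎
    where
    open ≤-Reasoning
    A≡1 : lt A F ≡ 1
    A≡1 = ≤-antisym (lt≤1 A F) a
    C≡1 : lt F C ≡ 1
    C≡1 = ≤-antisym (lt≤1 F C) c
    inside≡ : inside F ≡ suc (∣ F ∣ ∸ ∣ A ∣) * Φ A F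
    inside≡ = trans (∑-only _ unique A∈ (λ {G} G∈ p → unique-below F∈ m G∈ A∈ (pos-*ˡ (lt G F) _ p) a))
                    (trans (cong (_* _) A≡1) (*-identityˡ _))
    around≡ : around F ≡ suc (∣ C ∣ ∸ ∣ F ∣) * Φ F C
    around≡ = trans (∑-only _ unique C∈ (λ {G} G∈ p → unique-above F∈ m G∈ C∈ (pos-*ˡ (lt F G) _ p) c))
                    (trans (cong (_* _) C≡1) (*-identityˡ _))
    fine₁ : ⟦ does (∣ F ∣ ≟ 3) ⟧ * ⟦ does (∣ A ∣ ≟ 2) ⟧ * Φ A F ≤ fines₁ F
    fine₁ = ≤-trans (≤-reflexive (cong (_* Φ A F) (trans (sym (only-1 (∣ F ∣ ≟ 3) (∣ A ∣ ≟ 2)))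
              (cong₂ (only (∣ F ∣ ≟ 3) (∣ A ∣ ≟ 2)) (sym mid≡1) (sym A≡1)))))
            (∑-term (λ G → κ₁ F G * Φ G F) A∈)
    fine₂ : ⟦ does (∣ F ∣ ≟ n ∸ 3) ⟧ * ⟦ does (∣ C ∣ ≟ n ∸ 2) ⟧ * Φ F C ≤ fines₂ F
    fine₂ = ≤-trans (≤-reflexive (cong (_* Φ F C) (trans (sym (only-1 (∣ F ∣ ≟ n ∸ 3) (∣ C ∣ ≟ n ∸ 2)))
              (cong₂ (only (∣ F ∣ ≟ n ∸ 3) (∣ C ∣ ≟ n ∸ 2)) (sym mid≡1) (sym C≡1)))))
            (∑-term (λ G → κ₂ F G * Φ F G) C∈)

  -- Summed over all orderings, `per-cycle` has the second count K of the middle sets and the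
  -- penalties P on its left. By `middle` the covers on its right cost no more than these same
  -- terms, which then cancel.
  weighted-count : n * ∑ 𝓕 (λ F → w F * N F) ≤ n ! * (2 * (n * n !))
  weighted-count = +-cancelʳ-≤ (n * K + P) _ _ (begin
    n * ∑ 𝓕 (λ F → w F * N F) + (n * K + P)
      ≡⟨ trans (sym (+-assoc (n * ∑ 𝓕 (λ F → w F * N F)) (n * K) P)) (cong (_+ P) (sym (*-distribˡ-+ n (∑ 𝓕 (λ F → w F * N F)) K))) ⟩
    n * (∑ 𝓕 (λ F → w F * N F) + K) + P
      ≡⟨ cong (λ x → n * x + P) (trans (sym (∑-+ 𝓕 _ _)) (∑-cong 𝓕 λ {F} _ → double (w F) (mid F) (N F))) ⟩
    n * ∑ 𝓕 (λ F → w F * (1 + mid F) * N F) + P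
      ≡⟨ 𝔼-charged ⟨
    𝔼 charged
      ≤⟨ E-mono n ⊤ (size-⊤ n) (λ π o → per-cycle o) ⟩
    𝔼 (λ π → 2 * (n * n !) + covers π)
      ≡⟨ trans (E-+ n ⊤ _ _) (cong₂ _+_ (E-const n ⊤ _ (size-⊤ n)) 𝔼-covers) ⟩
    n ! * (2 * (n * n !)) + n * ∑ 𝓕 (λ F → w F * mid F * (inside F + around F))
      ≤⟨ +-monoʳ-≤ (n ! * (2 * (n * n !))) (*-monoʳ-≤ n (∑-mono 𝓕 middle)) ⟩
    n ! * (2 * (n * n !)) + n * ∑ 𝓕 (λ F → w F * mid F * N F + (pen₁ n * fines₁ F + pen₂ n * fines₂ F))
      ≡⟨ cong (n ! * (2 * (n * n !)) +_) (trans (cong (n *_) (trans (∑-+ 𝓕 _ _) (cong (K +_) (trans (∑-+ 𝓕 _ _)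
           (cong₂ _+_ (∑-*ˡ (pen₁ n) 𝓕 fines₁) (∑-*ˡ (pen₂ n) 𝓕 fines₂)))))) (distribute n K (pen₁ n) (∑ 𝓕 fines₁) (pen₂ n) (∑ 𝓕 fines₂))) ⟩
    n ! * (2 * (n * n !)) + (n * K + P) ∎)
    where
    open ≤-Reasoning
    K = ∑ 𝓕 λ F → w F * mid F * N F
    P = pen₁ n * (n * ∑ 𝓕 fines₁) + pen₂ n * (n * ∑ 𝓕 fines₂)
    double : ∀ w m N → w * N + w * m * N ≡ w * (1 + m) * N
    double = solve-∀
    distribute : ∀ n k a f b g → n * (k + (a * f + b * g)) ≡ n * k + (a * (n * f) + b * (n * g))
    distribute = solve-∀

-- Passage to the rationals

chains : ℕ → ℕ → ℕ
chains n k = k ! * (n ∸ k) !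

-- For l ≤ n this is n! times `weight n l`, because 1 / C(n,k) is k! (n - k)! / n!. All weights thus
-- get the common denominator n!.
weighted-chains : ℕ → ℕ → ℕ
weighted-chains n l with 2 * l ≤? n
... | yes _ = chains n (l ∸ 1)
... | no _  = chains n l

binomial-chains : ∀ {n k} → k ≤ n → (n C k) * chains n k ≡ n !
binomial-chains {n} {k} k≤n = trans (cong (_* chains n k) (nCk≡n!/k![n-k]! k≤n))
  (m/n*n≡m {{m*n≢0 (k !) ((n ∸ k) !) {{k !≢0}} {{(n ∸ k) !≢0}}}} (k![n∸k]!∣n! k≤n))

W-chains : ∀ {n l} → 0 < l → l ≤ n → W n l * chains n l ≡ n ! * weighted-chains n l
W-chains {n} {l@(suc k)} 0<l l≤n with 2 * l ≤? n
... | no _ = refl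
... | yes 2l≤n = begin
  W′ * (l * k ! * (n ∸ l) !)             ≡⟨ regroup W′ l (k !) ((n ∸ l) !) ⟩
  W′ * l * (k ! * (n ∸ l) !)             ≡⟨ cong (_* (k ! * (n ∸ l) !)) (trans (cong (_* l) (sym W≡)) (W-small 0<l 2l≤n)) ⟩
  (n ∸ k) * n ! * (k ! * (n ∸ l) !)      ≡⟨ regroup′ (n ∸ k) (n !) (k !) ((n ∸ l) !) ⟩
  n ! * (k ! * ((n ∸ k) * (n ∸ l) !))    ≡⟨ cong (λ x → n ! * (k ! * x)) factorial ⟩
  n ! * (k ! * (n ∸ k) !)                ∎
  where
  open ≡-Reasoning
  W′ = (n ∸ k) * (n ! ℕ./ l)
  W≡ : W n l ≡ W′
  W≡ with 2 * l ≤? n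
  ... | yes _ = refl
  ... | no 2l≰n = ⊥-elim (2l≰n 2l≤n)
  factorial : (n ∸ k) * (n ∸ l) ! ≡ (n ∸ k) !
  factorial rewrite +-∸-assoc 1 l≤n = refl
  regroup : ∀ w l k r → w * (l * k * r) ≡ w * l * (k * r)
  regroup = solve-∀
  regroup′ : ∀ a d k r → a * d * (k * r) ≡ d * (k * (a * r))
  regroup′ = solve-∀

module _ {n d} (n!≡ : n ! ≡ suc d) where

  inv-binomial : ∀ {k} → k ≤ n → toℚᵘ (inv (n C k)) ≃ mkℚᵘ (ℤ.+ chains n k) d
  inv-binomial {k} k≤n with n C k | binomial-chains k≤n
  ... | zero  | e with () ← trans e n!≡
  ... | suc m | e = ℚᵘ.≃-trans (Q.toℚᵘ-fromℚᵘ (mkℚᵘ (ℤ.+ 1) m)) (*≡* (begin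
    ℤ.+ 1 ℤ.* ℤ.+ suc d             ≡⟨ ℤ.*-identityˡ (ℤ.+ suc d) ⟩
    ℤ.+ suc d                       ≡⟨ cong ℤ.+_ (trans (sym n!≡) (trans (sym e) (*-comm (suc m) (chains n k)))) ⟩
    ℤ.+ (chains n k * suc m)        ≡⟨ ℤ.pos-* (chains n k) (suc m) ⟩
    ℤ.+ chains n k ℤ.* ℤ.+ suc m    ∎))
    where open ≡-Reasoning

  weight-chains : ∀ {l} → l ≤ n → toℚᵘ (weight n l) ≃ mkℚᵘ (ℤ.+ weighted-chains n l) d
  weight-chains {l} l≤n with 2 * l ≤? n
  ... | yes _ = inv-binomial (≤-trans (m∸n≤m l 1) l≤n)
  ... | no _  = inv-binomial l≤n

  mkℚᵘ-+ : ∀ a b → mkℚᵘ (ℤ.+ a) d ℚᵘ.+ mkℚᵘ (ℤ.+ b) d ≃ mkℚᵘ (ℤ.+ (a + b)) d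
  mkℚᵘ-+ a b = *≡* (distribute (ℤ.+ a) (ℤ.+ b) (ℤ.+ suc d))
    where
    distribute : ∀ a b c → (a ℤ.* c ℤ.+ b ℤ.* c) ℤ.* c ≡ (a ℤ.+ b) ℤ.* (c ℤ.* c)
    distribute = ℤSolver.solve-∀

  lhs-chains : ∀ (𝓕 : List (Subset n)) → (∀ {F} → F ∈ 𝓕 → ∣ F ∣ ≤ n) →
               toℚᵘ (lhs 𝓕) ≃ mkℚᵘ (ℤ.+ ∑ 𝓕 λ F → weighted-chains n ∣ F ∣) d
  lhs-chains [] _ = *≡* refl
  lhs-chains (F ∷ 𝓕) h = ℚᵘ.≃-trans (Q.toℚᵘ-homo-+ (weight n ∣ F ∣) (lhs 𝓕))
    (ℚᵘ.≃-trans (ℚᵘ.+-cong (weight-chains (h (here refl))) (lhs-chains 𝓕 (h ∘ there)))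
                (mkℚᵘ-+ (weighted-chains n ∣ F ∣) _))

module _ {n} (𝓕 : List (Subset n)) (unique : Unique 𝓕) (intersecting : Intersecting 𝓕) (bfree : BFree 𝓕)
         (sizes : ∀ {F} → F ∈ 𝓕 → 2 ≤ ∣ F ∣ × ∣ F ∣ + 2 ≤ n) where

  private
    open Average 𝓕 unique intersecting bfree sizes using (weighted-count)

    total : ℕ
    total = ∑ 𝓕 λ F → weighted-chains n ∣ F ∣

    ∣∣≤n : ∀ {F} → F ∈ 𝓕 → ∣ F ∣ ≤ n
    ∣∣≤n F∈ = ≤-trans (m≤m+n _ 2) (proj₂ (sizes F∈))

  chains-bound : 0 < n → total ≤ 2 * n !
  chains-bound 0<n = *-cancelˡ-≤ (n * n !) {{m*n≢0 n (n !) {{ℕ.>-nonZero 0<n}} {{n !≢0}}}} (begin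
    n * n ! * total                                            ≡⟨ *-assoc n (n !) total ⟩
    n * (n ! * total)                                          ≡⟨ cong (n *_) (∑-*ˡ (n !) 𝓕 _) ⟨
    n * ∑ 𝓕 (λ F → n ! * weighted-chains n ∣ F ∣)              ≡⟨ cong (n *_) (∑-cong 𝓕 λ {F} F∈ →
                                                                    W-chains {n} {∣ F ∣} (≤-trans (s≤s z≤n) (proj₁ (sizes F∈))) (∣∣≤n F∈)) ⟨
    n * ∑ 𝓕 (λ F → W n ∣ F ∣ * chains n ∣ F ∣)                 ≤⟨ weighted-count ⟩
    n ! * (2 * (n * n !))                                      ≡⟨ regroup (n !) n ⟩
    n * n ! * (2 * n !)                                        ∎)
    where
    open ≤-Reasoning
    regroup : ∀ d n → d * (2 * (n * d)) ≡ n * d * (2 * d)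
    regroup = solve-∀

  lhs≤2 : 0 < n → lhs 𝓕 Q.≤ ℤ.+ 2 Q./ 1
  lhs≤2 0<n = Q.toℚᵘ-cancel-≤ (ℚᵘ.≤-respˡ-≃ (ℚᵘ.≃-sym (lhs-chains n!≡ 𝓕 ∣∣≤n)) (*≤* (begin
    ℤ.+ total ℤ.* ℤ.+ 1    ≡⟨ ℤ.*-identityʳ (ℤ.+ total) ⟩
    ℤ.+ total              ≤⟨ ℤ.+≤+ (chains-bound 0<n) ⟩
    ℤ.+ (2 * n !)          ≡⟨ cong (λ x → ℤ.+ (2 * x)) n!≡ ⟩
    ℤ.+ (2 * suc d)        ≡⟨ ℤ.pos-* 2 (suc d) ⟩
    ℤ.+ 2 ℤ.* ℤ.+ suc d    ∎)))
    where
    open ℤ.≤-Reasoning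
    d = ℕ.pred (n !)
    n!≡ : n ! ≡ suc d
    n!≡ = sym (suc-pred (n !) {{n !≢0}})

theorem10 : (n : ℕ) (𝓕 : List (Subset n)) → Unique 𝓕 → Intersecting 𝓕 → BFree 𝓕 →
    (∀ {F} → F ∈ 𝓕 → 2 ≤ ∣ F ∣ × ∣ F ∣ + 2 ≤ n) → lhs 𝓕 Q.≤ (Data.Integer.+ 2 Q./ 1)
-- The empty family is separated because only a member forces n to be positive, and `chains-bound`
-- cancels a factor n.
theorem10 n [] unique intersecting bfree sizes = Q.*≤* (ℤ.+≤+ z≤n)
theorem10 n 𝓕@(F ∷ _) unique intersecting bfree sizes =
  lhs≤2 𝓕 unique intersecting bfree sizes (≤-trans (≤-trans (s≤s z≤n) (m≤n+m 2 ∣ F ∣)) (proj₂ (sizes (here refl))))
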